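{- Let $p$ be an odd prime with $p\notin E$, where $E=\{3,5,7,11,13,17,19,23,29,31,37,41,43,47,53,59,61,67,71,73,79,97,101,103,109,127,131,139,151,157,163,181,193,199,211,223,229,241,271,277,281,283,307,313,331,337,349,367,373,379,397,409,421,457,463,541,547,571,601,613,631,661,673,691,727,751,757,811,859,883,967,991,1009,1021,1051,1093,1171,1201,1231,1291,1321,1381,1471,1531,1951,2311,2521,2731,3361,3571,4621,4831,10711,11971,14281,17851,35911\}$, and let $F$ be the field with $p$ elements. Then for every polynomial $f(x)\in F[x]$ of degree $4$ that has nonzero constant term and is not of the form $\alpha g(x)^2$ (with $\alpha\in F$, $g(x)\in F[x]$), there exists a primitive root $\beta\in F$ (a generator of the multiplicative group $F\setminus\{0\}$) such that $f(\beta)$ is a square in $F$.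
   Context: The set $E$ is the set of primes listed as exceptions in two tables of the paper. -}

module Defs where

open import Data.Nat using (ℕ; zero; suc; _+_; _*_; _^_; _≤_; _<_; NonZero)
open import Data.Nat.DivMod using (_%_)
open import Data.List using (List; []; _∷_; map)
open import Data.Product using (∃; ∃-syntax; _×_)
open import Relation.Binary.PropositionalEquality using (_≡_)
open import Relation.Nullary using (¬_)

E : List ℕ
E = 3 ∷ 5 ∷ 7 ∷ 11 ∷ 13 ∷ 17 ∷ 19 ∷ 23 ∷ 29 ∷ 31 ∷ 37 ∷ 41 ∷ 43 ∷ 47 ∷ 53 ∷ 59 ∷ 61 ∷ 67 ∷ 71 ∷ 73 ∷ 79 ∷ 97 ∷ 101 ∷ 103 ∷ 109 ∷ 127 ∷ 131 ∷ 139 ∷ 151 ∷ 157 ∷ 163 ∷ 181 ∷ 193 ∷ 199 ∷ 211 ∷ 223 ∷ 229 ∷ 241 ∷ 271 ∷ 277 ∷ 281 ∷ 283 ∷ 307 ∷ 313 ∷ 331 ∷ 337 ∷ 349 ∷ 367 ∷ 373 ∷ 379 ∷ 397 ∷ 409 ∷ 421 ∷ 457 ∷ 463 ∷ 541 ∷ 547 ∷ 571 ∷ 601 ∷ 613 ∷ 631 ∷ 661 ∷ 673 ∷ 691 ∷ 727 ∷ 751 ∷ 757 ∷ 811 ∷ 859 ∷ 883 ∷ 967 ∷ 991 ∷ 1009 ∷ 1021 ∷ 1051 ∷ 1093 ∷ 1171 ∷ 1201 ∷ 1231 ∷ 1291 ∷ 1321 ∷ 1381 ∷ 1471 ∷ 1531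 ∷ 1951 ∷ 2311 ∷ 2521 ∷ 2731 ∷ 3361 ∷ 3571 ∷ 4621 ∷ 4831 ∷ 10711 ∷ 11971 ∷ 14281 ∷ 17851 ∷ 35911 ∷ []

-- The field F = 𝔽_p is modelled by ℕ with arithmetic modulo p;
-- elements of F are the residues 0 ≤ x < p, and equality in F of
-- natural numbers a, b is  a % p ≡ b % p.

-- Polynomials over F: coefficient lists, lowest degree first
-- (a₀ ∷ a₁ ∷ … ), coefficients read modulo p.
Poly : Set
Poly = List ℕ

coeff : Poly → ℕ → ℕ
coeff []       _       = 0
coeff (a ∷ _)  zero    = a
coeff (_ ∷ as) (suc i) = coeff as i

_+ₚ_ : Poly → Poly → Poly
[]       +ₚ q        = q
(a ∷ as) +ₚ []       = a ∷ as
(a ∷ as) +ₚ (b ∷ bs) = (a + b) ∷ (as +ₚ bs)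

scale : ℕ → Poly → Poly
scale c = map (c *_)

_*ₚ_ : Poly → Poly → Poly
[]       *ₚ q = []
(a ∷ as) *ₚ q = scale a q +ₚ (0 ∷ (as *ₚ q))

PolyEq : (p : ℕ) .{{_ : NonZero p}} → Poly → Poly → Set
PolyEq p f g = ∀ i → coeff f i % p ≡ coeff g i % p

-- Evaluation (Horner), as a natural number; reduce modulo p to get the value in F.
eval : Poly → ℕ → ℕ
eval []       x = 0
eval (a ∷ as) x = a + x * eval as x

quartic : ℕ → ℕ → ℕ → ℕ → ℕ → Poly
quartic a₀ a₁ a₂ a₃ a₄ = a₀ ∷ a₁ ∷ a₂ ∷ a₃ ∷ a₄ ∷ []

IsConstTimesSquare : (p : ℕ) .{{_ : NonZero p}} → Poly → Set
IsConstTimesSquare p f = ∃[ α ] ∃[ g ] PolyEq p f (scale α (g *ₚ g))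

-- a is a square in F (0 = 0² counts as a square).
IsSquareMod : (p : ℕ) .{{_ : NonZero p}} → ℕ → Set
IsSquareMod p a = ∃[ y ] (y * y) % p ≡ a % p

IsPrimitiveRoot : (p : ℕ) .{{_ : NonZero p}} → ℕ → Set
IsPrimitiveRoot p β =
  (β % p ≡ 0 → Data.Empty.⊥) ×
  (∀ y → 1 ≤ y → y < p → ∃[ k ] (β ^ k) % p ≡ y)
  where import Data.Empty

{-# OPTIONS --safe #-}
module Submission where

-- Suppose f(x) is a nonsquare at every primitive root x.  Stepanov's method bounds the number of
-- such x without Weil's theorem.  Write p − 1 = m n and e = (p + 1)/2.  At a primitive root xⁿ is
-- one of the φ(m) primitive m-th roots of unity ζ and f(x)ᵉ = − f(x), so the auxiliary polynomial
-- R = Σ x^{kn} A_k + fᵉ Σ x^{kn} D_k and its Euler derivatives take there the values of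
-- polynomials of small degree whose coefficients are linear in the unknown A_k, D_k.  Killing those
-- makes R vanish to order 2h at every primitive root, and fewer conditions than unknowns leave a
-- nonzero choice.  R itself is then nonzero, because R = 0 would give A₀² = c f D₀² for the lowest
-- blocks and make f a constant times a square.  Comparing 2h φ(p − 1) with deg R is a contradiction
-- for suitable m: m omits the two largest primes of p − 1 if the second one is at least 23, and
-- otherwise the largest one if p − 1 has a large enough cofactor.  The finitely many families left
-- over are checked by evaluation.

-- Zeros are available at primitive roots only, and φ(p - 1) is at most half of p - 1, so treating
-- the whole group at once (m = 1) is hopeless. One more unit of h adds 2 φ(p - 1) zeros, while the
-- φ(m) further pairs of blocks that pay for its conditions add φ(m) n to the degree. As φ(p - 1) is
-- φ(m) n times the product of the factors 1 - 1/l over the primes l that do not divide m, the gain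
-- exceeds the cost exactly when twice this product is greater than 1. Hence 2 has to divide m, and
-- the primes to omit are the largest ones. In the other direction, the degree of f^e is about 2 m
-- n, so h must reach a multiple of m/φ(m) before the zeros catch up, and the dimension count 4 φ(m)
-- h² < m n then wants n large compared with m/φ(m). Two omitted primes of size at least 23
-- guarantee this; a single one needs help from the cofactor.

open import Algebra.Bundles using (CommutativeRing)

-- A ring solver with integer coefficients for any commutative ring.

module IntegerCoefficients {c ℓ} (R : CommutativeRing c ℓ) where

  open import Algebra.Bundles using (RawRing)
  open import Algebra.Solver.Ring.AlmostCommutativeRing using (fromCommutativeRing; _-Raw-AlmostCommutative⟶_)
  open import Data.Integer.Base as ℤ using (ℤ; +_; -[1+_]; _⊖_)
  import Data.Integer.Properties as ℤₚ
  open import Data.Maybe.Base using (Maybe; just; nothing)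
  open import Data.Nat.Base as ℕ using (ℕ; zero; suc)
  import Data.Nat.Properties as ℕₚ
  open import Relation.Binary.PropositionalEquality.Core as ≡ using (_≡_)
  open import Relation.Nullary.Decidable using (yes; no)
  open CommutativeRing R
  open import Algebra.Properties.Ring ring using (-‿distribˡ-*; -‿distribʳ-*; -0#≈0#; -‿involutive)
  open import Algebra.Properties.AbelianGroup +-abelianGroup using (⁻¹-∙-comm)
  open import Algebra.Properties.Semiring.Mult semiring using (_×_; ×-homo-+; ×1-homo-*)
  open import Relation.Binary.Reasoning.Setoid setoid

  private
    -- Cancelling x - x in a normal form needs decidable equality of coefficients. With coefficients
    -- in ℤ that is evaluation, whatever R is.
    fromℤ : ℤ → Carrier
    fromℤ (+ n)    = n × 1#
    fromℤ -[1+ n ] = - (suc n × 1#)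

    cancel : ∀ x y z → (x + y) - (x + z) ≈ y - z
    cancel x y z = begin
      (x + y) - (x + z)       ≈⟨ +-congˡ (⁻¹-∙-comm x z) ⟨
      (x + y) + (- x - z)     ≈⟨ +-congʳ (+-comm x y) ⟩
      (y + x) + (- x - z)     ≈⟨ +-assoc y x _ ⟩
      y + (x + (- x - z))     ≈⟨ +-congˡ (+-assoc x _ _) ⟨
      y + ((x - x) - z)       ≈⟨ +-congˡ (+-congʳ (-‿inverseʳ x)) ⟩
      y + (0# - z)            ≈⟨ +-congˡ (+-identityˡ _) ⟩
      y - z                   ∎

    fromℤ-⊖ : ∀ m n → fromℤ (m ⊖ n) ≈ (m × 1#) - (n × 1#)
    fromℤ-⊖ m zero = sym (trans (+-congˡ -0#≈0#) (+-identityʳ _))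
    fromℤ-⊖ zero (suc n) = sym (+-identityˡ _)
    fromℤ-⊖ (suc m) (suc n) = begin
      fromℤ (suc m ⊖ suc n)               ≡⟨ ≡.cong fromℤ (ℤₚ.[1+m]⊖[1+n]≡m⊖n m n) ⟩
      fromℤ (m ⊖ n)                       ≈⟨ fromℤ-⊖ m n ⟩
      (m × 1#) - (n × 1#)                 ≈⟨ cancel 1# _ _ ⟨
      (suc m × 1#) - (suc n × 1#)         ∎

    fromℤ-+ : ∀ i j → fromℤ (i ℤ.+ j) ≈ fromℤ i + fromℤ j
    fromℤ-+ (+ m)    (+ n)    = ×-homo-+ 1# m n
    fromℤ-+ (+ m)    -[1+ n ] = fromℤ-⊖ m (suc n)
    fromℤ-+ -[1+ m ] (+ n)    = trans (fromℤ-⊖ n (suc m)) (+-comm _ _)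
    fromℤ-+ -[1+ m ] -[1+ n ] = begin
      - (suc (suc (m ℕ.+ n)) × 1#)        ≡⟨ ≡.cong (λ k → - (suc k × 1#)) (ℕₚ.+-suc m n) ⟨
      - ((suc m ℕ.+ suc n) × 1#)          ≈⟨ -‿cong (×-homo-+ 1# (suc m) (suc n)) ⟩
      - ((suc m × 1#) + (suc n × 1#))     ≈⟨ ⁻¹-∙-comm _ _ ⟨
      - (suc m × 1#) - (suc n × 1#)       ∎

    fromℤ-neg : ∀ i → fromℤ (ℤ.- i) ≈ - fromℤ i
    fromℤ-neg (+ zero)  = sym -0#≈0#
    fromℤ-neg (+ suc n) = refl
    fromℤ-neg -[1+ n ]  = sym (-‿involutive _)

    fromℤ-pos-* : ∀ m j → fromℤ (+ m ℤ.* j) ≈ fromℤ (+ m) * fromℤ j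
    fromℤ-pos-* m (+ n) = trans (reflexive (≡.cong fromℤ (≡.sym (ℤₚ.pos-* m n)))) (×1-homo-* m n)
    fromℤ-pos-* m -[1+ n ] = begin
      fromℤ (+ m ℤ.* -[1+ n ])            ≡⟨ ≡.cong fromℤ (ℤₚ.neg-distribʳ-* (+ m) (+ suc n)) ⟨
      fromℤ (ℤ.- (+ m ℤ.* + suc n))       ≈⟨ fromℤ-neg (+ m ℤ.* + suc n) ⟩
      - fromℤ (+ m ℤ.* + suc n)           ≈⟨ -‿cong (fromℤ-pos-* m (+ suc n)) ⟩
      - (fromℤ (+ m) * fromℤ (+ suc n))   ≈⟨ -‿distribʳ-* _ _ ⟩
      fromℤ (+ m) * - fromℤ (+ suc n)     ∎

    fromℤ-* : ∀ i j → fromℤ (i ℤ.* j) ≈ fromℤ i * fromℤ j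
    fromℤ-* (+ m) j = fromℤ-pos-* m j
    fromℤ-* -[1+ m ] j = begin
      fromℤ (-[1+ m ] ℤ.* j)              ≡⟨ ≡.cong fromℤ (ℤₚ.neg-distribˡ-* (+ suc m) j) ⟨
      fromℤ (ℤ.- (+ suc m ℤ.* j))         ≈⟨ fromℤ-neg (+ suc m ℤ.* j) ⟩
      - fromℤ (+ suc m ℤ.* j)             ≈⟨ -‿cong (fromℤ-pos-* (suc m) j) ⟩
      - (fromℤ (+ suc m) * fromℤ j)       ≈⟨ -‿distribˡ-* _ _ ⟩
      - fromℤ (+ suc m) * fromℤ j         ∎

    rawℤ : RawRing _ _
    rawℤ = record { Carrier = ℤ ; _≈_ = _≡_ ; _+_ = ℤ._+_ ; _*_ = ℤ._*_ ; -_ = ℤ.-_ ; 0# = + 0 ; 1# = + 1 }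

    morphism : rawℤ -Raw-AlmostCommutative⟶ fromCommutativeRing R
    morphism = record
      { ⟦_⟧ = fromℤ ; +-homo = fromℤ-+ ; *-homo = fromℤ-* ; -‿homo = fromℤ-neg
      ; 0-homo = refl ; 1-homo = +-identityʳ 1# }

    _≟ᶜ_ : ∀ i j → Maybe (fromℤ i ≈ fromℤ j)
    i ≟ᶜ j with i ℤₚ.≟ j
    ... | yes i≡j = just (reflexive (≡.cong fromℤ i≡j))
    ... | no _    = nothing

  open import Algebra.Solver.Ring rawℤ (fromCommutativeRing R) morphism _≟ᶜ_ public
    using (solve; _:=_; _:+_; _:*_; :-_)

open import Algebra.Structures using (IsCommutativeRing)
open import Data.Product using (∃; ∃-syntax; _×_; _,_; proj₁; proj₂)
open import Level using (0ℓ)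
open import Relation.Binary.Definitions using (DecidableEquality)
open import Relation.Binary.PropositionalEquality using (_≡_; _≢_; refl; sym; trans; cong; cong₂; subst; subst₂; module ≡-Reasoning)
open import Relation.Nullary using (¬_; Dec; yes; no; contradiction)

record DecidableField : Set₁ where
  infixl 7 _*_
  infixl 6 _+_
  infix 8 -_
  field
    F                 : Set
    _+_ _*_           : F → F → F
    -_                : F → F
    0# 1#             : F
    isCommutativeRing : IsCommutativeRing _≡_ _+_ _*_ -_ 0# 1#
    _≟_               : DecidableEquality F
    1≢0               : 1# ≢ 0#
    invertible        : ∀ x → x ≢ 0# → ∃ λ y → x * y ≡ 1#

  commutativeRing : CommutativeRing 0ℓ 0ℓ
  commutativeRing = record { isCommutativeRing = isCommutativeRing }

-- Polynomials over a field and the Euler operator.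

module Polynomials (𝕂 : DecidableField) where

  open import Data.List.Base using (List; []; _∷_; map)
  open import Data.Nat.Base as ℕ using (ℕ; zero; suc)
  open DecidableField 𝕂 public
  open IsCommutativeRing isCommutativeRing public
    using (+-identityˡ; +-identityʳ; *-identityˡ; *-identityʳ; zeroˡ; zeroʳ; -‿inverseˡ; -‿inverseʳ; +-comm; *-comm; +-assoc; *-assoc; distribˡ; distribʳ)
  open IntegerCoefficients commutativeRing public using ()
    renaming (solve to solveᶠ; _:=_ to _≔ᶠ_; _:+_ to _+ᶠ_; _:*_ to _*ᶠ_; :-_ to -ᶠ_)
  open import Algebra.Properties.Ring (CommutativeRing.ring commutativeRing) using (-0#≈0#)

  integral : ∀ {x y} → x * y ≡ 0# → x ≢ 0# → y ≡ 0#
  integral {x} {y} xy≡0 x≢0 with invertible x x≢0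
  ... | z , xz≡1 = begin
    y             ≡⟨ *-identityˡ y ⟨
    1# * y        ≡⟨ cong (_* y) xz≡1 ⟨
    (x * z) * y   ≡⟨ solveᶠ 3 (λ x y z → (x *ᶠ z) *ᶠ y ≔ᶠ z *ᶠ (x *ᶠ y)) refl x y z ⟩
    z * (x * y)   ≡⟨ cong (z *_) xy≡0 ⟩
    z * 0#        ≡⟨ zeroʳ z ⟩
    0#            ∎
    where open ≡-Reasoning

  *-nonzero : ∀ {x y} → x ≢ 0# → y ≢ 0# → x * y ≢ 0#
  *-nonzero x≢0 y≢0 xy≡0 = y≢0 (integral xy≡0 x≢0)

  infixr 8 _^_
  _^_ : F → ℕ → F
  x ^ zero = 1#
  x ^ suc n = x * x ^ n

  ι : ℕ → F
  ι zero = 0#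
  ι (suc n) = 1# + ι n

  Poly : Set
  Poly = List F

  coeff : Poly → ℕ → F
  coeff []       _       = 0#
  coeff (a ∷ _)  zero    = a
  coeff (_ ∷ as) (suc i) = coeff as i

  infix 4 _≈_
  -- Lists may end in zeros, so equality is coefficientwise; wrapping it in a record lets f and g be
  -- inferred from a proof.
  record _≈_ (f g : Poly) : Set where
    constructor mk≈
    field at : ∀ i → coeff f i ≡ coeff g i
  open _≈_ public

  ≈-refl : ∀ {f} → f ≈ f
  ≈-refl .at _ = refl

  ≈-sym : ∀ {f g} → f ≈ g → g ≈ f
  ≈-sym p .at i = sym (p .at i)

  ≈-trans : ∀ {f g h} → f ≈ g → g ≈ h → f ≈ h
  ≈-trans p q .at i = trans (p .at i) (q .at i)

  tail-≈ : ∀ {a b as bs} → a ∷ as ≈ b ∷ bs → as ≈ bs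
  tail-≈ p .at i = p .at (suc i)

  ∷-cong : ∀ {a b as bs} → a ≡ b → as ≈ bs → a ∷ as ≈ b ∷ bs
  ∷-cong p q .at zero = p
  ∷-cong p q .at (suc i) = q .at i

  []≈∷ : ∀ {a as} → a ≡ 0# → [] ≈ as → [] ≈ a ∷ as
  []≈∷ p q .at zero = sym p
  []≈∷ p q .at (suc i) = q .at i

  []≈tail : ∀ {a as} → [] ≈ a ∷ as → [] ≈ as
  []≈tail p .at i = p .at (suc i)

  infixl 6 _⊕_
  infixl 7 _⊛_ _·_
  infix 8 ⊖_

  -- Opacity makes the operations atoms for the unifier and for the ring solver.
  opaque
    _⊕_ : Poly → Poly → Poly
    []       ⊕ g        = g
    (a ∷ as) ⊕ []       = a ∷ as
    (a ∷ as) ⊕ (b ∷ bs) = (a + b) ∷ (as ⊕ bs)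

    _·_ : F → Poly → Poly
    a · f = map (a *_) f

    ⊖_ : Poly → Poly
    ⊖ f = map -_ f

    _⊛_ : Poly → Poly → Poly
    []       ⊛ g = []
    (a ∷ as) ⊛ g = (a · g) ⊕ (0# ∷ (as ⊛ g))

    coeff-⊕ : ∀ f g i → coeff (f ⊕ g) i ≡ coeff f i + coeff g i
    coeff-⊕ []       g        i       = sym (+-identityˡ _)
    coeff-⊕ (a ∷ as) []       i       = sym (+-identityʳ _)
    coeff-⊕ (a ∷ as) (b ∷ bs) zero    = refl
    coeff-⊕ (a ∷ as) (b ∷ bs) (suc i) = coeff-⊕ as bs i

    coeff-· : ∀ a f i → coeff (a · f) i ≡ a * coeff f i
    coeff-· a []       i       = sym (zeroʳ a)
    coeff-· a (b ∷ bs) zero    = refl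
    coeff-· a (b ∷ bs) (suc i) = coeff-· a bs i

    coeff-⊖ : ∀ f i → coeff (⊖ f) i ≡ - coeff f i
    coeff-⊖ []       i       = sym -0#≈0#
    coeff-⊖ (b ∷ bs) zero    = refl
    coeff-⊖ (b ∷ bs) (suc i) = coeff-⊖ bs i

    coeff-⊛-zero : ∀ a as g → coeff ((a ∷ as) ⊛ g) 0 ≡ a * coeff g 0
    coeff-⊛-zero a as g = trans (coeff-⊕ (a · g) _ 0) (trans (+-identityʳ _) (coeff-· a g 0))

    coeff-⊛-suc : ∀ a as g i → coeff ((a ∷ as) ⊛ g) (suc i) ≡ a * coeff g (suc i) + coeff (as ⊛ g) i
    coeff-⊛-suc a as g i = trans (coeff-⊕ (a · g) _ (suc i)) (cong (_+ coeff (as ⊛ g) i) (coeff-· a g (suc i)))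

    ⊕-cong : ∀ {f f′ g g′} → f ≈ f′ → g ≈ g′ → f ⊕ g ≈ f′ ⊕ g′
    ⊕-cong {f} {f′} {g} {g′} p q .at i =
      trans (coeff-⊕ f g i) (trans (cong₂ _+_ (p .at i) (q .at i)) (sym (coeff-⊕ f′ g′ i)))

    ⊖-cong : ∀ {f f′} → f ≈ f′ → ⊖ f ≈ ⊖ f′
    ⊖-cong {f} {f′} p .at i = trans (coeff-⊖ f i) (trans (cong -_ (p .at i)) (sym (coeff-⊖ f′ i)))

    private
      ⊕-assoc : ∀ f g h → (f ⊕ g) ⊕ h ≈ f ⊕ (g ⊕ h)
      ⊕-assoc f g h .at i
        rewrite coeff-⊕ (f ⊕ g) h i | coeff-⊕ f g i | coeff-⊕ f (g ⊕ h) i | coeff-⊕ g h i = +-assoc _ _ _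

      ⊕-comm : ∀ f g → f ⊕ g ≈ g ⊕ f
      ⊕-comm f g .at i rewrite coeff-⊕ f g i | coeff-⊕ g f i = +-comm _ _

      ⊕-identityˡ : ∀ f → [] ⊕ f ≈ f
      ⊕-identityˡ f = ≈-refl

      ⊕-identityʳ : ∀ f → f ⊕ [] ≈ f
      ⊕-identityʳ f .at i = trans (coeff-⊕ f [] i) (+-identityʳ _)

      ⊖-inverseʳ : ∀ f → f ⊕ (⊖ f) ≈ []
      ⊖-inverseʳ f .at i rewrite coeff-⊕ f (⊖ f) i | coeff-⊖ f i = -‿inverseʳ _

      ⊛-zeroˡ : ∀ f g → [] ≈ f → [] ≈ f ⊛ g
      ⊛-zeroˡ []       g p = ≈-refl
      ⊛-zeroˡ (a ∷ as) g p .at zero =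
        sym (trans (coeff-⊛-zero a as g) (trans (cong (_* _) (sym (p .at 0))) (zeroˡ _)))
      ⊛-zeroˡ (a ∷ as) g p .at (suc i) =
        sym (trans (coeff-⊛-suc a as g i)
            (trans (cong₂ _+_ (trans (cong (_* _) (sym (p .at 0))) (zeroˡ _)) (sym (⊛-zeroˡ as g ([]≈tail p) .at i)))
                   (+-identityʳ _)))

      ⊛-zeroʳ : ∀ f → f ⊛ [] ≈ []
      ⊛-zeroʳ [] = ≈-refl
      ⊛-zeroʳ (a ∷ as) .at zero = refl
      ⊛-zeroʳ (a ∷ as) .at (suc i) = ⊛-zeroʳ as .at i

      ⊛-congʳ : ∀ f f′ g → f ≈ f′ → f ⊛ g ≈ f′ ⊛ g
      ⊛-congʳ []       f′       g p = ⊛-zeroˡ f′ g p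
      ⊛-congʳ (a ∷ as) []       g p = ≈-sym (⊛-zeroˡ (a ∷ as) g (≈-sym p))
      ⊛-congʳ (a ∷ as) (b ∷ bs) g p .at zero =
        trans (coeff-⊛-zero a as g) (trans (cong (_* _) (p .at 0)) (sym (coeff-⊛-zero b bs g)))
      ⊛-congʳ (a ∷ as) (b ∷ bs) g p .at (suc i) =
        trans (coeff-⊛-suc a as g i)
          (trans (cong₂ _+_ (cong (_* _) (p .at 0)) (⊛-congʳ as bs g (tail-≈ p) .at i))
                 (sym (coeff-⊛-suc b bs g i)))

      ⊛-congˡ : ∀ f g g′ → g ≈ g′ → f ⊛ g ≈ f ⊛ g′
      ⊛-congˡ []       g g′ p = ≈-refl
      ⊛-congˡ (a ∷ as) g g′ p .at zero =
        trans (coeff-⊛-zero a as g) (trans (cong (a *_) (p .at 0)) (sym (coeff-⊛-zero a as g′)))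
      ⊛-congˡ (a ∷ as) g g′ p .at (suc i) =
        trans (coeff-⊛-suc a as g i)
          (trans (cong₂ _+_ (cong (a *_) (p .at (suc i))) (⊛-congˡ as g g′ p .at i))
                 (sym (coeff-⊛-suc a as g′ i)))

      ⊛-distribʳ : ∀ h f g → (f ⊕ g) ⊛ h ≈ f ⊛ h ⊕ g ⊛ h
      ⊛-distribʳ h []       g        = ≈-refl
      ⊛-distribʳ h (a ∷ as) []       = ≈-sym (⊕-identityʳ _)
      ⊛-distribʳ h (a ∷ as) (b ∷ bs) .at zero
        rewrite coeff-⊛-zero (a + b) (as ⊕ bs) h | coeff-⊕ ((a ∷ as) ⊛ h) ((b ∷ bs) ⊛ h) 0
              | coeff-⊛-zero a as h | coeff-⊛-zero b bs h = distribʳ _ _ _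
      ⊛-distribʳ h (a ∷ as) (b ∷ bs) .at (suc i)
        rewrite coeff-⊛-suc (a + b) (as ⊕ bs) h i | coeff-⊕ ((a ∷ as) ⊛ h) ((b ∷ bs) ⊛ h) (suc i)
              | coeff-⊛-suc a as h i | coeff-⊛-suc b bs h i
              | ⊛-distribʳ h as bs .at i | coeff-⊕ (as ⊛ h) (bs ⊛ h) i =
        solveᶠ 5 (λ a b x u v → (a +ᶠ b) *ᶠ x +ᶠ (u +ᶠ v) ≔ᶠ (a *ᶠ x +ᶠ u) +ᶠ (b *ᶠ x +ᶠ v)) refl
          a b (coeff h (suc i)) (coeff (as ⊛ h) i) (coeff (bs ⊛ h) i)

      ⊛-∷-zero : ∀ f b bs → coeff (f ⊛ (b ∷ bs)) 0 ≡ coeff f 0 * b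
      ⊛-∷-zero []       b bs = sym (zeroˡ b)
      ⊛-∷-zero (a ∷ as) b bs = coeff-⊛-zero a as (b ∷ bs)

      ⊛-∷-suc : ∀ f b bs i → coeff (f ⊛ (b ∷ bs)) (suc i) ≡ coeff f (suc i) * b + coeff (f ⊛ bs) i
      ⊛-∷-suc []       b bs i = sym (trans (+-identityʳ _) (zeroˡ b))
      ⊛-∷-suc (a ∷ as) b bs zero
        rewrite coeff-⊛-suc a as (b ∷ bs) 0 | coeff-⊛-zero a as bs | ⊛-∷-zero as b bs = +-comm _ _
      ⊛-∷-suc (a ∷ as) b bs (suc i)
        rewrite coeff-⊛-suc a as (b ∷ bs) (suc i) | coeff-⊛-suc a as bs i | ⊛-∷-suc as b bs i =
        solveᶠ 3 (λ x y z → x +ᶠ (y +ᶠ z) ≔ᶠ y +ᶠ (x +ᶠ z)) refl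
          (a * coeff bs (suc i)) (coeff as (suc i) * b) (coeff (as ⊛ bs) i)

      ⊛-comm : ∀ f g → f ⊛ g ≈ g ⊛ f
      ⊛-comm []       g = ≈-sym (⊛-zeroʳ g)
      ⊛-comm (a ∷ as) g .at zero
        rewrite coeff-⊛-zero a as g | ⊛-∷-zero g a as = *-comm _ _
      ⊛-comm (a ∷ as) g .at (suc i)
        rewrite coeff-⊛-suc a as g i | ⊛-∷-suc g a as i | ⊛-comm as g .at i = cong (_+ coeff (g ⊛ as) i) (*-comm _ _)

      ·-⊛ : ∀ a g h → (a · g) ⊛ h ≈ a · (g ⊛ h)
      ·-⊛ a [] h = ≈-refl
      ·-⊛ a (b ∷ bs) h .at zero
        rewrite coeff-⊛-zero (a * b) (a · bs) h | coeff-· a ((b ∷ bs) ⊛ h) 0 | coeff-⊛-zero b bs h = *-assoc _ _ _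
      ·-⊛ a (b ∷ bs) h .at (suc i)
        rewrite coeff-⊛-suc (a * b) (a · bs) h i | coeff-· a ((b ∷ bs) ⊛ h) (suc i) | coeff-⊛-suc b bs h i
              | ·-⊛ a bs h .at i | coeff-· a (bs ⊛ h) i =
        solveᶠ 4 (λ a b x y → (a *ᶠ b) *ᶠ x +ᶠ a *ᶠ y ≔ᶠ a *ᶠ (b *ᶠ x +ᶠ y)) refl
          a b (coeff h (suc i)) (coeff (bs ⊛ h) i)

      shift-⊛ : ∀ f h → (0# ∷ f) ⊛ h ≈ 0# ∷ (f ⊛ h)
      shift-⊛ f h .at zero = trans (coeff-⊛-zero 0# f h) (zeroˡ _)
      shift-⊛ f h .at (suc i) = trans (coeff-⊛-suc 0# f h i) (trans (cong (_+ coeff (f ⊛ h) i) (zeroˡ _)) (+-identityˡ _))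

      ⊛-assoc : ∀ f g h → (f ⊛ g) ⊛ h ≈ f ⊛ (g ⊛ h)
      ⊛-assoc []       g h = ≈-refl
      ⊛-assoc (a ∷ as) g h =
        ≈-trans (⊛-distribʳ h (a · g) (0# ∷ (as ⊛ g)))
          (⊕-cong (·-⊛ a g h) (≈-trans (shift-⊛ (as ⊛ g) h) (∷-cong refl (⊛-assoc as g h))))

      ⊛-identityˡ : ∀ g → (1# ∷ []) ⊛ g ≈ g
      ⊛-identityˡ g .at zero = trans (coeff-⊛-zero 1# [] g) (*-identityˡ _)
      ⊛-identityˡ g .at (suc i) = trans (coeff-⊛-suc 1# [] g i) (trans (+-identityʳ _) (*-identityˡ _))

  polynomialRing : CommutativeRing 0ℓ 0ℓ
  polynomialRing = record
    { Carrier = Poly ; _≈_ = _≈_ ; _+_ = _⊕_ ; _*_ = _⊛_ ; -_ = ⊖_ ; 0# = [] ; 1# = 1# ∷ []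
    ; isCommutativeRing = record
      { isRing = record
        { +-isAbelianGroup = record
          { isGroup = record
            { isMonoid = record
              { isSemigroup = record
                { isMagma = record
                  { isEquivalence = record { refl = ≈-refl ; sym = ≈-sym ; trans = ≈-trans }
                  ; ∙-cong = ⊕-cong }
                ; assoc = ⊕-assoc }
              ; identity = ⊕-identityˡ , ⊕-identityʳ }
            ; inverse = (λ f → ≈-trans (⊕-comm (⊖ f) f) (⊖-inverseʳ f)) , ⊖-inverseʳ
            ; ⁻¹-cong = ⊖-cong }
          ; comm = ⊕-comm }
        ; *-cong = λ {f} {f′} {g} {g′} p q → ≈-trans (⊛-congʳ f f′ g p) (⊛-congˡ f′ g g′ q)
        ; *-assoc = ⊛-assoc
        ; *-identity = ⊛-identityˡ , λ f → ≈-trans (⊛-comm f _) (⊛-identityˡ f)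
        ; distrib = (λ f g h → ≈-trans (⊛-comm f _) (≈-trans (⊛-distribʳ f g h) (⊕-cong (⊛-comm g f) (⊛-comm h f))))
                  , ⊛-distribʳ }
      ; *-comm = ⊛-comm } }

  module P where
    open CommutativeRing polynomialRing public
      using (*-cong; +-identityʳ; zeroˡ; zeroʳ; distribˡ; distribʳ; *-assoc; *-comm; +-comm; +-assoc; *-identityˡ; *-identityʳ; -‿inverseʳ; reflexive)
    module Reasoning where
      open import Relation.Binary.Reasoning.Setoid (CommutativeRing.setoid polynomialRing) public

  open IntegerCoefficients polynomialRing public using ()
    renaming (solve to solveₚ; _:=_ to _≔_; _:+_ to _⊞_; _:*_ to _⊠_; :-_ to ⊟_)

  ⊛-cong : ∀ {f f′ g g′} → f ≈ f′ → g ≈ g′ → f ⊛ g ≈ f′ ⊛ g′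
  ⊛-cong = P.*-cong

  C : F → Poly
  C a = a ∷ []

  opaque
    unfolding _⊕_ _⊛_
    -- Scalars enter as constant polynomials because scaling is then a ring product, which `solveₚ`
    -- can rearrange.
    C⊛≈· : ∀ a f → C a ⊛ f ≈ a · f
    C⊛≈· a f .at zero = trans (coeff-⊛-zero a [] f) (sym (coeff-· a f 0))
    C⊛≈· a f .at (suc i) = trans (coeff-⊛-suc a [] f i) (trans (+-identityʳ _) (sym (coeff-· a f (suc i))))

    coeff-C⊛ : ∀ a f i → coeff (C a ⊛ f) i ≡ a * coeff f i
    coeff-C⊛ a f i = trans (C⊛≈· a f .at i) (coeff-· a f i)

  C-cong : ∀ {a b} → a ≡ b → C a ≈ C b
  C-cong refl = ≈-refl

  C-* : ∀ a b → C (a * b) ≈ C a ⊛ C b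
  C-* a b = ≈-sym (≈-trans (C⊛≈· a (C b)) (mk≈ (·C a b)))
    where
    ·C : ∀ a b i → coeff (a · C b) i ≡ coeff (C (a * b)) i
    ·C a b zero = coeff-· a (C b) 0
    ·C a b (suc i) = trans (coeff-· a (C b) (suc i)) (zeroʳ a)

  C0≈[] : C 0# ≈ []
  C0≈[] = ≈-sym ([]≈∷ refl ≈-refl)

  X : Poly
  X = 0# ∷ 1# ∷ []

  opaque
    unfolding _⊕_ _⊛_
    C-+ : ∀ a b → C (a + b) ≈ C a ⊕ C b
    C-+ a b = ≈-refl

    X⊛ : ∀ f → X ⊛ f ≈ 0# ∷ f
    X⊛ f = ≈-trans (shift-⊛ (1# ∷ []) f) (∷-cong refl (⊛-identityˡ f))

    ∷≈ : ∀ a f → a ∷ f ≈ C a ⊕ X ⊛ f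
    ∷≈ a f = ≈-sym (≈-trans (⊕-cong (≈-refl {C a}) (X⊛ f)) (∷-cong (+-identityʳ a) ≈-refl))

  eval : Poly → F → F
  eval []       x = 0#
  eval (a ∷ as) x = a + x * eval as x

  eval-zero : ∀ f x → [] ≈ f → eval f x ≡ 0#
  eval-zero [] x p = refl
  eval-zero (a ∷ as) x p =
    trans (cong₂ (λ u v → u + x * v) (sym (p .at 0)) (eval-zero as x ([]≈tail p)))
          (trans (+-identityˡ _) (zeroʳ x))

  eval-cong : ∀ {f g} x → f ≈ g → eval f x ≡ eval g x
  eval-cong {[]} {g} x p = sym (eval-zero g x p)
  eval-cong {a ∷ as} {[]} x p = eval-zero (a ∷ as) x (≈-sym p)
  eval-cong {a ∷ as} {b ∷ bs} x p = cong₂ (λ u v → u + x * v) (p .at 0) (eval-cong x (tail-≈ p))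

  opaque
    unfolding _⊕_ _⊛_
    eval-⊕ : ∀ f g x → eval (f ⊕ g) x ≡ eval f x + eval g x
    eval-⊕ [] g x = sym (+-identityˡ _)
    eval-⊕ (a ∷ as) [] x = sym (+-identityʳ _)
    eval-⊕ (a ∷ as) (b ∷ bs) x rewrite eval-⊕ as bs x =
      solveᶠ 5 (λ a b x u v → (a +ᶠ b) +ᶠ x *ᶠ (u +ᶠ v) ≔ᶠ (a +ᶠ x *ᶠ u) +ᶠ (b +ᶠ x *ᶠ v)) refl
        a b x (eval as x) (eval bs x)

    eval-· : ∀ a f x → eval (a · f) x ≡ a * eval f x
    eval-· a [] x = sym (zeroʳ a)
    eval-· a (b ∷ bs) x rewrite eval-· a bs x =
      solveᶠ 4 (λ a b x u → a *ᶠ b +ᶠ x *ᶠ (a *ᶠ u) ≔ᶠ a *ᶠ (b +ᶠ x *ᶠ u)) refl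
        a b x (eval bs x)

    eval-⊛ : ∀ f g x → eval (f ⊛ g) x ≡ eval f x * eval g x
    eval-⊛ [] g x = sym (zeroˡ _)
    eval-⊛ (a ∷ as) g x rewrite eval-⊕ (a · g) (0# ∷ (as ⊛ g)) x | eval-· a g x | eval-⊛ as g x | +-identityˡ (x * (eval as x * eval g x)) =
      solveᶠ 4 (λ a x u v → a *ᶠ v +ᶠ x *ᶠ (u *ᶠ v) ≔ᶠ (a +ᶠ x *ᶠ u) *ᶠ v) refl
        a x (eval as x) (eval g x)

    eval-⊖ : ∀ f x → eval (⊖ f) x ≡ - eval f x
    eval-⊖ [] x = sym -0#≈0#
    eval-⊖ (a ∷ as) x rewrite eval-⊖ as x =
      solveᶠ 3 (λ a x u → (-ᶠ a) +ᶠ x *ᶠ (-ᶠ u) ≔ᶠ -ᶠ (a +ᶠ x *ᶠ u)) refl a x (eval as x)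

  eval-C : ∀ a x → eval (C a) x ≡ a
  eval-C a x = trans (cong (a +_) (zeroʳ x)) (+-identityʳ a)

  eval-X : ∀ x → eval X x ≡ x
  eval-X x = trans (+-identityˡ _) (trans (cong (x *_) (eval-C 1# x)) (*-identityʳ x))

  infixr 8 _⊛^_
  _⊛^_ : Poly → ℕ → Poly
  f ⊛^ zero  = 1# ∷ []
  f ⊛^ suc n = f ⊛ f ⊛^ n

  ⊛^-+ : ∀ f m n → f ⊛^ (m ℕ.+ n) ≈ f ⊛^ m ⊛ f ⊛^ n
  ⊛^-+ f zero n = ≈-sym (P.*-identityˡ _)
  ⊛^-+ f (suc m) n = ≈-trans (⊛-cong (≈-refl {f}) (⊛^-+ f m n)) (≈-sym (P.*-assoc f _ _))

  eval-⊛^ : ∀ f n x → eval (f ⊛^ n) x ≡ eval f x ^ n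
  eval-⊛^ f zero x = eval-C 1# x
  eval-⊛^ f (suc n) x = trans (eval-⊛ f (f ⊛^ n) x) (cong (eval f x *_) (eval-⊛^ f n x))

  -- The Euler operator x d/dx.
  opaque
    unfolding _⊕_
    θ : Poly → Poly
    θ [] = []
    θ (a ∷ as) = 0# ∷ (as ⊕ θ as)

    coeff-θ : ∀ f i → coeff (θ f) i ≡ ι i * coeff f i
    coeff-θ [] i = sym (zeroʳ _)
    coeff-θ (a ∷ as) zero = sym (zeroˡ a)
    coeff-θ (a ∷ as) (suc i) rewrite coeff-⊕ as (θ as) i | coeff-θ as i =
      sym (trans (distribʳ _ _ _) (cong (_+ ι i * coeff as i) (*-identityˡ _)))

  θ-cong : ∀ {f g} → f ≈ g → θ f ≈ θ g
  θ-cong {f} {g} p .at i = trans (coeff-θ f i) (trans (cong (ι i *_) (p .at i)) (sym (coeff-θ g i)))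

  θ-⊕ : ∀ f g → θ (f ⊕ g) ≈ θ f ⊕ θ g
  θ-⊕ f g .at i rewrite coeff-θ (f ⊕ g) i | coeff-⊕ f g i | coeff-⊕ (θ f) (θ g) i | coeff-θ f i | coeff-θ g i = distribˡ _ _ _

  θ-· : ∀ a f → θ (a · f) ≈ a · θ f
  θ-· a f .at i rewrite coeff-θ (a · f) i | coeff-· a f i | coeff-· a (θ f) i | coeff-θ f i =
    solveᶠ 3 (λ k a u → k *ᶠ (a *ᶠ u) ≔ᶠ a *ᶠ (k *ᶠ u)) refl (ι i) a (coeff f i)

  opaque
    unfolding _⊕_ _⊛_ θ
    θ-⊛ : ∀ f g → θ (f ⊛ g) ≈ θ f ⊛ g ⊕ f ⊛ θ g
    θ-⊛ [] g = ≈-refl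
    θ-⊛ (a ∷ as) g = begin
      θ (a · g ⊕ (0# ∷ (as ⊛ g)))                                 ≈⟨ θ-⊕ (a · g) _ ⟩
      θ (a · g) ⊕ (0# ∷ (as ⊛ g ⊕ θ (as ⊛ g)))                    ≈⟨ ⊕-cong (θ-· a g) (∷-cong refl (⊕-cong (≈-refl {as ⊛ g}) (θ-⊛ as g))) ⟩
      a · θ g ⊕ (0# ∷ (as ⊛ g ⊕ (θ as ⊛ g ⊕ as ⊛ θ g)))           ≈⟨ ⊕-cong (≈-refl {a · θ g}) (X⊛ _) ⟨
      a · θ g ⊕ X ⊛ (as ⊛ g ⊕ (θ as ⊛ g ⊕ as ⊛ θ g))              ≈⟨ solveₚ 6 (λ u x p q g h → u ⊞ x ⊠ (p ⊠ g ⊞ (q ⊠ g ⊞ p ⊠ h))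
                                                                        ≔ (x ⊠ (p ⊞ q)) ⊠ g ⊞ (u ⊞ x ⊠ (p ⊠ h))) ≈-refl
                                                                        (a · θ g) X as (θ as) g (θ g) ⟩
      (X ⊛ (as ⊕ θ as)) ⊛ g ⊕ (a · θ g ⊕ X ⊛ (as ⊛ θ g))          ≈⟨ ⊕-cong (⊛-cong (X⊛ (as ⊕ θ as)) (≈-refl {g})) (⊕-cong (≈-refl {a · θ g}) (X⊛ (as ⊛ θ g))) ⟩
      (0# ∷ (as ⊕ θ as)) ⊛ g ⊕ (a · θ g ⊕ (0# ∷ (as ⊛ θ g)))      ∎
      where open P.Reasoning

    θ-C : ∀ a → θ (C a) ≈ []
    θ-C a = C0≈[]

    θX : θ X ≈ X
    θX .at zero = refl
    θX .at (suc zero) = +-identityʳ _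
    θX .at (suc (suc i)) = refl

  -- The extra factor f leaves f^n on the right in place of f^(n - 1), so n = 0 is no exception and
  -- f^e survives differentiation unchanged.
  ⊛-θ-⊛^ : ∀ f n → f ⊛ θ (f ⊛^ n) ≈ C (ι n) ⊛ (θ f ⊛ f ⊛^ n)
  ⊛-θ-⊛^ f zero = begin
    f ⊛ θ (C 1#)                   ≈⟨ ⊛-cong (≈-refl {f}) (θ-C 1#) ⟩
    f ⊛ []                         ≈⟨ P.zeroʳ f ⟩
    []                             ≈⟨ P.zeroˡ (θ f ⊛ (1# ∷ [])) ⟨
    [] ⊛ (θ f ⊛ (1# ∷ []))         ≈⟨ ⊛-cong C0≈[] (≈-refl {θ f ⊛ (1# ∷ [])}) ⟨
    C 0# ⊛ (θ f ⊛ (1# ∷ []))       ∎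
    where open P.Reasoning
  ⊛-θ-⊛^ f (suc n) = begin
    f ⊛ θ (f ⊛ g)                                  ≈⟨ ⊛-cong (≈-refl {f}) (θ-⊛ f g) ⟩
    f ⊛ (θ f ⊛ g ⊕ f ⊛ θ g)                        ≈⟨ ⊛-cong (≈-refl {f}) (⊕-cong (≈-refl {θ f ⊛ g}) (⊛-θ-⊛^ f n)) ⟩
    f ⊛ (θ f ⊛ g ⊕ C (ι n) ⊛ (θ f ⊛ g))            ≈⟨ solveₚ 4 (λ f t g k → f ⊠ (t ⊠ g ⊞ k ⊠ (t ⊠ g)) ≔ t ⊠ (f ⊠ g) ⊞ k ⊠ (t ⊠ (f ⊠ g))) ≈-refl f (θ f) g (C (ι n)) ⟩
    θ f ⊛ (f ⊛ g) ⊕ C (ι n) ⊛ (θ f ⊛ (f ⊛ g))      ≈⟨ ⊕-cong (P.*-identityˡ _) ≈-refl ⟨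
    C 1# ⊛ (θ f ⊛ (f ⊛ g)) ⊕ C (ι n) ⊛ (θ f ⊛ (f ⊛ g))  ≈⟨ P.distribʳ (θ f ⊛ (f ⊛ g)) (C 1#) (C (ι n)) ⟨
    (C 1# ⊕ C (ι n)) ⊛ (θ f ⊛ (f ⊛ g))             ≈⟨ ⊛-cong (C-+ 1# (ι n)) ≈-refl ⟨
    C (1# + ι n) ⊛ (θ f ⊛ (f ⊛ g))                 ∎
    where
    open P.Reasoning
    g = f ⊛^ n

-- Degree bounds, multiplicities of zeros, division and square roots of polynomials.

module Divisibility (𝕂 : DecidableField) where

  open Polynomials 𝕂
  open import Data.List.Base using (List; []; _∷_; map; length)
  open import Data.List.Membership.Propositional using (_∈_)
  open import Data.List.Membership.Propositional.Properties using (∈-map⁺)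
  open import Data.List.Relation.Unary.All as All using (All)
  open import Data.List.Relation.Unary.Any using (here; there)
  open import Data.List.Relation.Unary.AllPairs using (_∷_)
  open import Data.List.Relation.Unary.Unique.Propositional using (Unique)
  open import Data.Nat.Base as ℕ using (ℕ; zero; suc; _∸_; _≤_; z≤n; s≤s)
  open import Data.Nat.ListAction using (sum)
  import Data.Nat.Properties as ℕₚ
  open import Data.Sum.Base using (inj₁; inj₂)

  -- A strict bound includes the zero polynomial, and a bound on coefficients ignores trailing zeros
  -- of the list.
  Deg< : ℕ → Poly → Set
  Deg< d f = ∀ i → d ≤ i → coeff f i ≡ 0#

  Deg<-mono : ∀ {d e} f → d ≤ e → Deg< d f → Deg< e f
  Deg<-mono f d≤e h i e≤i = h i (ℕₚ.≤-trans d≤e e≤i)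

  Deg<-cong : ∀ {d f g} → f ≈ g → Deg< d f → Deg< d g
  Deg<-cong f≈g h i d≤i = trans (sym (f≈g .at i)) (h i d≤i)

  Deg<-⊕ : ∀ {d} f g → Deg< d f → Deg< d g → Deg< d (f ⊕ g)
  Deg<-⊕ f g hf hg i d≤i = trans (coeff-⊕ f g i) (trans (cong₂ _+_ (hf i d≤i) (hg i d≤i)) (+-identityʳ 0#))

  Deg<-⊖ : ∀ {d} f → Deg< d f → Deg< d (⊖ f)
  Deg<-⊖ f hf i d≤i = trans (coeff-⊖ f i) (trans (cong -_ (hf i d≤i)) (trans (sym (+-identityˡ _)) (-‿inverseʳ 0#)))

  Deg<-C⊛ : ∀ {d} a f → Deg< d f → Deg< d (C a ⊛ f)
  Deg<-C⊛ a f hf i d≤i = trans (coeff-C⊛ a f i) (trans (cong (a *_) (hf i d≤i)) (zeroʳ a))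

  Deg<-θ : ∀ {d} f → Deg< d f → Deg< d (θ f)
  Deg<-θ f hf i d≤i = trans (coeff-θ f i) (trans (cong (ι i *_) (hf i d≤i)) (zeroʳ _))

  Deg<0⇒≈[] : ∀ {f} → Deg< 0 f → f ≈ []
  Deg<0⇒≈[] h .at i = h i z≤n

  ≈[]⊛ : ∀ {f} g → f ≈ [] → f ⊛ g ≈ []
  ≈[]⊛ g f≈0 = ≈-trans (⊛-cong f≈0 ≈-refl) (P.zeroˡ g)

  ⊛≈[] : ∀ f {g} → g ≈ [] → f ⊛ g ≈ []
  ⊛≈[] f g≈0 = ≈-trans (⊛-cong ≈-refl g≈0) (P.zeroʳ f)

  -- One bound is inclusive, deg f ≤ a, and one strict, deg g < b; in this form the bounds add up
  -- without any subtraction.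
  Deg<-⊛ : ∀ f g a b → Deg< (suc a) f → Deg< b g → Deg< (a ℕ.+ b) (f ⊛ g)
  Deg<-⊛ [] g a b hf hg i _ = P.zeroˡ g .at i
  Deg<-⊛ (c ∷ cs) g a b hf hg zero a+b≤0 =
    trans (coeff-⊛-zero c cs g) (trans (cong (c *_) (hg 0 (ℕₚ.≤-trans (ℕₚ.m≤n+m b a) a+b≤0))) (zeroʳ c))
  Deg<-⊛ (c ∷ cs) g a b hf hg (suc j) a+b≤j =
    trans (coeff-⊛-suc c cs g j)
      (trans (cong₂ _+_ (trans (cong (c *_) (hg (suc j) (ℕₚ.≤-trans (ℕₚ.m≤n+m b a) a+b≤j))) (zeroʳ c)) (tail a hf a+b≤j))
             (+-identityʳ 0#))
    where
    tail : ∀ a → Deg< (suc a) (c ∷ cs) → a ℕ.+ b ≤ suc j → coeff (cs ⊛ g) j ≡ 0#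
    tail zero hf _ = ≈[]⊛ g (Deg<0⇒≈[] (λ i _ → hf (suc i) (s≤s z≤n))) .at j
    tail (suc a) hf (s≤s le) = Deg<-⊛ cs g a b (λ i le → hf (suc i) (s≤s le)) hg j le

  private
    integral-unit : ∀ f g → coeff g 0 ≢ 0# → f ⊛ g ≈ [] → f ≈ []
    integral-unit [] g g₀≢0 p = ≈-refl
    integral-unit (a ∷ as) g g₀≢0 p = ≈-sym ([]≈∷ a≡0 (≈-sym (integral-unit as g g₀≢0 q)))
      where
      a≡0 : a ≡ 0#
      a≡0 = integral (trans (*-comm _ a) (trans (sym (coeff-⊛-zero a as g)) (p .at 0))) g₀≢0
      q : as ⊛ g ≈ []
      q .at i = begin
        coeff (as ⊛ g) i                            ≡⟨ +-identityˡ _ ⟨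
        0# + coeff (as ⊛ g) i                       ≡⟨ cong (_+ coeff (as ⊛ g) i) (trans (cong (_* coeff g (suc i)) a≡0) (zeroˡ _)) ⟨
        a * coeff g (suc i) + coeff (as ⊛ g) i      ≡⟨ coeff-⊛-suc a as g i ⟨
        coeff ((a ∷ as) ⊛ g) (suc i)                ≡⟨ p .at (suc i) ⟩
        0#                                          ∎
        where open ≡-Reasoning

  -- Factors x are stripped from g until its constant term is nonzero; then the coefficients of f
  -- vanish one after another from the bottom.
  ⊛-integral : ∀ f g → f ⊛ g ≈ [] → ¬ g ≈ [] → f ≈ []
  ⊛-integral f [] p g≉0 = contradiction ≈-refl g≉0
  ⊛-integral f (b ∷ bs) p g≉0 with b ≟ 0#
  ... | no b≢0 = integral-unit f (b ∷ bs) b≢0 p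
  ... | yes b≡0 = ⊛-integral f bs q (λ bs≈0 → g≉0 (≈-sym ([]≈∷ b≡0 (≈-sym bs≈0))))
    where
    q : f ⊛ bs ≈ []
    q .at i = begin
      coeff (f ⊛ bs) i                            ≡⟨ P.*-comm f bs .at i ⟩
      coeff (bs ⊛ f) i                            ≡⟨ +-identityˡ _ ⟨
      0# + coeff (bs ⊛ f) i                       ≡⟨ cong (_+ coeff (bs ⊛ f) i) (trans (cong (_* coeff f (suc i)) b≡0) (zeroˡ _)) ⟨
      b * coeff f (suc i) + coeff (bs ⊛ f) i      ≡⟨ coeff-⊛-suc b bs f i ⟨
      coeff ((b ∷ bs) ⊛ f) (suc i)                ≡⟨ P.*-comm (b ∷ bs) f .at (suc i) ⟩
      coeff (f ⊛ (b ∷ bs)) (suc i)                ≡⟨ p .at (suc i) ⟩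
      0#                                          ∎
      where open ≡-Reasoning

  ≈[]? : ∀ f → Dec (f ≈ [])
  ≈[]? [] = yes ≈-refl
  ≈[]? (a ∷ as) with a ≟ 0# | ≈[]? as
  ... | yes a≡0 | yes as≈0 = yes (≈-sym ([]≈∷ a≡0 (≈-sym as≈0)))
  ... | no a≢0  | _        = no λ p → a≢0 (p .at 0)
  ... | _       | no as≉0  = no λ p → as≉0 (≈-sym ([]≈tail (≈-sym p)))

  ⊖≈[] : ∀ {f g} → f ⊕ ⊖ g ≈ [] → f ≈ g
  ⊖≈[] {f} {g} p = begin
    f                ≈⟨ solveₚ 2 (λ f g → f ≔ (f ⊞ (⊟ g)) ⊞ g) ≈-refl f g ⟩
    f ⊕ ⊖ g ⊕ g      ≈⟨ ⊕-cong p ≈-refl ⟩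
    [] ⊕ g           ≈⟨ P.+-comm [] g ⟩
    g ⊕ []           ≈⟨ P.+-identityʳ g ⟩
    g                ∎
    where open P.Reasoning

  ≈⇒⊖≈[] : ∀ {f g} → f ≈ g → f ⊕ ⊖ g ≈ []
  ≈⇒⊖≈[] {f} {g} p = ≈-trans (⊕-cong p ≈-refl) (P.-‿inverseʳ g)

  ⊛-cancelˡ : ∀ h {f g} → ¬ h ≈ [] → h ⊛ f ≈ h ⊛ g → f ≈ g
  ⊛-cancelˡ h {f} {g} h≉0 p = ⊖≈[] (⊛-integral (f ⊕ ⊖ g) h q h≉0)
    where
    q : (f ⊕ ⊖ g) ⊛ h ≈ []
    q = ≈-trans (solveₚ 3 (λ f g h → (f ⊞ (⊟ g)) ⊠ h ≔ h ⊠ f ⊞ (⊟ (h ⊠ g))) ≈-refl f g h)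
                (≈⇒⊖≈[] p)

  ⊛^-nonzero : ∀ {f} n → ¬ f ≈ [] → ¬ f ⊛^ n ≈ []
  ⊛^-nonzero zero f≉0 p = 1≢0 (p .at 0)
  ⊛^-nonzero {f} (suc n) f≉0 p = f≉0 (⊛-integral f (f ⊛^ n) p (⊛^-nonzero n f≉0))

  lin : F → Poly
  lin a = (- a) ∷ 1# ∷ []

  lin≉[] : ∀ a → ¬ lin a ≈ []
  lin≉[] a p = 1≢0 (p .at 1)

  lin≈ : ∀ a → lin a ≈ X ⊕ ⊖ C a
  lin≈ a .at zero = sym (trans (coeff-⊕ X (⊖ C a) 0) (trans (+-identityˡ _) (coeff-⊖ (C a) 0)))
  lin≈ a .at (suc zero) = sym (trans (coeff-⊕ X (⊖ C a) 1) (trans (cong (1# +_) (coeff-⊖ (C a) 1)) (trans (cong (1# +_) -0≡0) (+-identityʳ 1#))))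
    where
    -0≡0 : - 0# ≡ 0#
    -0≡0 = trans (sym (+-identityˡ _)) (-‿inverseʳ 0#)
  lin≈ a .at (suc (suc i)) = sym (trans (coeff-⊕ X (⊖ C a) (suc (suc i))) (trans (+-identityˡ _) (trans (coeff-⊖ (C a) (suc (suc i))) -0≡0)))
    where
    -0≡0 : - 0# ≡ 0#
    -0≡0 = trans (sym (+-identityˡ _)) (-‿inverseʳ 0#)

  eval-lin : ∀ a x → eval (lin a) x ≡ x + - a
  eval-lin a x = trans (cong (λ y → - a + x * y) (eval-C 1# x)) (trans (cong (- a +_) (*-identityʳ x)) (+-comm _ _))

  eval-lin-self : ∀ a → eval (lin a) a ≡ 0#
  eval-lin-self a = trans (eval-lin a a) (-‿inverseʳ a)

  θ-lin : ∀ a → θ (lin a) ≈ X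
  θ-lin a .at zero = trans (coeff-θ (lin a) 0) (zeroˡ _)
  θ-lin a .at (suc zero) = trans (coeff-θ (lin a) 1) (trans (*-identityʳ _) (+-identityʳ 1#))
  θ-lin a .at (suc (suc i)) = trans (coeff-θ (lin a) (suc (suc i))) (zeroʳ _)

  -- Horner's scheme: the value of the tail at `a` becomes the constant term of the new quotient.
  divide-lin : ∀ f a → ∃[ q ] f ≈ lin a ⊛ q ⊕ C (eval f a)
  divide-lin [] a = [] , ≈-sym (≈-trans (⊕-cong (P.zeroʳ (lin a)) C0≈[]) (P.+-identityʳ []))
  divide-lin (c ∷ cs) a with divide-lin cs a
  ... | q , cs≈ = X ⊛ q ⊕ C r , (begin
    c ∷ cs                                            ≈⟨ ∷≈ c cs ⟩
    C c ⊕ X ⊛ cs                                      ≈⟨ ⊕-cong ≈-refl (⊛-cong ≈-refl (≈-trans cs≈ (⊕-cong (⊛-cong (lin≈ a) ≈-refl) ≈-refl))) ⟩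
    C c ⊕ X ⊛ ((X ⊕ ⊖ C a) ⊛ q ⊕ C r)                 ≈⟨ solveₚ 5 (λ c x a q r → c ⊞ x ⊠ ((x ⊞ (⊟ a)) ⊠ q ⊞ r)
                                                           ≔ (x ⊞ (⊟ a)) ⊠ (x ⊠ q ⊞ r) ⊞ (c ⊞ a ⊠ r)) ≈-refl (C c) X (C a) q (C r) ⟩
    (X ⊕ ⊖ C a) ⊛ (X ⊛ q ⊕ C r) ⊕ (C c ⊕ C a ⊛ C r)   ≈⟨ ⊕-cong (⊛-cong (lin≈ a) ≈-refl) (≈-trans (C-+ c (a * r)) (⊕-cong ≈-refl (C-* a r))) ⟨
    lin a ⊛ (X ⊛ q ⊕ C r) ⊕ C (c + a * r)             ∎)
    where
    open P.Reasoning
    r = eval cs a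

  root⇒lin∣ : ∀ f a → eval f a ≡ 0# → ∃[ q ] f ≈ lin a ⊛ q
  root⇒lin∣ f a fa≡0 with divide-lin f a
  ... | q , p = q , ≈-trans p (≈-trans (⊕-cong ≈-refl (≈-trans (C-cong fa≡0) C0≈[])) (P.+-identityʳ _))

  Div : F → ℕ → Poly → Set
  Div a k f = ∃[ q ] f ≈ lin a ⊛^ k ⊛ q

  Div-⊛ : ∀ {a k f} g → Div a k f → Div a k (g ⊛ f)
  Div-⊛ {a} {k} g (q , p) = g ⊛ q , ≈-trans (⊛-cong ≈-refl p)
    (solveₚ 3 (λ g l q → g ⊠ (l ⊠ q) ≔ l ⊠ (g ⊠ q)) ≈-refl g (lin a ⊛^ k) q)

  Div-cong : ∀ {a k f g} → f ≈ g → Div a k f → Div a k g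
  Div-cong f≈g (q , p) = q , ≈-trans (≈-sym f≈g) p

  θ-lin^ : ∀ a j → θ (lin a ⊛^ suc j) ≈ C (ι (suc j)) ⊛ (X ⊛ lin a ⊛^ j)
  θ-lin^ a j = ⊛-cancelˡ (lin a) (lin≉[] a) (begin
    lin a ⊛ θ (lin a ⊛^ suc j)                                ≈⟨ ⊛-θ-⊛^ (lin a) (suc j) ⟩
    C (ι (suc j)) ⊛ (θ (lin a) ⊛ (lin a ⊛ lin a ⊛^ j))        ≈⟨ ⊛-cong ≈-refl (⊛-cong (θ-lin a) ≈-refl) ⟩
    C (ι (suc j)) ⊛ (X ⊛ (lin a ⊛ lin a ⊛^ j))                ≈⟨ solveₚ 4 (λ c x l m → c ⊠ (x ⊠ (l ⊠ m)) ≔ l ⊠ (c ⊠ (x ⊠ m))) ≈-refl (C (ι (suc j))) X (lin a) (lin a ⊛^ j) ⟩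
    lin a ⊛ (C (ι (suc j)) ⊛ (X ⊛ lin a ⊛^ j))                ∎)
    where open P.Reasoning

  Div-suc : ∀ a k f q → f ≈ lin a ⊛^ k ⊛ q → eval q a ≡ 0# → Div a (suc k) f
  Div-suc a k f q p qa≡0 with root⇒lin∣ q a qa≡0
  ... | q′ , q≈ = q′ , ≈-trans p (≈-trans (⊛-cong ≈-refl q≈)
    (solveₚ 3 (λ l m q → m ⊠ (l ⊠ q) ≔ (l ⊠ m) ⊠ q) ≈-refl (lin a) (lin a ⊛^ k) q′))

  -- The order of vanishing drops by exactly one under g θ + c, as long as it is nonzero in the field.
  Div-θ : ∀ {a k} f g c → a ≢ 0# → eval g a ≢ 0# → (∀ j → 1 ≤ j → j ≤ k → ι j ≢ 0#) →
          eval f a ≡ 0# → Div a k (g ⊛ θ f ⊕ c ⊛ f) → Div a (suc k) f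
  Div-θ {a} {k} f g c a≢0 ga≢0 ιj≢0 fa≡0 (s , s≈) = go k ℕₚ.≤-refl
    where
    go : ∀ j → j ≤ k → Div a (suc j) f
    go zero _ = Div-suc a 0 f f (≈-sym (P.*-identityˡ f)) fa≡0
    go (suc j) j<k with go j (ℕₚ.<⇒≤ j<k)
    ... | q , f≈ = Div-suc a (suc j) f q f≈ (integral (trans (*-comm _ _) qa*) (*-nonzero (ιj≢0 (suc j) (s≤s z≤n) j<k) (*-nonzero ga≢0 a≢0)))
      where
      l = lin a
      lʲ = l ⊛^ j
      k′ = k ∸ suc j
      κ = C (ι (suc j))
      k≡ : j ℕ.+ suc k′ ≡ k
      k≡ = trans (ℕₚ.+-suc j k′) (ℕₚ.m+[n∸m]≡n j<k)
      -- With f = (x - a)^(j+1) q, the polynomial g θf + c f is (x - a)^j times the sum of (j+1) g x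
      -- q and a multiple of x - a. It is also divisible by (x - a)^(j+1), because j < k. Cancelling
      -- (x - a)^j and evaluating at `a` leaves (j+1) g(a) a q(a) = 0.
      expand : lʲ ⊛ (κ ⊛ (g ⊛ (X ⊛ q)) ⊕ l ⊛ (g ⊛ θ q ⊕ c ⊛ q)) ≈ lʲ ⊛ (l ⊛ (l ⊛^ k′ ⊛ s))
      expand = begin
        lʲ ⊛ (κ ⊛ (g ⊛ (X ⊛ q)) ⊕ l ⊛ (g ⊛ θ q ⊕ c ⊛ q))
          ≈⟨ solveₚ 4 (λ m u l v → m ⊠ (u ⊞ l ⊠ v) ≔ m ⊠ u ⊞ (l ⊠ m) ⊠ v) ≈-refl lʲ (κ ⊛ (g ⊛ (X ⊛ q))) l (g ⊛ θ q ⊕ c ⊛ q) ⟩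
        lʲ ⊛ (κ ⊛ (g ⊛ (X ⊛ q))) ⊕ (l ⊛ lʲ) ⊛ (g ⊛ θ q ⊕ c ⊛ q)
          ≈⟨ ⊕-cong (solveₚ 5 (λ m κ g x q → m ⊠ (κ ⊠ (g ⊠ (x ⊠ q))) ≔ g ⊠ ((κ ⊠ (x ⊠ m)) ⊠ q)) ≈-refl lʲ κ g X q) ≈-refl ⟩
        g ⊛ ((κ ⊛ (X ⊛ lʲ)) ⊛ q) ⊕ (l ⊛ lʲ) ⊛ (g ⊛ θ q ⊕ c ⊛ q)
          ≈⟨ solveₚ 6 (λ u m g t c q → g ⊠ u ⊞ m ⊠ (g ⊠ t ⊞ c ⊠ q) ≔ g ⊠ (u ⊞ m ⊠ t) ⊞ c ⊠ (m ⊠ q)) ≈-refl ((κ ⊛ (X ⊛ lʲ)) ⊛ q) (l ⊛ lʲ) g (θ q) c q ⟩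
        g ⊛ ((κ ⊛ (X ⊛ lʲ)) ⊛ q ⊕ (l ⊛ lʲ) ⊛ θ q) ⊕ c ⊛ ((l ⊛ lʲ) ⊛ q)
          ≈⟨ ⊕-cong (⊛-cong ≈-refl (⊕-cong (⊛-cong (θ-lin^ a j) ≈-refl) ≈-refl)) ≈-refl ⟨
        g ⊛ (θ (l ⊛ lʲ) ⊛ q ⊕ (l ⊛ lʲ) ⊛ θ q) ⊕ c ⊛ ((l ⊛ lʲ) ⊛ q)
          ≈⟨ ⊕-cong (⊛-cong ≈-refl (≈-trans (θ-cong f≈) (θ-⊛ (l ⊛ lʲ) q))) (⊛-cong ≈-refl f≈) ⟨
        g ⊛ θ f ⊕ c ⊛ f           ≈⟨ s≈ ⟩
        l ⊛^ k ⊛ s                ≡⟨ cong (λ n → l ⊛^ n ⊛ s) k≡ ⟨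
        l ⊛^ (j ℕ.+ suc k′) ⊛ s   ≈⟨ ⊛-cong (⊛^-+ l j (suc k′)) ≈-refl ⟩
        (lʲ ⊛ (l ⊛ l ⊛^ k′)) ⊛ s  ≈⟨ solveₚ 4 (λ m l n s → (m ⊠ (l ⊠ n)) ⊠ s ≔ m ⊠ (l ⊠ (n ⊠ s))) ≈-refl lʲ l (l ⊛^ k′) s ⟩
        lʲ ⊛ (l ⊛ (l ⊛^ k′ ⊛ s))  ∎
        where open P.Reasoning
      cancelled = ⊛-cancelˡ lʲ (⊛^-nonzero j (lin≉[] a)) expand
      qa* : eval q a * (ι (suc j) * (eval g a * a)) ≡ 0#
      qa* = begin
        eval q a * (ι (suc j) * (eval g a * a))
          ≡⟨ solveᶠ 4 (λ q k g a → q *ᶠ (k *ᶠ (g *ᶠ a)) ≔ᶠ k *ᶠ (g *ᶠ (a *ᶠ q))) refl (eval q a) (ι (suc j)) (eval g a) a ⟩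
        ι (suc j) * (eval g a * (a * eval q a))
          ≡⟨ cong₂ (λ u v → u * (eval g a * v)) (eval-C (ι (suc j)) a) (trans (eval-⊛ X q a) (cong (_* eval q a) (eval-X a))) ⟨
        eval κ a * (eval g a * eval (X ⊛ q) a)
          ≡⟨ trans (eval-⊛ κ (g ⊛ (X ⊛ q)) a) (cong (eval κ a *_) (eval-⊛ g (X ⊛ q) a)) ⟨
        eval (κ ⊛ (g ⊛ (X ⊛ q))) a
          ≡⟨ +-identityʳ _ ⟨
        eval (κ ⊛ (g ⊛ (X ⊛ q))) a + 0#
          ≡⟨ cong (eval (κ ⊛ (g ⊛ (X ⊛ q))) a +_) (lin⊛-zero (g ⊛ θ q ⊕ c ⊛ q)) ⟨
        eval (κ ⊛ (g ⊛ (X ⊛ q))) a + eval (l ⊛ (g ⊛ θ q ⊕ c ⊛ q)) a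
          ≡⟨ eval-⊕ (κ ⊛ (g ⊛ (X ⊛ q))) _ a ⟨
        eval (κ ⊛ (g ⊛ (X ⊛ q)) ⊕ l ⊛ (g ⊛ θ q ⊕ c ⊛ q)) a
          ≡⟨ eval-cong a cancelled ⟩
        eval (l ⊛ (l ⊛^ k′ ⊛ s)) a
          ≡⟨ lin⊛-zero _ ⟩
        0# ∎
        where
        open ≡-Reasoning
        lin⊛-zero : ∀ h → eval (lin a ⊛ h) a ≡ 0#
        lin⊛-zero h = trans (eval-⊛ (lin a) h a) (trans (cong (_* eval h a) (eval-lin-self a)) (zeroˡ _))

  ⊖≡0 : ∀ {x y} → x + - y ≡ 0# → x ≡ y
  ⊖≡0 {x} {y} p = trans (solveᶠ 2 (λ x y → x ≔ᶠ (x +ᶠ (-ᶠ y)) +ᶠ y) refl x y) (trans (cong (_+ y) p) (+-identityˡ y))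

  -- The factor `lin x` does not vanish at y, so q(y) = 0; a factor `lin y` is split off q and
  -- cancelled, which lowers k.
  Div-coprime : ∀ {x y} k q → x ≢ y → Div y k (lin x ⊛ q) → Div y k q
  Div-coprime zero q x≢y _ = q , ≈-sym (P.*-identityˡ q)
  Div-coprime {x} {y} (suc k) q x≢y (s , p) = t , ≈-trans q≈ (≈-trans (⊛-cong ≈-refl q′≈) (≈-sym (P.*-assoc (lin y) _ t)))
    where
    q[y]≡0 : eval q y ≡ 0#
    q[y]≡0 = integral (begin
      eval (lin x) y * eval q y                 ≡⟨ eval-⊛ (lin x) q y ⟨
      eval (lin x ⊛ q) y                        ≡⟨ eval-cong y p ⟩
      eval ((lin y ⊛ lin y ⊛^ k) ⊛ s) y         ≡⟨ trans (eval-⊛ _ s y) (cong (_* eval s y) (eval-⊛ (lin y) _ y)) ⟩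
      (eval (lin y) y * eval (lin y ⊛^ k) y) * eval s y ≡⟨ cong (λ z → (z * eval (lin y ⊛^ k) y) * eval s y) (eval-lin-self y) ⟩
      (0# * eval (lin y ⊛^ k) y) * eval s y     ≡⟨ trans (cong (_* eval s y) (zeroˡ _)) (zeroˡ _) ⟩
      0#                                        ∎)
      (λ e → x≢y (sym (⊖≡0 (trans (sym (eval-lin x y)) e))))
      where open ≡-Reasoning
    factored = root⇒lin∣ q y q[y]≡0
    q′ = proj₁ factored
    q≈ : q ≈ lin y ⊛ q′
    q≈ = proj₂ factored
    cancelled : lin x ⊛ q′ ≈ lin y ⊛^ k ⊛ s
    cancelled = ⊛-cancelˡ (lin y) (lin≉[] y) (begin
      lin y ⊛ (lin x ⊛ q′)              ≈⟨ solveₚ 3 (λ l m q → l ⊠ (m ⊠ q) ≔ m ⊠ (l ⊠ q)) ≈-refl (lin y) (lin x) q′ ⟩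
      lin x ⊛ (lin y ⊛ q′)              ≈⟨ ⊛-cong ≈-refl q≈ ⟨
      lin x ⊛ q                         ≈⟨ p ⟩
      (lin y ⊛ lin y ⊛^ k) ⊛ s          ≈⟨ P.*-assoc _ _ s ⟩
      lin y ⊛ (lin y ⊛^ k ⊛ s)          ∎)
      where open P.Reasoning
    rec = Div-coprime k q′ x≢y (s , cancelled)
    t = proj₁ rec
    q′≈ : q′ ≈ lin y ⊛^ k ⊛ t
    q′≈ = proj₂ rec

  Div-coprime^ : ∀ {x y} j k q → x ≢ y → Div y k (lin x ⊛^ j ⊛ q) → Div y k q
  Div-coprime^ zero k q x≢y d = Div-cong {_} {k} (P.*-identityˡ q) d
  Div-coprime^ (suc j) k q x≢y d =
    Div-coprime^ j k q x≢y (Div-coprime k _ x≢y (Div-cong {_} {k} (P.*-assoc _ _ q) d))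

  coeff-beyond : ∀ f i → length f ≤ i → coeff f i ≡ 0#
  coeff-beyond [] i _ = refl
  coeff-beyond (a ∷ as) (suc i) (s≤s le) = coeff-beyond as i le

  -- From degree d on, the vanishing coefficients of (x - a) q say that each coefficient of q is `a`
  -- times the next one, and past the length of the list they are zero.
  Deg<-lin-quotient : ∀ {d} a q → Deg< d (lin a ⊛ q) → Deg< (d ∸ 1) q
  Deg<-lin-quotient {d} a q h i d≤i = go (length q) i (ℕₚ.m≤n+m (length q) i) (ℕₚ.≤-trans (ℕₚ.m≤n+m∸n d 1) (s≤s d≤i))
    where
    step : ∀ i → d ≤ suc i → coeff q i ≡ a * coeff q (suc i)
    step i d≤1+i = ⊖≡0 (begin
      coeff q i + - (a * coeff q (suc i))             ≡⟨ solveᶠ 3 (λ u a v → u +ᶠ (-ᶠ (a *ᶠ v)) ≔ᶠ (-ᶠ a) *ᶠ v +ᶠ u) refl (coeff q i) a (coeff q (suc i)) ⟩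
      - a * coeff q (suc i) + coeff q i               ≡⟨ cong (- a * coeff q (suc i) +_) (P.*-identityˡ q .at i) ⟨
      - a * coeff q (suc i) + coeff (C 1# ⊛ q) i      ≡⟨ coeff-⊛-suc (- a) (1# ∷ []) q i ⟨
      coeff (lin a ⊛ q) (suc i)                       ≡⟨ h (suc i) d≤1+i ⟩
      0#                                              ∎)
      where open ≡-Reasoning
    go : ∀ n i → length q ≤ i ℕ.+ n → d ≤ suc i → coeff q i ≡ 0#
    go zero i le _ = coeff-beyond q i (subst (length q ≤_) (ℕₚ.+-identityʳ i) le)
    go (suc n) i le d≤1+i = trans (step i d≤1+i)
      (trans (cong (a *_) (go n (suc i) (subst (length q ≤_) (ℕₚ.+-suc i n) le) (ℕₚ.m≤n⇒m≤1+n d≤1+i))) (zeroʳ a))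

  Deg<-lin^-quotient : ∀ {d} a k q → Deg< d (lin a ⊛^ k ⊛ q) → Deg< (d ∸ k) q
  Deg<-lin^-quotient a zero q h = Deg<-cong (P.*-identityˡ q) h
  Deg<-lin^-quotient {d} a (suc k) q h =
    subst (λ e → Deg< e q) (ℕₚ.∸-+-assoc d 1 k)
      (Deg<-lin^-quotient a k q (Deg<-lin-quotient a (lin a ⊛^ k ⊛ q) (Deg<-cong (P.*-assoc _ _ q) h)))

  -- Each zero is divided out with its multiplicity k. This lowers the degree bound by k and keeps
  -- the multiplicities of the other zeros, until the bound is 0.
  many-roots⇒≈[] : ∀ (ps : List (F × ℕ)) f d → Unique (map proj₁ ps) → (∀ {x k} → (x , k) ∈ ps → Div x k f) →
                   Deg< d f → d ≤ sum (map proj₂ ps) → f ≈ []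
  many-roots⇒≈[] [] f d _ _ h z≤n = Deg<0⇒≈[] h
  many-roots⇒≈[] ((x , k) ∷ ps) f d (x∉ps ∷ u) ds h d≤ with ds (here refl)
  ... | q , f≈ = ≈-trans f≈ (⊛≈[] _ (many-roots⇒≈[] ps q (d ∸ k) u
        (λ {y} {j} y∈ → Div-coprime^ k j q (All.lookup x∉ps (∈-map⁺ proj₁ y∈)) (Div-cong {_} {j} f≈ (ds (there y∈))))
        (Deg<-lin^-quotient x k q (Deg<-cong f≈ h))
        (ℕₚ.m≤n+o⇒m∸n≤o d k d≤)))

  degree : ∀ f → ¬ f ≈ [] → ∃[ d ] (coeff f d ≢ 0# × Deg< (suc d) f)
  degree [] f≉0 = contradiction ≈-refl f≉0
  degree (a ∷ as) f≉0 with ≈[]? as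
  ... | no as≉0 with degree as as≉0
  ...   | d , lc , h = suc d , lc , λ { (suc i) (s≤s le) → h i le }
  degree (a ∷ as) f≉0 | yes as≈0 = 0 , (λ a≡0 → f≉0 (≈-sym ([]≈∷ a≡0 (≈-sym as≈0)))) , λ { (suc i) _ → as≈0 .at i }

  -- The dividend grows by one coefficient at a time. The remainder then becomes `a ∷ r`, whose
  -- degree may reach d, and one multiple of g removes that coefficient.
  divide : ∀ f g d → coeff g d ≢ 0# → Deg< (suc d) g → ∃[ q ] ∃[ r ] (f ≈ q ⊛ g ⊕ r × Deg< d r)
  divide [] g d _ _ = [] , [] , ≈-sym (≈-trans (⊕-cong (P.zeroˡ g) ≈-refl) (P.+-identityʳ [])) , λ _ _ → refl
  divide (a ∷ as) g d lc≢0 hg with divide as g d lc≢0 hg | invertible (coeff g d) lc≢0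
  ... | q , r , as≈ , hr | y , lc*y≡1 = X ⊛ q ⊕ C c , s ⊕ ⊖ (C c ⊛ g) , eq , hs
    where
    s = a ∷ r
    c = coeff s d * y
    hs₀ : Deg< (suc d) s
    hs₀ (suc i) (s≤s le) = hr i le
    hs : Deg< d (s ⊕ ⊖ (C c ⊛ g))
    hs i d≤i with ℕₚ.m≤n⇒m<n∨m≡n d≤i
    ... | inj₁ d<i = Deg<-⊕ s (⊖ (C c ⊛ g)) hs₀ (Deg<-⊖ (C c ⊛ g) (Deg<-C⊛ c g hg)) i d<i
    ... | inj₂ refl = begin
      coeff (s ⊕ ⊖ (C c ⊛ g)) d                    ≡⟨ coeff-⊕ s _ d ⟩
      coeff s d + coeff (⊖ (C c ⊛ g)) d            ≡⟨ cong (coeff s d +_) (trans (coeff-⊖ (C c ⊛ g) d) (cong -_ (coeff-C⊛ c g d))) ⟩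
      coeff s d + - (coeff s d * y * coeff g d)    ≡⟨ solveᶠ 3 (λ u y v → u +ᶠ (-ᶠ (u *ᶠ y *ᶠ v)) ≔ᶠ u +ᶠ (-ᶠ (u *ᶠ (v *ᶠ y)))) refl (coeff s d) y (coeff g d) ⟩
      coeff s d + - (coeff s d * (coeff g d * y))  ≡⟨ cong (λ z → coeff s d + - z) (trans (cong (coeff s d *_) lc*y≡1) (*-identityʳ _)) ⟩
      coeff s d + - coeff s d                      ≡⟨ -‿inverseʳ _ ⟩
      0#                                           ∎
      where open ≡-Reasoning
    eq : a ∷ as ≈ (X ⊛ q ⊕ C c) ⊛ g ⊕ (s ⊕ ⊖ (C c ⊛ g))
    eq = begin
      a ∷ as                                        ≈⟨ ∷≈ a as ⟩
      C a ⊕ X ⊛ as                                  ≈⟨ ⊕-cong ≈-refl (⊛-cong ≈-refl as≈) ⟩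
      C a ⊕ X ⊛ (q ⊛ g ⊕ r)                         ≈⟨ solveₚ 6 (λ a x q g r c → a ⊞ x ⊠ (q ⊠ g ⊞ r)
                                                        ≔ (x ⊠ q ⊞ c) ⊠ g ⊞ ((a ⊞ x ⊠ r) ⊞ (⊟ (c ⊠ g)))) ≈-refl (C a) X q g r (C c) ⟩
      (X ⊛ q ⊕ C c) ⊛ g ⊕ ((C a ⊕ X ⊛ r) ⊕ ⊖ (C c ⊛ g))  ≈⟨ ⊕-cong ≈-refl (⊕-cong (∷≈ a r) ≈-refl) ⟨
      (X ⊛ q ⊕ C c) ⊛ g ⊕ (s ⊕ ⊖ (C c ⊛ g))         ∎
      where open P.Reasoning

  -- If A² = g B² and A = q B + r then (g B − q A)² = g r², so the denominator B of √g can be replaced by r.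
  square-quotient : ∀ n A B g → Deg< n B → ¬ B ≈ [] → A ⊛ A ≈ g ⊛ (B ⊛ B) → ∃[ q ] g ≈ q ⊛ q
  square-quotient zero A B g hB B≉0 _ = contradiction (Deg<0⇒≈[] hB) B≉0
  square-quotient (suc n) A B g hB B≉0 A²≈ with degree B B≉0
  ... | d , lc≢0 , hd with divide A B d lc≢0 hd
  ...   | q , r , A≈ , hr with ≈[]? r
  ...     | yes r≈0 = q , ≈-sym (⊛-cancelˡ (B ⊛ B) (λ B²≈0 → B≉0 (⊛-integral B B B²≈0 B≉0)) (begin
    (B ⊛ B) ⊛ (q ⊛ q)          ≈⟨ solveₚ 2 (λ b q → (b ⊠ b) ⊠ (q ⊠ q) ≔ (q ⊠ b) ⊠ (q ⊠ b)) ≈-refl B q ⟩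
    (q ⊛ B) ⊛ (q ⊛ B)          ≈⟨ ⊛-cong A≈′ A≈′ ⟨
    A ⊛ A                      ≈⟨ A²≈ ⟩
    g ⊛ (B ⊛ B)                ≈⟨ P.*-comm g _ ⟩
    (B ⊛ B) ⊛ g                ∎))
    where
    open P.Reasoning
    A≈′ : A ≈ q ⊛ B
    A≈′ = ≈-trans A≈ (≈-trans (⊕-cong ≈-refl r≈0) (P.+-identityʳ _))
  ...     | no r≉0 = square-quotient n (g ⊛ B ⊕ ⊖ (q ⊛ A)) r g
                       (Deg<-mono r d≤n hr) r≉0 (begin
    (g ⊛ B ⊕ ⊖ (q ⊛ A)) ⊛ (g ⊛ B ⊕ ⊖ (q ⊛ A))
      ≈⟨ solveₚ 4 (λ g b q a → (g ⊠ b ⊞ (⊟ (q ⊠ a))) ⊠ (g ⊠ b ⊞ (⊟ (q ⊠ a)))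
           ≔ (g ⊠ (g ⊠ (b ⊠ b)) ⊞ (⊟ (g ⊠ ((q ⊠ b) ⊠ a ⊞ (q ⊠ b) ⊠ a)))) ⊞ (q ⊠ q) ⊠ (a ⊠ a)) ≈-refl g B q A ⟩
    g ⊛ (g ⊛ (B ⊛ B)) ⊕ ⊖ (g ⊛ ((q ⊛ B) ⊛ A ⊕ (q ⊛ B) ⊛ A)) ⊕ (q ⊛ q) ⊛ (A ⊛ A)
      ≈⟨ ⊕-cong (⊕-cong (⊛-cong ≈-refl (≈-sym A²≈)) ≈-refl) (⊛-cong ≈-refl A²≈) ⟩
    g ⊛ (A ⊛ A) ⊕ ⊖ (g ⊛ ((q ⊛ B) ⊛ A ⊕ (q ⊛ B) ⊛ A)) ⊕ (q ⊛ q) ⊛ (g ⊛ (B ⊛ B))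
      ≈⟨ solveₚ 4 (λ g b q a → (g ⊠ (a ⊠ a) ⊞ (⊟ (g ⊠ ((q ⊠ b) ⊠ a ⊞ (q ⊠ b) ⊠ a)))) ⊞ (q ⊠ q) ⊠ (g ⊠ (b ⊠ b))
           ≔ g ⊠ ((a ⊞ (⊟ (q ⊠ b))) ⊠ (a ⊞ (⊟ (q ⊠ b))))) ≈-refl g B q A ⟩
    g ⊛ ((A ⊕ ⊖ (q ⊛ B)) ⊛ (A ⊕ ⊖ (q ⊛ B)))
      ≈⟨ ⊛-cong ≈-refl (⊛-cong r≈ r≈) ⟩
    g ⊛ (r ⊛ r) ∎)
    where
    open P.Reasoning
    r≈ : A ⊕ ⊖ (q ⊛ B) ≈ r
    r≈ = ≈-trans (⊕-cong A≈ ≈-refl) (solveₚ 2 (λ u r → (u ⊞ r) ⊞ (⊟ u) ≔ r) ≈-refl (q ⊛ B) r)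
    d≤n : d ≤ n
    d≤n with d ℕₚ.≤? n
    ... | yes le = le
    ... | no d≰n = contradiction (hB d (ℕₚ.≰⇒> d≰n)) lc≢0

-- Linear systems with more unknowns than equations.

module LinearAlgebra (𝕂 : DecidableField) where

  open Polynomials 𝕂
  open import Data.List.Base using (List; []; _∷_; map; length)
  open import Data.List.Properties using (length-map)
  open import Data.List.Relation.Unary.All as All using (All; []; _∷_)
  open import Data.List.Relation.Unary.All.Properties using (map⁻)
  open import Data.Nat.Base as ℕ using (ℕ; zero; suc; _<_)
  open import Data.Sum.Base using (_⊎_; inj₁; inj₂)
  open import Data.Vec.Base as Vec using (Vec; []; _∷_; zipWith)

  zeros : ∀ n → Vec F n
  zeros zero = []
  zeros (suc n) = 0# ∷ zeros n

  axpy : ∀ {n} → F → Vec F n → Vec F n → Vec F n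
  axpy a = zipWith (λ x y → a * x + y)

  dot : ∀ {n} → Vec F n → Vec F n → F
  dot [] [] = 0#
  dot (a ∷ as) (b ∷ bs) = a * b + dot as bs

  dot-zeros : ∀ {n} (v : Vec F n) → dot v (zeros n) ≡ 0#
  dot-zeros [] = refl
  dot-zeros (a ∷ v) = trans (cong₂ _+_ (zeroʳ a) (dot-zeros v)) (+-identityʳ 0#)

  dot-axpy : ∀ {n} a (u v w : Vec F n) → dot (axpy a u v) w ≡ a * dot u w + dot v w
  dot-axpy a [] [] [] = sym (trans (+-identityʳ _) (zeroʳ a))
  dot-axpy a (x ∷ u) (y ∷ v) (z ∷ w) rewrite dot-axpy a u v w =
    solveᶠ 6 (λ a x y z p q → (a *ᶠ x +ᶠ y) *ᶠ z +ᶠ (a *ᶠ p +ᶠ q) ≔ᶠ a *ᶠ (x *ᶠ z +ᶠ p) +ᶠ (y *ᶠ z +ᶠ q)) refl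
      a x y z (dot u w) (dot v w)

  Kills : ∀ {n} → Vec F n → Vec F n → Set
  Kills v r = dot r v ≡ 0#

  private
    Pivot : ∀ {n} → List (Vec F (suc n)) → Set
    Pivot {n} rows = ∃[ c ] ∃[ t ] ∃[ rest ] (c ≢ 0# × length rows ≡ suc (length rest) ×
                     (∀ v → Kills v (c ∷ t) → All (Kills v) rest → All (Kills v) rows))

    pivot : ∀ {n} (rows : List (Vec F (suc n))) → All (Kills (1# ∷ zeros n)) rows ⊎ Pivot rows
    pivot [] = inj₁ []
    pivot ((c ∷ t) ∷ rows) with c ≟ 0#
    ... | no c≢0 = inj₂ (c , t , rows , c≢0 , refl , λ v k ks → k ∷ ks)
    ... | yes c≡0 with pivot rows
    ...   | inj₁ ks = inj₁ (trans (cong₂ _+_ (trans (*-identityʳ c) c≡0) (dot-zeros t)) (+-identityʳ 0#) ∷ ks)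
    ...   | inj₂ (c′ , t′ , rest , c′≢0 , len , ok) =
      inj₂ (c′ , t′ , (c ∷ t) ∷ rest , c′≢0 , cong suc len , λ { v k (k′ ∷ ks) → k′ ∷ ok v k ks })

  -- Gaussian elimination by columns. A pivot row expresses the first unknown and leaves one row and
  -- one unknown fewer; without a pivot the first unit vector is a solution.
  solution : ∀ {n} (rows : List (Vec F n)) → length rows < n → ∃[ v ] (v ≢ zeros n × All (Kills v) rows)
  solution {suc n} rows len with pivot rows
  ... | inj₁ ks = 1# ∷ zeros n , (λ e → 1≢0 (cong Vec.head e)) , ks
  ... | inj₂ (c , t , rest , c≢0 , len≡ , ok) =
    x ∷ w , (λ e → w≢0 (cong Vec.tail e)) , ok (x ∷ w) killed (All.map (λ {r} → lift r) (map⁻ kw))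
    where
    c⁻¹ = proj₁ (invertible c c≢0)
    eliminate : Vec F (suc n) → Vec F n
    eliminate (h ∷ r) = axpy (- (h * c⁻¹)) t r
    IH = solution (map eliminate rest)
      (subst (_< n) (sym (length-map eliminate rest)) (ℕ.s≤s⁻¹ (subst (_< suc n) len≡ len)))
    w = proj₁ IH
    w≢0 = proj₁ (proj₂ IH)
    kw : All (Kills w) (map eliminate rest)
    kw = proj₂ (proj₂ IH)
    x = - (c⁻¹ * dot t w)
    killed : c * x + dot t w ≡ 0#
    killed = begin
      c * - (c⁻¹ * dot t w) + dot t w    ≡⟨ solveᶠ 3 (λ c y d → c *ᶠ (-ᶠ (y *ᶠ d)) +ᶠ d ≔ᶠ (-ᶠ ((c *ᶠ y) *ᶠ d)) +ᶠ d) refl c c⁻¹ (dot t w) ⟩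
      - ((c * c⁻¹) * dot t w) + dot t w  ≡⟨ cong (λ z → - z + dot t w) (trans (cong (_* dot t w) (proj₂ (invertible c c≢0))) (*-identityˡ _)) ⟩
      - dot t w + dot t w                ≡⟨ -‿inverseˡ _ ⟩
      0#                                 ∎
      where open ≡-Reasoning
    lift : ∀ r → Kills w (eliminate r) → Kills (x ∷ w) r
    lift (h ∷ r) k = begin
      h * - (c⁻¹ * dot t w) + dot r w    ≡⟨ solveᶠ 4 (λ h y d s → h *ᶠ (-ᶠ (y *ᶠ d)) +ᶠ s ≔ᶠ (-ᶠ (h *ᶠ y)) *ᶠ d +ᶠ s) refl h c⁻¹ (dot t w) (dot r w) ⟩
      - (h * c⁻¹) * dot t w + dot r w    ≡⟨ dot-axpy (- (h * c⁻¹)) t r w ⟨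
      dot (eliminate (h ∷ r)) w          ≡⟨ k ⟩
      0#                                 ∎
      where open ≡-Reasoning

  IsLinear : ∀ {n} → (Vec F n → F) → Set
  IsLinear φ = ∀ a v w → φ (axpy a v w) ≡ a * φ v + φ w

  private
    axpy-zeros : ∀ a n → axpy a (zeros n) (zeros n) ≡ zeros n
    axpy-zeros a zero = refl
    axpy-zeros a (suc n) = cong₂ _∷_ (trans (+-identityʳ _) (zeroʳ a)) (axpy-zeros a n)

    axpy-zerosˡ : ∀ {n} a (w : Vec F n) → axpy a (zeros n) w ≡ w
    axpy-zerosˡ a [] = refl
    axpy-zerosˡ a (x ∷ w) = cong₂ _∷_ (trans (cong (_+ x) (zeroʳ a)) (+-identityˡ x)) (axpy-zerosˡ a w)

    linear-zeros : ∀ {n} (φ : Vec F n → F) → IsLinear φ → φ (zeros n) ≡ 0#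
    linear-zeros {n} φ lin = begin
      φ (zeros n)                                  ≡⟨ cong φ (axpy-zeros (- 1#) n) ⟨
      φ (axpy (- 1#) (zeros n) (zeros n))          ≡⟨ lin (- 1#) _ _ ⟩
      - 1# * φ (zeros n) + φ (zeros n)             ≡⟨ solveᶠ 2 (λ o x → (-ᶠ o) *ᶠ x +ᶠ x ≔ᶠ (-ᶠ (o *ᶠ x)) +ᶠ x) refl 1# (φ (zeros n)) ⟩
      - (1# * φ (zeros n)) + φ (zeros n)           ≡⟨ cong (λ z → - z + φ (zeros n)) (*-identityˡ _) ⟩
      - φ (zeros n) + φ (zeros n)                  ≡⟨ -‿inverseˡ _ ⟩
      0#                                           ∎
      where open ≡-Reasoning

    row : ∀ {n} → (Vec F n → F) → Vec F n
    row {zero} φ = []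
    row {suc n} φ = φ (1# ∷ zeros n) ∷ row (λ w → φ (0# ∷ w))

    dot-row : ∀ {n} (φ : Vec F n → F) → IsLinear φ → ∀ v → φ v ≡ dot (row φ) v
    dot-row φ lin [] = linear-zeros φ lin
    dot-row {suc n} φ lin (x ∷ w) = begin
      φ (x ∷ w)
        ≡⟨ cong₂ (λ y u → φ (y ∷ u)) (trans (+-identityʳ _) (*-identityʳ x)) (axpy-zerosˡ x w) ⟨
      φ (axpy x (1# ∷ zeros n) (0# ∷ w))
        ≡⟨ lin x (1# ∷ zeros n) (0# ∷ w) ⟩
      x * φ (1# ∷ zeros n) + φ (0# ∷ w)
        ≡⟨ cong₂ _+_ (*-comm x _) (dot-row (λ w → φ (0# ∷ w)) tail-linear w) ⟩
      φ (1# ∷ zeros n) * x + dot (row (λ w → φ (0# ∷ w))) w ∎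
      where
      open ≡-Reasoning
      tail-linear : IsLinear (λ w → φ (0# ∷ w))
      tail-linear a v w = trans (cong (λ z → φ (z ∷ axpy a v w)) (sym (trans (+-identityʳ _) (zeroʳ a)))) (lin a (0# ∷ v) (0# ∷ w))

  -- The conditions on the auxiliary polynomial arise as functionals, not as a matrix; evaluation at
  -- the unit vectors recovers the matrix rows.
  common-kernel : ∀ {n} (φs : List (Vec F n → F)) → All IsLinear φs → length φs < n →
                  ∃[ v ] (v ≢ zeros n × All (λ φ → φ v ≡ 0#) φs)
  common-kernel φs lins len with solution (map row φs) (subst (_< _) (sym (length-map row φs)) len)
  ... | v , v≢0 , ks = v , v≢0 , All.zipWith (λ (lin , k) → trans (dot-row _ lin v) k) (lins , map⁻ ks)

-- Sums of blocks x^(kn) U and the action of the Euler operator on them.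

module Stepanov (𝕂 : DecidableField) where

  open Polynomials 𝕂
  open Divisibility 𝕂
  open LinearAlgebra 𝕂
  open import Data.List.Base as List using (List; []; _∷_; _++_)
  open import Data.List.Relation.Unary.All as All using (All; []; _∷_)
  open import Data.Nat.Base as ℕ using (ℕ; zero; suc; _<_; _≤_; z≤n; s≤s)
  import Data.Nat.Properties as ℕₚ
  open import Data.Vec.Base as Vec using (Vec; []; _∷_; take; drop; toList)
  open import Data.Vec.Properties using (take-zipWith; drop-zipWith; take++drop≡id)

  Σₚ : ℕ → (ℕ → Poly) → Poly
  Σₚ zero u = []
  Σₚ (suc B) u = u 0 ⊕ Σₚ B (λ k → u (suc k))

  Σₚ-cong : ∀ B {u w} → (∀ k → u k ≈ w k) → Σₚ B u ≈ Σₚ B w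
  Σₚ-cong zero p = ≈-refl
  Σₚ-cong (suc B) p = ⊕-cong (p 0) (Σₚ-cong B (λ k → p (suc k)))

  Σₚ-linear : ∀ B g h u w → Σₚ B (λ k → g ⊛ u k ⊕ h ⊛ w k) ≈ g ⊛ Σₚ B u ⊕ h ⊛ Σₚ B w
  Σₚ-linear zero g h u w = ≈-sym (≈-trans (⊕-cong (P.zeroʳ g) (P.zeroʳ h)) (P.+-identityʳ []))
  Σₚ-linear (suc B) g h u w = ≈-trans (⊕-cong ≈-refl (Σₚ-linear B g h _ _))
    (solveₚ 6 (λ g h a b c d → (g ⊠ a ⊞ h ⊠ b) ⊞ (g ⊠ c ⊞ h ⊠ d) ≔ g ⊠ (a ⊞ c) ⊞ h ⊠ (b ⊞ d)) ≈-refl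
      g h (u 0) (w 0) (Σₚ B (λ k → u (suc k))) (Σₚ B (λ k → w (suc k))))

  Σₚ-⊛ : ∀ B g u → Σₚ B (λ k → g ⊛ u k) ≈ g ⊛ Σₚ B u
  Σₚ-⊛ zero g u = ≈-sym (P.zeroʳ g)
  Σₚ-⊛ (suc B) g u = ≈-trans (⊕-cong ≈-refl (Σₚ-⊛ B g _)) (≈-sym (P.distribˡ g _ _))

  θ-[] : θ [] ≈ []
  θ-[] .at i = trans (coeff-θ [] i) (zeroʳ _)

  θ-Σₚ : ∀ B u → θ (Σₚ B u) ≈ Σₚ B (λ k → θ (u k))
  θ-Σₚ zero u = θ-[]
  θ-Σₚ (suc B) u = ≈-trans (θ-⊕ (u 0) _) (⊕-cong ≈-refl (θ-Σₚ B _))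

  eval-Σₚ : ∀ B {u w} x → (∀ k → eval (u k) x ≡ eval (w k) x) → eval (Σₚ B u) x ≡ eval (Σₚ B w) x
  eval-Σₚ zero x p = refl
  eval-Σₚ (suc B) {u} {w} x p =
    trans (eval-⊕ (u 0) _ x) (trans (cong₂ _+_ (p 0) (eval-Σₚ B x (λ k → p (suc k)))) (sym (eval-⊕ (w 0) _ x)))

  Deg<-Σₚ : ∀ B {d} u → (∀ k → k < B → Deg< d (u k)) → Deg< d (Σₚ B u)
  Deg<-Σₚ zero u h i _ = refl
  Deg<-Σₚ (suc B) u h = Deg<-⊕ (u 0) _ (h 0 (s≤s z≤n)) (Deg<-Σₚ B _ (λ k k<B → h (suc k) (s≤s k<B)))

  X≉[] : ¬ X ≈ []
  X≉[] p = 1≢0 (p .at 1)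

  θ-X^ : ∀ j → θ (X ⊛^ j) ≈ C (ι j) ⊛ X ⊛^ j
  θ-X^ j = ⊛-cancelˡ X X≉[] (begin
    X ⊛ θ (X ⊛^ j)               ≈⟨ ⊛-θ-⊛^ X j ⟩
    C (ι j) ⊛ (θ X ⊛ X ⊛^ j)     ≈⟨ ⊛-cong ≈-refl (⊛-cong θX ≈-refl) ⟩
    C (ι j) ⊛ (X ⊛ X ⊛^ j)       ≈⟨ solveₚ 3 (λ c x m → c ⊠ (x ⊠ m) ≔ x ⊠ (c ⊠ m)) ≈-refl (C (ι j)) X (X ⊛^ j) ⟩
    X ⊛ (C (ι j) ⊛ X ⊛^ j)       ∎)
    where open P.Reasoning

  coeff-X^⊛ : ∀ n s t → t < n → coeff (X ⊛^ n ⊛ s) t ≡ 0#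
  coeff-X^⊛ (suc n) s t t<n = trans (≈-trans (P.*-assoc X (X ⊛^ n) s) (X⊛ (X ⊛^ n ⊛ s)) .at t) (go t t<n)
    where
    go : ∀ t → t < suc n → coeff (0# ∷ (X ⊛^ n ⊛ s)) t ≡ 0#
    go zero _ = refl
    go (suc t) (s≤s t<n) = coeff-X^⊛ n s t t<n

  low-zero⇒X^∣ : ∀ n f → (∀ t → t < n → coeff f t ≡ 0#) → ∃[ s ] f ≈ X ⊛^ n ⊛ s
  low-zero⇒X^∣ zero f h = f , ≈-sym (P.*-identityˡ f)
  low-zero⇒X^∣ (suc n) [] h = [] , ≈-sym (P.zeroʳ _)
  low-zero⇒X^∣ (suc n) (a ∷ as) h with low-zero⇒X^∣ n as (λ t t<n → h (suc t) (s≤s t<n))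
  ... | s , p = s , ≈-trans (∷-cong (h 0 (s≤s z≤n)) p) (≈-trans (≈-sym (X⊛ _)) (≈-sym (P.*-assoc X (X ⊛^ n) s)))

  Deg<-X^ : ∀ n → Deg< (suc n) (X ⊛^ n)
  Deg<-X^ zero (suc i) _ = refl
  Deg<-X^ (suc n) = Deg<-⊛ X (X ⊛^ n) 1 (suc n) (λ { (suc (suc i)) _ → refl ; (suc zero) (s≤s ()) }) (Deg<-X^ n)

  Deg<-⊛^ : ∀ f d n → Deg< (suc d) f → Deg< (suc (n ℕ.* d)) (f ⊛^ n)
  Deg<-⊛^ f d zero h (suc i) _ = refl
  Deg<-⊛^ f d (suc n) h = Deg<-mono (f ⊛^ suc n) (ℕₚ.≤-reflexive (ℕₚ.+-suc d (n ℕ.* d))) (Deg<-⊛ f (f ⊛^ n) d _ h (Deg<-⊛^ f d n h))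

  zeros-++ : ∀ m n → zeros m Vec.++ zeros n ≡ zeros (m ℕ.+ n)
  zeros-++ zero n = refl
  zeros-++ (suc m) n = cong (0# ∷_) (zeros-++ m n)

  -- The unknown vector is cut into B lists of l coefficients. Past the last block the value is the
  -- zero polynomial, so the A and D families, which differ in their number of blocks, can share one
  -- range of summation.
  blocks : ∀ B l → Vec F (B ℕ.* l) → ℕ → Poly
  blocks zero    l v k       = []
  blocks (suc B) l v zero    = toList (take l v)
  blocks (suc B) l v (suc k) = blocks B l (drop l v) k

  private
    Deg<-toList : ∀ {l} (v : Vec F l) → Deg< l (toList v)
    Deg<-toList [] i _ = refl
    Deg<-toList (x ∷ v) (suc i) (s≤s le) = Deg<-toList v i le

    toList-axpy : ∀ {l} a (v w : Vec F l) i → coeff (toList (axpy a v w)) i ≡ a * coeff (toList v) i + coeff (toList w) i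
    toList-axpy a [] [] i = sym (trans (+-identityʳ _) (zeroʳ a))
    toList-axpy a (x ∷ v) (y ∷ w) zero = refl
    toList-axpy a (x ∷ v) (y ∷ w) (suc i) = toList-axpy a v w i

    toList≈[] : ∀ {l} (v : Vec F l) → toList v ≈ [] → v ≡ zeros l
    toList≈[] [] p = refl
    toList≈[] (x ∷ v) p = cong₂ _∷_ (p .at 0) (toList≈[] v (≈-sym ([]≈tail (≈-sym p))))

  split-zeros : ∀ m {n} (v : Vec F (m ℕ.+ n)) → take m v ≡ zeros m → drop m v ≡ zeros n → v ≡ zeros (m ℕ.+ n)
  split-zeros m {n} v p q = trans (sym (take++drop≡id m v)) (trans (cong₂ Vec._++_ p q) (zeros-++ m n))

  Deg<-blocks : ∀ B l v k → Deg< l (blocks B l v k)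
  Deg<-blocks zero l v k i _ = refl
  Deg<-blocks (suc B) l v zero = Deg<-toList (take l v)
  Deg<-blocks (suc B) l v (suc k) = Deg<-blocks B l (drop l v) k

  blocks-beyond : ∀ B l v k → B ≤ k → blocks B l v k ≈ []
  blocks-beyond zero l v k _ = ≈-refl
  blocks-beyond (suc B) l v (suc k) (s≤s le) = blocks-beyond B l (drop l v) k le

  blocks≈[]⇒zeros : ∀ B l v → (∀ k → k < B → blocks B l v k ≈ []) → v ≡ zeros (B ℕ.* l)
  blocks≈[]⇒zeros zero l [] h = refl
  blocks≈[]⇒zeros (suc B) l v h =
    split-zeros l v (toList≈[] (take l v) (h 0 (s≤s z≤n))) (blocks≈[]⇒zeros B l (drop l v) (λ k k<B → h (suc k) (s≤s k<B)))

  Linear : ∀ {N} → (Vec F N → Poly) → Set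
  Linear φ = ∀ a v w → φ (axpy a v w) ≈ C a ⊛ φ v ⊕ φ w

  coeffs-linear : ∀ {N} (φ : Vec F N → Poly) →
    (∀ a v w i → coeff (φ (axpy a v w)) i ≡ a * coeff (φ v) i + coeff (φ w) i) → Linear φ
  coeffs-linear φ h a v w .at i =
    trans (h a v w i) (sym (trans (coeff-⊕ (C a ⊛ φ v) (φ w) i) (cong (_+ coeff (φ w) i) (coeff-C⊛ a (φ v) i))))

  blocks-linear : ∀ B l k → Linear (λ v → blocks B l v k)
  blocks-linear B l k = coeffs-linear _ (go B k)
    where
    go : ∀ B k a v w i → coeff (blocks B l (axpy a v w) k) i ≡ a * coeff (blocks B l v k) i + coeff (blocks B l w k) i
    go zero k a v w i = sym (trans (+-identityʳ _) (zeroʳ a))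
    go (suc B) zero a v w i = trans (cong (λ u → coeff (toList u) i) (take-zipWith {m = l} (λ x y → a * x + y) v w)) (toList-axpy a (take l v) (take l w) i)
    go (suc B) (suc k) a v w i = trans (cong (λ u → coeff (blocks B l u k) i) (drop-zipWith {m = l} (λ x y → a * x + y) v w)) (go B k a (drop l v) (drop l w) i)

  linear-⊕ : ∀ {N} (φ ψ : Vec F N → Poly) → Linear φ → Linear ψ → Linear (λ v → φ v ⊕ ψ v)
  linear-⊕ φ ψ p q a v w = ≈-trans (⊕-cong (p a v w) (q a v w))
    (solveₚ 5 (λ c x y z t → (c ⊠ x ⊞ y) ⊞ (c ⊠ z ⊞ t) ≔ c ⊠ (x ⊞ z) ⊞ (y ⊞ t)) ≈-refl (C a) (φ v) (φ w) (ψ v) (ψ w))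

  linear-⊖ : ∀ {N} (φ : Vec F N → Poly) → Linear φ → Linear (λ v → ⊖ φ v)
  linear-⊖ φ p a v w = ≈-trans (⊖-cong (p a v w))
    (solveₚ 3 (λ c x y → ⊟ (c ⊠ x ⊞ y) ≔ c ⊠ (⊟ x) ⊞ (⊟ y)) ≈-refl (C a) (φ v) (φ w))

  linear-⊛ : ∀ {N} g (φ : Vec F N → Poly) → Linear φ → Linear (λ v → g ⊛ φ v)
  linear-⊛ g φ p a v w = ≈-trans (⊛-cong ≈-refl (p a v w))
    (solveₚ 4 (λ g c x y → g ⊠ (c ⊠ x ⊞ y) ≔ c ⊠ (g ⊠ x) ⊞ g ⊠ y) ≈-refl g (C a) (φ v) (φ w))

  linear-θ : ∀ {N} (φ : Vec F N → Poly) → Linear φ → Linear (λ v → θ (φ v))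
  linear-θ φ p a v w = begin
    θ (φ (axpy a v w))          ≈⟨ θ-cong (p a v w) ⟩
    θ (C a ⊛ φ v ⊕ φ w)         ≈⟨ θ-⊕ (C a ⊛ φ v) (φ w) ⟩
    θ (C a ⊛ φ v) ⊕ θ (φ w)     ≈⟨ ⊕-cong (θ-cong (C⊛≈· a (φ v))) ≈-refl ⟩
    θ (a · φ v) ⊕ θ (φ w)       ≈⟨ ⊕-cong (≈-trans (θ-· a (φ v)) (≈-sym (C⊛≈· a (θ (φ v))))) ≈-refl ⟩
    C a ⊛ θ (φ v) ⊕ θ (φ w)     ∎
    where open P.Reasoning

  linear-Σₚ : ∀ {N} B (φ : ℕ → Vec F N → Poly) → (∀ k → Linear (φ k)) → Linear (λ v → Σₚ B (λ k → φ k v))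
  linear-Σₚ zero φ p a v w = ≈-sym (≈-trans (⊕-cong (P.zeroʳ (C a)) ≈-refl) (P.+-identityʳ []))
  linear-Σₚ (suc B) φ p = linear-⊕ (φ 0) (λ v → Σₚ B (λ k → φ (suc k) v)) (p 0) (linear-Σₚ B _ (λ k → p (suc k)))

  coeff-IsLinear : ∀ {N} (φ : Vec F N → Poly) → Linear φ → ∀ i → IsLinear (λ v → coeff (φ v) i)
  coeff-IsLinear φ p i a v w =
    trans (p a v w .at i) (trans (coeff-⊕ (C a ⊛ φ v) (φ w) i) (cong (_+ coeff (φ w) i) (coeff-C⊛ a (φ v) i)))

  eval-IsLinear : ∀ {N} (φ : Vec F N → Poly) → Linear φ → ∀ x → IsLinear (λ v → eval (φ v) x)
  eval-IsLinear φ p x a v w =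
    trans (eval-cong x (p a v w)) (trans (eval-⊕ (C a ⊛ φ v) (φ w) x)
      (cong (_+ eval (φ w) x) (trans (eval-⊛ (C a) (φ v) x) (cong (_* eval (φ v) x) (eval-C a x)))))

  eval-X^ : ∀ x n → eval (X ⊛^ n) x ≡ x ^ n
  eval-X^ x n = trans (eval-⊛^ X n x) (cong (_^ n) (eval-X x))

  ^-* : ∀ x k n → x ^ (k ℕ.* n) ≡ (x ^ n) ^ k
  ^-* x zero n = refl
  ^-* x (suc k) n = trans (go n) (cong (x ^ n *_) (^-* x k n))
    where
    go : ∀ j → x ^ (j ℕ.+ k ℕ.* n) ≡ x ^ j * x ^ (k ℕ.* n)
    go zero = sym (*-identityˡ _)
    go (suc j) = trans (cong (x *_) (go j)) (sym (*-assoc x _ _))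

  module Operators (f : Poly) (n e B : ℕ) where

    ε ε′ : F
    ε = ι e
    ε′ = 1# + - ε

    fᵉ f′ : Poly
    fᵉ = f ⊛^ e
    f′ = θ f

    mono : ℕ → Poly
    mono k = X ⊛^ (k ℕ.* n)

    Ev : (ℕ → Poly) → Poly
    Ev u = Σₚ B (λ k → mono k ⊛ u k)

    -- 𝒫 k and ℋ c k describe f^c-twisted Euler operators on the k-th block:
    -- θ (x^kn U) = x^kn 𝒫 U and f θ (f^c x^kn U) = f^c x^kn ℋ U.
    𝒫 : ℕ → Poly → Poly
    𝒫 k U = θ U ⊕ C (ι (k ℕ.* n)) ⊛ U

    ℋ : F → ℕ → Poly → Poly
    ℋ c k U = f ⊛ 𝒫 k U ⊕ (C c ⊛ f′) ⊛ U

    θ-Ev : ∀ u → θ (Ev u) ≈ Ev (λ k → 𝒫 k (u k))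
    θ-Ev u = ≈-trans (θ-Σₚ B _) (Σₚ-cong B (λ k → begin
      θ (mono k ⊛ u k)                                        ≈⟨ θ-⊛ (mono k) (u k) ⟩
      θ (mono k) ⊛ u k ⊕ mono k ⊛ θ (u k)                     ≈⟨ ⊕-cong (⊛-cong (θ-X^ (k ℕ.* n)) ≈-refl) ≈-refl ⟩
      (C (ι (k ℕ.* n)) ⊛ mono k) ⊛ u k ⊕ mono k ⊛ θ (u k)     ≈⟨ solveₚ 4 (λ c m u t → (c ⊠ m) ⊠ u ⊞ m ⊠ t ≔ m ⊠ (t ⊞ c ⊠ u)) ≈-refl (C (ι (k ℕ.* n))) (mono k) (u k) (θ (u k)) ⟩
      mono k ⊛ 𝒫 k (u k)                                      ∎))
      where open P.Reasoning

    Ev-linear : ∀ g h u w → Ev (λ k → g ⊛ u k ⊕ h ⊛ w k) ≈ g ⊛ Ev u ⊕ h ⊛ Ev w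
    Ev-linear g h u w = ≈-trans
      (Σₚ-cong B (λ k → solveₚ 5 (λ m g h a b → m ⊠ (g ⊠ a ⊞ h ⊠ b) ≔ g ⊠ (m ⊠ a) ⊞ h ⊠ (m ⊠ b)) ≈-refl (mono k) g h (u k) (w k)))
      (Σₚ-linear B g h _ _)

    Ev-ℋ : ∀ c u → Ev (λ k → ℋ c k (u k)) ≈ f ⊛ Ev (λ k → 𝒫 k (u k)) ⊕ (C c ⊛ f′) ⊛ Ev u
    Ev-ℋ c u = Ev-linear f (C c ⊛ f′) (λ k → 𝒫 k (u k)) u

    private
      ε′⊛ : ∀ z → C ε′ ⊛ z ≈ z ⊕ ⊖ (C ε ⊛ z)
      ε′⊛ z .at i = begin
        coeff (C ε′ ⊛ z) i                       ≡⟨ coeff-C⊛ ε′ z i ⟩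
        (1# + - ε) * coeff z i                   ≡⟨ solveᶠ 3 (λ o e z → (o +ᶠ (-ᶠ e)) *ᶠ z ≔ᶠ o *ᶠ z +ᶠ (-ᶠ (e *ᶠ z))) refl 1# ε (coeff z i) ⟩
        1# * coeff z i + - (ε * coeff z i)       ≡⟨ cong₂ (λ a b → a + - b) (*-identityˡ _) (sym (coeff-C⊛ ε z i)) ⟩
        coeff z i + - coeff (C ε ⊛ z) i          ≡⟨ cong (coeff z i +_) (coeff-⊖ (C ε ⊛ z) i) ⟨
        coeff z i + coeff (⊖ (C ε ⊛ z)) i        ≡⟨ coeff-⊕ z (⊖ (C ε ⊛ z)) i ⟨
        coeff (z ⊕ ⊖ (C ε ⊛ z)) i                ∎
        where open ≡-Reasoning

    -- Only the f^e part grows in degree here, by 4; the plain part merely acquires a factor f. At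
    -- the points in question f^e = - f, so this f can be divided out of both parts.
    f-θ-even : ∀ u w → f ⊛ θ (Ev u ⊕ fᵉ ⊛ Ev w) ≈ f ⊛ Ev (λ k → 𝒫 k (u k)) ⊕ fᵉ ⊛ Ev (λ k → ℋ ε k (w k))
    f-θ-even u w = begin
      f ⊛ θ (Ev u ⊕ fᵉ ⊛ Ev w)                               ≈⟨ ⊛-cong ≈-refl (≈-trans (θ-⊕ (Ev u) _) (⊕-cong (θ-Ev u) (≈-trans (θ-⊛ fᵉ (Ev w)) (⊕-cong ≈-refl (⊛-cong ≈-refl (θ-Ev w)))))) ⟩
      f ⊛ (a′ ⊕ (θ fᵉ ⊛ Ev w ⊕ fᵉ ⊛ b′))                     ≈⟨ solveₚ 6 (λ f a φ′ b φ b′ → f ⊠ (a ⊞ (φ′ ⊠ b ⊞ φ ⊠ b′)) ≔ f ⊠ a ⊞ ((f ⊠ φ′) ⊠ b ⊞ (f ⊠ φ) ⊠ b′)) ≈-refl f a′ (θ fᵉ) (Ev w) fᵉ b′ ⟩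
      f ⊛ a′ ⊕ ((f ⊛ θ fᵉ) ⊛ Ev w ⊕ (f ⊛ fᵉ) ⊛ b′)           ≈⟨ ⊕-cong ≈-refl (⊕-cong (⊛-cong (⊛-θ-⊛^ f e) ≈-refl) ≈-refl) ⟩
      f ⊛ a′ ⊕ ((C ε ⊛ (f′ ⊛ fᵉ)) ⊛ Ev w ⊕ (f ⊛ fᵉ) ⊛ b′)    ≈⟨ ⊕-cong ≈-refl (solveₚ 6 (λ c t φ b f b′ → (c ⊠ (t ⊠ φ)) ⊠ b ⊞ (f ⊠ φ) ⊠ b′ ≔ φ ⊠ (f ⊠ b′ ⊞ (c ⊠ t) ⊠ b)) ≈-refl (C ε) f′ fᵉ (Ev w) f b′) ⟩
      f ⊛ a′ ⊕ fᵉ ⊛ (f ⊛ b′ ⊕ (C ε ⊛ f′) ⊛ Ev w)             ≈⟨ ⊕-cong ≈-refl (⊛-cong ≈-refl (Ev-ℋ ε w)) ⟨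
      f ⊛ a′ ⊕ fᵉ ⊛ Ev (λ k → ℋ ε k (w k))                   ∎
      where
      open P.Reasoning
      a′ = Ev (λ k → 𝒫 k (u k))
      b′ = Ev (λ k → 𝒫 k (w k))

    -- The operator f θ - e f′ is f θ conjugated by f^e. It sends f^e b to f^e f θb, and it sends f
    -- a, seen as f^e times f^(1-e) a, to f times the operator ℋ with exponent 1 - e. Both results
    -- contain a factor f, which is what returns from R° to the next R.
    f-θ-odd : ∀ u w → f ⊛ θ (f ⊛ Ev u ⊕ fᵉ ⊛ Ev w) ⊕ ⊖ (C ε ⊛ f′) ⊛ (f ⊛ Ev u ⊕ fᵉ ⊛ Ev w)
                    ≈ f ⊛ (Ev (λ k → ℋ ε′ k (u k)) ⊕ fᵉ ⊛ Ev (λ k → 𝒫 k (w k)))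
    f-θ-odd u w = begin
      f ⊛ θ (f ⊛ a ⊕ fᵉ ⊛ b) ⊕ ⊖ (C ε ⊛ f′) ⊛ (f ⊛ a ⊕ fᵉ ⊛ b)
        ≈⟨ ⊕-cong (⊛-cong ≈-refl (≈-trans (θ-⊕ (f ⊛ a) _) (⊕-cong (≈-trans (θ-⊛ f a) (⊕-cong ≈-refl (⊛-cong ≈-refl (θ-Ev u))))
                                                                    (≈-trans (θ-⊛ fᵉ b) (⊕-cong ≈-refl (⊛-cong ≈-refl (θ-Ev w))))))) ≈-refl ⟩
      f ⊛ ((f′ ⊛ a ⊕ f ⊛ a′) ⊕ (θ fᵉ ⊛ b ⊕ fᵉ ⊛ b′)) ⊕ ⊖ (C ε ⊛ f′) ⊛ (f ⊛ a ⊕ fᵉ ⊛ b)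
        ≈⟨ solveₚ 6 (λ f p q φ′ b r → f ⊠ (p ⊞ (φ′ ⊠ b ⊞ q)) ⊞ r ≔ (f ⊠ (p ⊞ q) ⊞ (f ⊠ φ′) ⊠ b) ⊞ r) ≈-refl
             f (f′ ⊛ a ⊕ f ⊛ a′) (fᵉ ⊛ b′) (θ fᵉ) b (⊖ (C ε ⊛ f′) ⊛ (f ⊛ a ⊕ fᵉ ⊛ b)) ⟩
      (f ⊛ ((f′ ⊛ a ⊕ f ⊛ a′) ⊕ fᵉ ⊛ b′) ⊕ (f ⊛ θ fᵉ) ⊛ b) ⊕ ⊖ (C ε ⊛ f′) ⊛ (f ⊛ a ⊕ fᵉ ⊛ b)
        ≈⟨ ⊕-cong (⊕-cong ≈-refl (⊛-cong (⊛-θ-⊛^ f e) ≈-refl)) ≈-refl ⟩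
      (f ⊛ ((f′ ⊛ a ⊕ f ⊛ a′) ⊕ fᵉ ⊛ b′) ⊕ (C ε ⊛ (f′ ⊛ fᵉ)) ⊛ b) ⊕ ⊖ (C ε ⊛ f′) ⊛ (f ⊛ a ⊕ fᵉ ⊛ b)
        ≈⟨ ⊕-cong (⊕-cong ≈-refl (solveₚ 4 (λ c t φ b → (c ⊠ (t ⊠ φ)) ⊠ b ≔ c ⊠ (t ⊠ (φ ⊠ b))) ≈-refl (C ε) f′ fᵉ b)) ≈-refl ⟩
      (f ⊛ ((f′ ⊛ a ⊕ f ⊛ a′) ⊕ fᵉ ⊛ b′) ⊕ C ε ⊛ (f′ ⊛ (fᵉ ⊛ b))) ⊕ ⊖ (C ε ⊛ f′) ⊛ (f ⊛ a ⊕ fᵉ ⊛ b)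
        ≈⟨ solveₚ 7 (λ f t a p φ b c → (f ⊠ ((t ⊠ a ⊞ p) ⊞ φ) ⊞ c ⊠ (t ⊠ b)) ⊞ (⊟ (c ⊠ t)) ⊠ (f ⊠ a ⊞ b)
             ≔ f ⊠ ((p ⊞ (t ⊠ a ⊞ (⊟ (c ⊠ (t ⊠ a))))) ⊞ φ)) ≈-refl f f′ a (f ⊛ a′) (fᵉ ⊛ b′) (fᵉ ⊛ b) (C ε) ⟩
      f ⊛ ((f ⊛ a′ ⊕ (f′ ⊛ a ⊕ ⊖ (C ε ⊛ (f′ ⊛ a)))) ⊕ fᵉ ⊛ b′)
        ≈⟨ ⊛-cong ≈-refl (⊕-cong (⊕-cong ≈-refl (≈-trans (P.*-assoc (C ε′) f′ a) (ε′⊛ (f′ ⊛ a)))) ≈-refl) ⟨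
      f ⊛ ((f ⊛ a′ ⊕ (C ε′ ⊛ f′) ⊛ a) ⊕ fᵉ ⊛ b′)
        ≈⟨ ⊛-cong ≈-refl (⊕-cong (Ev-ℋ ε′ u) ≈-refl) ⟨
      f ⊛ (Ev (λ k → ℋ ε′ k (u k)) ⊕ fᵉ ⊛ b′) ∎
      where
      open P.Reasoning
      a = Ev u
      b = Ev w
      a′ = Ev (λ k → 𝒫 k (u k))
      b′ = Ev (λ k → 𝒫 k (w k))

    Deg<-𝒫 : ∀ {d} k U → Deg< d U → Deg< d (𝒫 k U)
    Deg<-𝒫 k U h = Deg<-⊕ (θ U) _ (Deg<-θ U h) (Deg<-C⊛ _ U h)

    Deg<-ℋ : ∀ {d} c k U → Deg< 5 f → Deg< d U → Deg< (4 ℕ.+ d) (ℋ c k U)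
    Deg<-ℋ {d} c k U hf h = Deg<-⊕ (f ⊛ 𝒫 k U) _ (Deg<-⊛ f (𝒫 k U) 4 d hf (Deg<-𝒫 k U h))
      (Deg<-⊛ (C c ⊛ f′) U 4 d (Deg<-C⊛ c f′ (Deg<-θ f hf)) h)

    linear-𝒫 : ∀ {N} k (φ : Vec F N → Poly) → Linear φ → Linear (λ v → 𝒫 k (φ v))
    linear-𝒫 k φ p = linear-⊕ (λ v → θ (φ v)) _ (linear-θ φ p) (linear-⊛ _ φ p)

    linear-ℋ : ∀ {N} c k (φ : Vec F N → Poly) → Linear φ → Linear (λ v → ℋ c k (φ v))
    linear-ℋ c k φ p = linear-⊕ (λ v → f ⊛ 𝒫 k (φ v)) _ (linear-⊛ f _ (linear-𝒫 k φ p)) (linear-⊛ _ φ p)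

-- Counting the linear conditions.

module Conditions where

  open import Data.Nat.Base using (ℕ; zero; suc; _+_; _*_)

  -- The number of linear conditions imposed by the first 2h levels for one ζ.
  rows : ℕ → ℕ → ℕ
  rows l′ zero = 0
  rows l′ (suc h) = (h * 4 + (4 + l′)) + ((h * 4 + (4 + l′)) + rows l′ h)

-- Construction of the auxiliary polynomial and the contradiction between its zeros and its degree.

module StepanovBound (𝕂 : DecidableField) where

  open Polynomials 𝕂
  open Divisibility 𝕂
  open LinearAlgebra 𝕂
  open Stepanov 𝕂
  open Conditions
  open import Data.Empty using (⊥)
  open import Data.List.Base as List using (List; []; _∷_; _++_; map; length; upTo; concatMap)
  open import Data.List.Membership.Propositional using (_∈_)
  open import Data.List.Membership.Propositional.Properties using (∈-upTo⁺; ∈-++⁻; ∈-map⁻; ∈-++⁺ˡ; ∈-++⁺ʳ)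
  open import Data.List.Properties using (length-map; length-upTo; length-++; map-++)
  open import Data.List.Relation.Unary.All as All using (All; []; _∷_)
  open import Data.List.Relation.Unary.All.Properties as Allₚ using (map⁺; map⁻; ++⁺; ++⁻ˡ; ++⁻ʳ)
  open import Data.List.Relation.Unary.Any using (here; there)
  open import Data.List.Relation.Unary.Unique.Propositional using (Unique)
  open import Data.Nat.Base as ℕ using (ℕ; zero; suc; _<_; _≤_; z≤n; s≤s)
  open import Data.Nat.ListAction using (sum)
  open import Data.Nat.ListAction.Properties using (sum-++)
  import Data.Nat.Properties as ℕₚ
  open import Data.Nat.Solver using (module +-*-Solver)
  open import Data.Sum.Base using (inj₁; inj₂; [_,_]′)
  open import Data.Vec.Base as Vec using (Vec; []; _∷_; take; drop)
  open import Data.Vec.Properties using (take-zipWith; drop-zipWith)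

  module Levels (f : Poly) (n e B : ℕ) where

    open Operators f n e B public

    module Chain (A D : ℕ → Poly) where

      -- Each index i stands for two derivatives. On the half-step to R° only the w part is
      -- multiplied by f, on the half-step to the next R only the u part, so the degrees of the
      -- restrictions grow by 4 for every two orders of vanishing instead of 4 for each.
      u u° w w° : ℕ → ℕ → Poly
      u zero k = A k
      u (suc i) k = ℋ ε′ k (u° i k)
      u° i k = 𝒫 k (u i k)
      w zero k = D k
      w (suc i) k = 𝒫 k (w° i k)
      w° i k = ℋ ε k (w i k)

      R R° : ℕ → Poly
      R i = Ev (u i) ⊕ fᵉ ⊛ Ev (w i)
      R° i = f ⊛ Ev (u° i) ⊕ fᵉ ⊛ Ev (w° i)

      diag : F → (ℕ → Poly) → Poly
      diag ζ s = Σₚ B (λ k → C (ζ ^ k) ⊛ s k)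

      -- The restrictions of R i and R° i / f to the points x with xⁿ = ζ and f(x)ᵉ = − f(x).
      Δ Δ° : F → ℕ → Poly
      Δ ζ i = diag ζ (u i) ⊕ ⊖ (f ⊛ diag ζ (w i))
      Δ° ζ i = diag ζ (u° i) ⊕ ⊖ diag ζ (w° i)

      f-θ-R : ∀ i → f ⊛ θ (R i) ≈ R° i
      f-θ-R i = f-θ-even (u i) (w i)

      f-θ-R° : ∀ i → f ⊛ θ (R° i) ⊕ ⊖ (C ε ⊛ f′) ⊛ R° i ≈ f ⊛ R (suc i)
      f-θ-R° i = f-θ-odd (u° i) (w° i)

      module _ (x : F) (x≢0 : x ≢ 0#) (fx≢0 : eval f x ≢ 0#) (fx : eval f x ^ e ≡ - eval f x) where

        eval-Ev : ∀ s → eval (Ev s) x ≡ eval (diag (x ^ n) s) x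
        eval-Ev s = eval-Σₚ B x (λ k → begin
          eval (mono k ⊛ s k) x                ≡⟨ eval-⊛ (mono k) (s k) x ⟩
          eval (mono k) x * eval (s k) x       ≡⟨ cong (_* eval (s k) x) (trans (eval-X^ x (k ℕ.* n)) (^-* x k n)) ⟩
          (x ^ n) ^ k * eval (s k) x           ≡⟨ cong (_* eval (s k) x) (eval-C _ x) ⟨
          eval (C ((x ^ n) ^ k)) x * eval (s k) x ≡⟨ eval-⊛ (C _) (s k) x ⟨
          eval (C ((x ^ n) ^ k) ⊛ s k) x       ∎)
          where open ≡-Reasoning

        eval-fᵉ : eval fᵉ x ≡ - eval f x
        eval-fᵉ = trans (eval-⊛^ f e x) fx

        eval-R : ∀ i → eval (R i) x ≡ eval (Δ (x ^ n) i) x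
        eval-R i = begin
          eval (R i) x                                   ≡⟨ eval-⊕ (Ev (u i)) _ x ⟩
          eval (Ev (u i)) x + eval (fᵉ ⊛ Ev (w i)) x     ≡⟨ cong₂ _+_ (eval-Ev (u i)) (trans (eval-⊛ fᵉ _ x) (cong₂ _*_ eval-fᵉ (eval-Ev (w i)))) ⟩
          eval du x + - eval f x * eval dw x             ≡⟨ solveᶠ 3 (λ a b c → a +ᶠ (-ᶠ b) *ᶠ c ≔ᶠ a +ᶠ (-ᶠ (b *ᶠ c))) refl (eval du x) (eval f x) (eval dw x) ⟩
          eval du x + - (eval f x * eval dw x)           ≡⟨ cong (eval du x +_) (trans (eval-⊖ (f ⊛ dw) x) (cong -_ (eval-⊛ f dw x))) ⟨
          eval du x + eval (⊖ (f ⊛ dw)) x                ≡⟨ eval-⊕ du _ x ⟨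
          eval (Δ (x ^ n) i) x                           ∎
          where
          open ≡-Reasoning
          du = diag (x ^ n) (u i)
          dw = diag (x ^ n) (w i)

        eval-R° : ∀ i → eval (R° i) x ≡ eval f x * eval (Δ° (x ^ n) i) x
        eval-R° i = begin
          eval (R° i) x                                   ≡⟨ eval-⊕ (f ⊛ Ev (u° i)) _ x ⟩
          eval (f ⊛ Ev (u° i)) x + eval (fᵉ ⊛ Ev (w° i)) x ≡⟨ cong₂ _+_ (trans (eval-⊛ f _ x) (cong (eval f x *_) (eval-Ev (u° i)))) (trans (eval-⊛ fᵉ _ x) (cong₂ _*_ eval-fᵉ (eval-Ev (w° i)))) ⟩
          eval f x * eval du x + - eval f x * eval dw x  ≡⟨ solveᶠ 3 (λ a b c → b *ᶠ a +ᶠ (-ᶠ b) *ᶠ c ≔ᶠ b *ᶠ (a +ᶠ (-ᶠ c))) refl (eval du x) (eval f x) (eval dw x) ⟩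
          eval f x * (eval du x + - eval dw x)           ≡⟨ cong (λ z → eval f x * (eval du x + z)) (eval-⊖ dw x) ⟨
          eval f x * (eval du x + eval (⊖ dw) x)         ≡⟨ cong (eval f x *_) (eval-⊕ du _ x) ⟨
          eval f x * eval (Δ° (x ^ n) i) x               ∎
          where
          open ≡-Reasoning
          du = diag (x ^ n) (u° i)
          dw = diag (x ^ n) (w° i)

        -- Induction down from level H, where the order r is given. The conditions at level i
        -- provide a zero of R° i and of R i, and `Div-θ` turns the order of R (i + 1) into one more
        -- for R° i and two more for R i.
        vanishing-order : ∀ {H r} → (∀ i → i < H → Δ (x ^ n) i ≈ [] × Δ° (x ^ n) i ≈ []) →
          (∀ j → 1 ≤ j → j ≤ H ℕ.* 2 ℕ.+ r → ι j ≢ 0#) → Div x r (R H) →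
          ∀ h i → i ℕ.+ h ≡ H → Div x (h ℕ.* 2 ℕ.+ r) (R i)
        vanishing-order {H} {r} zeroes ιj≢0 last zero i i+0≡H =
          subst (λ j → Div x r (R j)) (trans (sym i+0≡H) (ℕₚ.+-identityʳ i)) last
        vanishing-order {H} {r} zeroes ιj≢0 last (suc h) i i+h≡H = Div-θ (R i) f [] x≢0 fx≢0 small₁ Ri≡0
            (Div-cong {x} {suc (h ℕ.* 2 ℕ.+ r)} (≈-sym (≈-trans (⊕-cong (f-θ-R i) (P.zeroˡ (R i))) (P.+-identityʳ _))) odd)
          where
          i<H : i < H
          i<H = subst (i <_) i+h≡H (ℕₚ.m<m+n i (s≤s z≤n))
          h<H : suc h ≤ H
          h<H = subst (suc h ≤_) i+h≡H (ℕₚ.m≤n+m (suc h) i)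
          bound : suc h ℕ.* 2 ℕ.+ r ≤ H ℕ.* 2 ℕ.+ r
          bound = ℕₚ.+-monoˡ-≤ r (ℕₚ.*-monoˡ-≤ 2 h<H)
          small₁ : ∀ j → 1 ≤ j → j ≤ suc (h ℕ.* 2 ℕ.+ r) → ι j ≢ 0#
          small₁ j 1≤j j≤ = ιj≢0 j 1≤j (ℕₚ.≤-trans (ℕₚ.m≤n⇒m≤1+n j≤) bound)
          small₀ : ∀ j → 1 ≤ j → j ≤ h ℕ.* 2 ℕ.+ r → ι j ≢ 0#
          small₀ j 1≤j j≤ = small₁ j 1≤j (ℕₚ.m≤n⇒m≤1+n j≤)
          Ri≡0 : eval (R i) x ≡ 0#
          Ri≡0 = trans (eval-R i) (eval-cong x (proj₁ (zeroes i i<H)))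
          R°i≡0 : eval (R° i) x ≡ 0#
          R°i≡0 = trans (eval-R° i) (trans (cong (eval f x *_) (eval-cong x (proj₂ (zeroes i i<H)))) (zeroʳ _))
          next : Div x (h ℕ.* 2 ℕ.+ r) (f ⊛ R (suc i))
          next = Div-⊛ {x} {h ℕ.* 2 ℕ.+ r} f (vanishing-order zeroes ιj≢0 last h (suc i) (trans (sym (ℕₚ.+-suc i h)) i+h≡H))
          odd : Div x (suc (h ℕ.* 2 ℕ.+ r)) (R° i)
          odd = Div-θ (R° i) f (⊖ (C ε ⊛ f′)) x≢0 fx≢0 small₀ R°i≡0 (Div-cong {x} {h ℕ.* 2 ℕ.+ r} (≈-sym (f-θ-R° i)) next)

      module _ (l′ : ℕ) (hf : Deg< 5 f) (hA : ∀ k → Deg< (4 ℕ.+ l′) (A k)) (hD : ∀ k → Deg< l′ (D k)) where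

        width : ℕ → ℕ
        width i = i ℕ.* 4 ℕ.+ (4 ℕ.+ l′)

        private
          width≡ : ∀ i → 4 ℕ.+ (i ℕ.* 4 ℕ.+ l′) ≡ width i
          width≡ i = +-*-Solver.solve 2 (λ i l → con 4 :+ (i :* con 4 :+ l) := i :* con 4 :+ (con 4 :+ l)) refl i l′
            where open +-*-Solver

          Deg<-u : ∀ i k → Deg< (width i) (u i k)
          Deg<-u zero k = hA k
          Deg<-u (suc i) k = Deg<-ℋ ε′ k (u° i k) hf (Deg<-𝒫 k (u i k) (Deg<-u i k))

          Deg<-w : ∀ i k → Deg< (i ℕ.* 4 ℕ.+ l′) (w i k)
          Deg<-w zero k = hD k
          Deg<-w (suc i) k = Deg<-𝒫 k (w° i k) (Deg<-ℋ ε k (w i k) hf (Deg<-w i k))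

          Deg<-diag : ∀ {d} ζ s → (∀ k → Deg< d (s k)) → Deg< d (diag ζ s)
          Deg<-diag ζ s h = Deg<-Σₚ B _ (λ k _ → Deg<-C⊛ (ζ ^ k) (s k) (h k))

        Deg<-Δ : ∀ ζ i → Deg< (width i) (Δ ζ i)
        Deg<-Δ ζ i = Deg<-⊕ (diag ζ (u i)) _ (Deg<-diag ζ (u i) (Deg<-u i))
          (Deg<-⊖ (f ⊛ diag ζ (w i)) (subst (λ d → Deg< d (f ⊛ diag ζ (w i))) (width≡ i)
            (Deg<-⊛ f (diag ζ (w i)) 4 _ hf (Deg<-diag ζ (w i) (Deg<-w i)))))

        Deg<-Δ° : ∀ ζ i → Deg< (width i) (Δ° ζ i)
        Deg<-Δ° ζ i = Deg<-⊕ (diag ζ (u° i)) _ (Deg<-diag ζ (u° i) (λ k → Deg<-𝒫 k (u i k) (Deg<-u i k)))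
          (Deg<-⊖ (diag ζ (w° i)) (Deg<-diag ζ (w° i)
            (λ k → subst (λ d → Deg< d (w° i k)) (width≡ i) (Deg<-ℋ ε k (w i k) hf (Deg<-w i k)))))

    open Chain using (u; u°; w; w°; R; R°; diag; Δ; Δ°; width; Deg<-Δ; Deg<-Δ°; vanishing-order)

    module _ {N} (A D : Vec F N → ℕ → Poly) (linA : ∀ k → Linear (λ v → A v k)) (linD : ∀ k → Linear (λ v → D v k)) where

      private
        linear-u : ∀ i k → Linear (λ v → u (A v) (D v) i k)
        linear-u zero k = linA k
        linear-u (suc i) k = linear-ℋ ε′ k _ (linear-𝒫 k _ (linear-u i k))

        linear-w : ∀ i k → Linear (λ v → w (A v) (D v) i k)
        linear-w zero k = linD k
        linear-w (suc i) k = linear-𝒫 k _ (linear-ℋ ε k _ (linear-w i k))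

        linear-diag : ∀ ζ (s : Vec F N → ℕ → Poly) → (∀ k → Linear (λ v → s v k)) →
                      Linear (λ v → diag (A v) (D v) ζ (s v))
        linear-diag ζ s h = linear-Σₚ B _ (λ k → linear-⊛ (C (ζ ^ k)) _ (h k))

      linear-Δ : ∀ ζ i → Linear (λ v → Δ (A v) (D v) ζ i)
      linear-Δ ζ i = linear-⊕ (λ v → diag (A v) (D v) ζ (u (A v) (D v) i)) _ (linear-diag ζ _ (linear-u i))
        (linear-⊖ _ (linear-⊛ f _ (linear-diag ζ _ (linear-w i))))

      linear-Δ° : ∀ ζ i → Linear (λ v → Δ° (A v) (D v) ζ i)
      linear-Δ° ζ i = linear-⊕ (λ v → diag (A v) (D v) ζ (u° (A v) (D v) i)) _
        (linear-diag ζ _ (λ k → linear-𝒫 k _ (linear-u i k)))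
        (linear-⊖ _ (linear-diag ζ _ (λ k → linear-ℋ ε k _ (linear-w i k))))

      linear-R : ∀ i → Linear (λ v → R (A v) (D v) i)
      linear-R i = linear-⊕ (λ v → Ev (u (A v) (D v) i)) _
        (linear-Σₚ B _ (λ k → linear-⊛ (mono k) _ (linear-u i k)))
        (linear-⊛ fᵉ _ (linear-Σₚ B _ (λ k → linear-⊛ (mono k) _ (linear-w i k))))

  private
    coefficients : ∀ {N} → ℕ → (Vec F N → Poly) → List (Vec F N → F)
    coefficients d φ = map (λ t v → coeff (φ v) t) (upTo d)

    coefficients-linear : ∀ {N} d (φ : Vec F N → Poly) → Linear φ → All IsLinear (coefficients d φ)
    coefficients-linear d φ p = map⁺ (All.tabulate (λ {t} _ → coeff-IsLinear φ p t))

    coefficients-zero : ∀ {N} d (φ : Vec F N → Poly) v → Deg< d (φ v) → All (λ ψ → ψ v ≡ 0#) (coefficients d φ) → φ v ≈ []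
    coefficients-zero d φ v h zs .at t with d ℕₚ.≤? t
    ... | yes d≤t = h t d≤t
    ... | no d≰t = All.lookup (map⁻ zs) (∈-upTo⁺ (ℕₚ.≰⇒> d≰t))

    length-coefficients : ∀ {N} d (φ : Vec F N → Poly) → length (coefficients d φ) ≡ d
    length-coefficients d φ = trans (length-map _ (upTo d)) (length-upTo d)

    length-concatMap : ∀ {A B : Set} (g : A → List B) d xs → (∀ x → length (g x) ≡ d) → length (concatMap g xs) ≡ length xs ℕ.* d
    length-concatMap g d [] h = refl
    length-concatMap g d (x ∷ xs) h = trans (length-++ (g x)) (cong₂ ℕ._+_ (h x) (length-concatMap g d xs h))

    All-concatMap⁺ : ∀ {A B : Set} {Q : B → Set} (g : A → List B) xs → (∀ x → All Q (g x)) → All Q (concatMap g xs)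
    All-concatMap⁺ g [] h = []
    All-concatMap⁺ g (x ∷ xs) h = ++⁺ (h x) (All-concatMap⁺ g xs h)

    All-concatMap⁻ : ∀ {A B : Set} {Q : B → Set} (g : A → List B) {x} xs → x ∈ xs → All Q (concatMap g xs) → All Q (g x)
    All-concatMap⁻ g (x ∷ xs) (here refl) qs = ++⁻ˡ (g x) qs
    All-concatMap⁻ g (x ∷ xs) (there x∈) qs = All-concatMap⁻ g xs x∈ (++⁻ʳ (g x) qs)

  module Nonvanishing (f : Poly) (n e : ℕ) (hf : Deg< 5 f)
    (nonsquare : ∀ c q → c ≢ 0# → ¬ C c ⊛ f ≈ q ⊛ q)
    (c₀ : F) (c₀≢0 : c₀ ≢ 0#) (s₀ : Poly) (f²ᵉ≈ : f ⊛^ e ⊛ f ⊛^ e ≈ f ⊛ (C c₀ ⊕ X ⊛^ n ⊛ s₀))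
    (l′ : ℕ) (small : (4 ℕ.+ l′) ℕ.+ (4 ℕ.+ l′) ≤ suc n) where

    private
      fᵉ = f ⊛^ e
      l = 4 ℕ.+ l′

      Evₙ : ℕ → (ℕ → Poly) → Poly
      Evₙ B u = Σₚ B (λ k → X ⊛^ (k ℕ.* n) ⊛ u k)

      Ev-suc : ∀ B u → Evₙ (suc B) u ≈ u 0 ⊕ X ⊛^ n ⊛ Evₙ B (λ k → u (suc k))
      Ev-suc B u = ⊕-cong (P.*-identityˡ (u 0))
        (≈-trans (Σₚ-cong B (λ k → ≈-trans (⊛-cong (⊛^-+ X n (k ℕ.* n)) ≈-refl) (P.*-assoc _ _ _))) (Σₚ-⊛ B (X ⊛^ n) _))

      -- From A = - f^e D follows A² = f^(2e) D², and f^(2e) is c₀ f modulo x^n. Modulo x^n only the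
      -- lowest blocks remain, and both sides have degree below n, so the congruence is an equality.
      lowest-block : ∀ A₀ A₁ D₀ D₁ → Deg< l A₀ → Deg< l′ D₀ →
        (A₀ ⊕ X ⊛^ n ⊛ A₁) ⊕ fᵉ ⊛ (D₀ ⊕ X ⊛^ n ⊛ D₁) ≈ [] → A₀ ⊛ A₀ ≈ (C c₀ ⊛ f) ⊛ (D₀ ⊛ D₀)
      lowest-block A₀ A₁ D₀ D₁ hA hD R≈0 = ⊖≈[] δ≈0
        where
        y = X ⊛^ n
        A = A₀ ⊕ y ⊛ A₁
        D = D₀ ⊕ y ⊛ D₁
        δ = A₀ ⊛ A₀ ⊕ ⊖ ((C c₀ ⊛ f) ⊛ (D₀ ⊛ D₀))
        squares : A ⊛ A ≈ (f ⊛ (C c₀ ⊕ y ⊛ s₀)) ⊛ (D ⊛ D)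
        squares = begin
          A ⊛ A                                       ≈⟨ solveₚ 2 (λ a b → a ⊠ a ≔ (a ⊞ b) ⊠ (a ⊞ (⊟ b)) ⊞ b ⊠ b) ≈-refl A (fᵉ ⊛ D) ⟩
          (A ⊕ fᵉ ⊛ D) ⊛ (A ⊕ ⊖ (fᵉ ⊛ D)) ⊕ (fᵉ ⊛ D) ⊛ (fᵉ ⊛ D)  ≈⟨ ⊕-cong (≈[]⊛ _ R≈0) ≈-refl ⟩
          [] ⊕ (fᵉ ⊛ D) ⊛ (fᵉ ⊛ D)                    ≈⟨ ≈-trans (P.+-comm [] _) (P.+-identityʳ _) ⟩
          (fᵉ ⊛ D) ⊛ (fᵉ ⊛ D)                         ≈⟨ solveₚ 2 (λ f d → (f ⊠ d) ⊠ (f ⊠ d) ≔ (f ⊠ f) ⊠ (d ⊠ d)) ≈-refl fᵉ D ⟩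
          (fᵉ ⊛ fᵉ) ⊛ (D ⊛ D)                         ≈⟨ ⊛-cong f²ᵉ≈ ≈-refl ⟩
          (f ⊛ (C c₀ ⊕ y ⊛ s₀)) ⊛ (D ⊛ D)             ∎
          where open P.Reasoning
        rA = A₀ ⊛ A₁ ⊕ A₀ ⊛ A₁ ⊕ y ⊛ (A₁ ⊛ A₁)
        rD = D₀ ⊛ D₁ ⊕ D₀ ⊛ D₁ ⊕ y ⊛ (D₁ ⊛ D₁)
        s = (f ⊛ s₀) ⊛ (D ⊛ D) ⊕ (C c₀ ⊛ f) ⊛ rD ⊕ ⊖ rA
        δ≈ : δ ≈ y ⊛ s
        δ≈ = begin
          A₀ ⊛ A₀ ⊕ ⊖ (cf ⊛ (D₀ ⊛ D₀))
            ≈⟨ solveₚ 4 (λ a b g y → a ⊠ a ⊞ (⊟ g)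
                 ≔ ((a ⊞ y ⊠ b) ⊠ (a ⊞ y ⊠ b) ⊞ (⊟ g)) ⊞ (⊟ (y ⊠ ((a ⊠ b ⊞ a ⊠ b) ⊞ y ⊠ (b ⊠ b))))) ≈-refl A₀ A₁ (cf ⊛ (D₀ ⊛ D₀)) y ⟩
          (A ⊛ A ⊕ ⊖ (cf ⊛ (D₀ ⊛ D₀))) ⊕ ⊖ (y ⊛ rA)
            ≈⟨ ⊕-cong (⊕-cong squares ≈-refl) ≈-refl ⟩
          ((f ⊛ (C c₀ ⊕ y ⊛ s₀)) ⊛ (D ⊛ D) ⊕ ⊖ (cf ⊛ (D₀ ⊛ D₀))) ⊕ ⊖ (y ⊛ rA)
            ≈⟨ solveₚ 7 (λ f c y s d g r → ((f ⊠ (c ⊞ y ⊠ s)) ⊠ d ⊞ g) ⊞ (⊟ (y ⊠ r))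
                 ≔ (y ⊠ ((f ⊠ s) ⊠ d) ⊞ ((c ⊠ f) ⊠ d ⊞ g)) ⊞ (⊟ (y ⊠ r))) ≈-refl f (C c₀) y s₀ (D ⊛ D) (⊖ (cf ⊛ (D₀ ⊛ D₀))) rA ⟩
          (y ⊛ ((f ⊛ s₀) ⊛ (D ⊛ D)) ⊕ (cf ⊛ (D ⊛ D) ⊕ ⊖ (cf ⊛ (D₀ ⊛ D₀)))) ⊕ ⊖ (y ⊛ rA)
            ≈⟨ ⊕-cong (⊕-cong ≈-refl (solveₚ 4 (λ g d e y → g ⊠ ((d ⊞ y ⊠ e) ⊠ (d ⊞ y ⊠ e)) ⊞ (⊟ (g ⊠ (d ⊠ d)))
                 ≔ y ⊠ (g ⊠ ((d ⊠ e ⊞ d ⊠ e) ⊞ y ⊠ (e ⊠ e)))) ≈-refl cf D₀ D₁ y)) ≈-refl ⟩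
          (y ⊛ ((f ⊛ s₀) ⊛ (D ⊛ D)) ⊕ y ⊛ (cf ⊛ rD)) ⊕ ⊖ (y ⊛ rA)
            ≈⟨ solveₚ 4 (λ y a b c → (y ⊠ a ⊞ y ⊠ b) ⊞ (⊟ (y ⊠ c)) ≔ y ⊠ ((a ⊞ b) ⊞ (⊟ c))) ≈-refl y ((f ⊛ s₀) ⊛ (D ⊛ D)) (cf ⊛ rD) rA ⟩
          y ⊛ s ∎
          where
          open P.Reasoning
          cf = C c₀ ⊛ f
        -- A₀² has degree at most 2 l - 2, and `small` says 2 l - 1 ≤ n. This is what limits the
        -- length l of a block to about n/2.
        hδ : Deg< n δ
        hδ = Deg<-⊕ (A₀ ⊛ A₀) _
          (Deg<-mono (A₀ ⊛ A₀) (ℕ.s≤s⁻¹ small) (Deg<-⊛ A₀ A₀ (3 ℕ.+ l′) l hA hA))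
          (Deg<-⊖ ((C c₀ ⊛ f) ⊛ (D₀ ⊛ D₀)) (Deg<-mono ((C c₀ ⊛ f) ⊛ (D₀ ⊛ D₀)) bound
            (Deg<-⊛ (C c₀ ⊛ f) (D₀ ⊛ D₀) 4 (l′ ℕ.+ l′) (Deg<-C⊛ c₀ f hf) (Deg<-⊛ D₀ D₀ l′ l′ (Deg<-mono D₀ (ℕₚ.n≤1+n l′) hD) hD))))
          where
          bound : 4 ℕ.+ (l′ ℕ.+ l′) ≤ n
          bound = ℕₚ.≤-trans (ℕₚ.≤-trans (ℕₚ.m≤n+m (4 ℕ.+ (l′ ℕ.+ l′)) 3) (ℕₚ.≤-reflexive eq)) (ℕ.s≤s⁻¹ small)
            where
            open +-*-Solver
            eq : 3 ℕ.+ (4 ℕ.+ (l′ ℕ.+ l′)) ≡ 3 ℕ.+ (l′ ℕ.+ (4 ℕ.+ l′))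
            eq = solve 1 (λ l → con 3 :+ (con 4 :+ (l :+ l)) := con 3 :+ (l :+ (con 4 :+ l))) refl l′
        δ≈0 : δ ≈ []
        δ≈0 .at t with n ℕₚ.≤? t
        ... | yes n≤t = hδ t n≤t
        ... | no n≰t = trans (δ≈ .at t) (coeff-X^⊛ n s t (ℕₚ.≰⇒> n≰t))

    -- A nonzero D₀ would make c₀ f a square. Once both lowest blocks vanish, x^n divides out and
    -- the next pair becomes the lowest.
    nonvanishing : ∀ B A D → (∀ k → Deg< l (A k)) → (∀ k → Deg< l′ (D k)) → Evₙ B A ⊕ fᵉ ⊛ Evₙ B D ≈ [] →
                   ∀ k → k < B → A k ≈ [] × D k ≈ []
    nonvanishing (suc B) A D hA hD R≈0 = λ { zero _ → A₀≈0 , D₀≈0 ; (suc k) (s≤s k<B) → rest k k<B }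
      where
      A₁ = Evₙ B (λ k → A (suc k))
      D₁ = Evₙ B (λ k → D (suc k))
      y = X ⊛^ n
      split : (A 0 ⊕ y ⊛ A₁) ⊕ fᵉ ⊛ (D 0 ⊕ y ⊛ D₁) ≈ []
      split = ≈-trans (≈-sym (⊕-cong (Ev-suc B A) (⊛-cong ≈-refl (Ev-suc B D)))) R≈0
      A₀²≈ = lowest-block (A 0) A₁ (D 0) D₁ (hA 0) (hD 0) split
      D₀≈0 : D 0 ≈ []
      D₀≈0 with ≈[]? (D 0)
      ... | yes p = p
      ... | no D₀≉0 = contradiction (proj₂ root) (nonsquare c₀ (proj₁ root) c₀≢0)
        where root = square-quotient l′ (A 0) (D 0) (C c₀ ⊛ f) (hD 0) D₀≉0 A₀²≈
      A₀≈0 : A 0 ≈ []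
      A₀≈0 with ≈[]? (A 0)
      ... | yes p = p
      ... | no A₀≉0 = ⊛-integral (A 0) (A 0) (≈-trans A₀²≈ (⊛≈[] _ (⊛≈[] _ D₀≈0))) A₀≉0
      y≉0 : ¬ y ≈ []
      y≉0 = ⊛^-nonzero n X≉[]
      tail≈0 : A₁ ⊕ fᵉ ⊛ D₁ ≈ []
      tail≈0 = ⊛-integral (A₁ ⊕ fᵉ ⊛ D₁) y (begin
        (A₁ ⊕ fᵉ ⊛ D₁) ⊛ y                              ≈⟨ solveₚ 4 (λ a f d y → (a ⊞ f ⊠ d) ⊠ y ≔ y ⊠ a ⊞ f ⊠ (y ⊠ d)) ≈-refl A₁ fᵉ D₁ y ⟩
        y ⊛ A₁ ⊕ fᵉ ⊛ (y ⊛ D₁)                          ≈⟨ ⊕-cong (≈-trans (⊕-cong A₀≈0 ≈-refl) (≈-trans (P.+-comm [] _) (P.+-identityʳ _)))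
                                                              (⊛-cong ≈-refl (≈-trans (⊕-cong D₀≈0 ≈-refl) (≈-trans (P.+-comm [] _) (P.+-identityʳ _)))) ⟨
        (A 0 ⊕ y ⊛ A₁) ⊕ fᵉ ⊛ (D 0 ⊕ y ⊛ D₁)            ≈⟨ split ⟩
        []                                              ∎) y≉0
        where open P.Reasoning
      rest = nonvanishing B (λ k → A (suc k)) (λ k → D (suc k)) (λ k → hA (suc k)) (λ k → hD (suc k)) tail≈0

  -- K contains the values xⁿ. The points are split: in Y the level-h polynomial is also made to
  -- vanish, at one condition per point, and the order becomes 2h + 1; in Z it is 2h. This fine
  -- tuning of the number of zeros decides the tightest cases.
  module Bound (f : Poly) (n e : ℕ) (hf : Deg< 5 f)
    (nonsquare : ∀ c q → c ≢ 0# → ¬ C c ⊛ f ≈ q ⊛ q)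
    (c₀ : F) (c₀≢0 : c₀ ≢ 0#) (s₀ : Poly) (f²ᵉ≈ : f ⊛^ e ⊛ f ⊛^ e ≈ f ⊛ (C c₀ ⊕ X ⊛^ n ⊛ s₀))
    (l′ m B′ h : ℕ) (small : (4 ℕ.+ l′) ℕ.+ (4 ℕ.+ l′) ≤ suc n) (e≡ : e ℕ.* 4 ≡ 4 ℕ.+ (m ℕ.+ m) ℕ.* n)
    (ιj≢0 : ∀ j → 1 ≤ j → j ≤ h ℕ.* 2 ℕ.+ 1 → ι j ≢ 0#)
    (K Y Z : List F) (unique : Unique (Y ++ Z))
    (good : ∀ {x} → x ∈ Y ++ Z → x ≢ 0# × eval f x ≢ 0# × eval f x ^ e ≡ - eval f x × x ^ n ∈ K)
    where

    private
      -- The degree of f^e is at most 4 e = 2 m n + 4. With 2 m more blocks and 4 more coefficients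
      -- per block, the A part gets the same degree bound as f^e times the D part.
      l = 4 ℕ.+ l′
      B = suc (B′ ℕ.+ (m ℕ.+ m))
      N = B ℕ.* l ℕ.+ suc B′ ℕ.* l′
      open Levels f n e B
      open Chain using (R; Δ; Δ°; width; Deg<-Δ; Deg<-Δ°; vanishing-order)

      Aᵥ Dᵥ : Vec F N → ℕ → Poly
      Aᵥ v = blocks B l (take (B ℕ.* l) v)
      Dᵥ v = blocks (suc B′) l′ (drop (B ℕ.* l) v)

      linA : ∀ k → Linear (λ v → Aᵥ v k)
      linA k a v w = ≈-trans (P.reflexive (cong (λ z → blocks B l z k) (take-zipWith {m = B ℕ.* l} (λ x y → a * x + y) v w)))
                             (blocks-linear B l k a (take (B ℕ.* l) v) (take (B ℕ.* l) w))

      linD : ∀ k → Linear (λ v → Dᵥ v k)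
      linD k a v w = ≈-trans (P.reflexive (cong (λ z → blocks (suc B′) l′ z k) (drop-zipWith {m = B ℕ.* l} (λ x y → a * x + y) v w)))
                             (blocks-linear (suc B′) l′ k a (drop (B ℕ.* l) v) (drop (B ℕ.* l) w))

      wd : ℕ → ℕ
      wd i = i ℕ.* 4 ℕ.+ l

      Δᵥ Δ°ᵥ : F → ℕ → Vec F N → Poly
      Δᵥ ζ i v = Δ (Aᵥ v) (Dᵥ v) ζ i
      Δ°ᵥ ζ i v = Δ° (Aᵥ v) (Dᵥ v) ζ i

      conditions : F → ℕ → List (Vec F N → F)
      conditions ζ zero = []
      conditions ζ (suc i) = coefficients (wd i) (Δᵥ ζ i) ++ coefficients (wd i) (Δ°ᵥ ζ i) ++ conditions ζ i

      conditions-linear : ∀ ζ i → All IsLinear (conditions ζ i)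
      conditions-linear ζ zero = []
      conditions-linear ζ (suc i) = ++⁺ (coefficients-linear (wd i) (Δᵥ ζ i) (linear-Δ Aᵥ Dᵥ linA linD ζ i))
        (++⁺ (coefficients-linear (wd i) (Δ°ᵥ ζ i) (linear-Δ° Aᵥ Dᵥ linA linD ζ i)) (conditions-linear ζ i))

      length-conditions : ∀ ζ i → length (conditions ζ i) ≡ rows l′ i
      length-conditions ζ zero = refl
      length-conditions ζ (suc i) = trans (length-++ (coefficients (wd i) (Δᵥ ζ i)))
        (cong₂ ℕ._+_ (length-coefficients (wd i) (Δᵥ ζ i)) (trans (length-++ (coefficients (wd i) (Δ°ᵥ ζ i)))
          (cong₂ ℕ._+_ (length-coefficients (wd i) (Δ°ᵥ ζ i)) (length-conditions ζ i))))

      hA : ∀ v k → Deg< l (Aᵥ v k)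
      hA v = Deg<-blocks B l (take (B ℕ.* l) v)

      hD : ∀ v k → Deg< l′ (Dᵥ v k)
      hD v = Deg<-blocks (suc B′) l′ (drop (B ℕ.* l) v)

      conditions-zero : ∀ ζ v i → All (λ ψ → ψ v ≡ 0#) (conditions ζ i) → ∀ j → j < i → Δᵥ ζ j v ≈ [] × Δ°ᵥ ζ j v ≈ []
      conditions-zero ζ v (suc i) zs j (s≤s j≤i) with ℕₚ.m≤n⇒m<n∨m≡n j≤i
      ... | inj₁ j<i = conditions-zero ζ v i (++⁻ʳ (coefficients (wd i) (Δ°ᵥ ζ i)) (++⁻ʳ (coefficients (wd i) (Δᵥ ζ i)) zs)) j j<i
      ... | inj₂ refl =
        coefficients-zero (wd i) (Δᵥ ζ i) v (Deg<-Δ (Aᵥ v) (Dᵥ v) l′ hf (hA v) (hD v) ζ i) (++⁻ˡ (coefficients (wd i) (Δᵥ ζ i)) zs) ,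
        coefficients-zero (wd i) (Δ°ᵥ ζ i) v (Deg<-Δ° (Aᵥ v) (Dᵥ v) l′ hf (hA v) (hD v) ζ i)
          (++⁻ˡ (coefficients (wd i) (Δ°ᵥ ζ i)) (++⁻ʳ (coefficients (wd i) (Δᵥ ζ i)) zs))

      points : List (Vec F N → F)
      points = map (λ y v → eval (R (Aᵥ v) (Dᵥ v) h) y) Y

      system : List (Vec F N → F)
      system = concatMap (λ ζ → conditions ζ h) K ++ points

      system-linear : All IsLinear system
      system-linear = ++⁺ (All-concatMap⁺ _ K (λ ζ → conditions-linear ζ h))
        (map⁺ (All.tabulate (λ {y} _ → eval-IsLinear _ (linear-R Aᵥ Dᵥ linA linD h) y)))

      length-system : length system ≡ length K ℕ.* rows l′ h ℕ.+ length Y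
      length-system = trans (length-++ (concatMap (λ ζ → conditions ζ h) K))
        (cong₂ ℕ._+_ (length-concatMap _ (rows l′ h) K (λ ζ → length-conditions ζ h)) (length-map _ Y))

      Deg<-R : ∀ v → Deg< (l ℕ.+ (B′ ℕ.+ (m ℕ.+ m)) ℕ.* n) (R (Aᵥ v) (Dᵥ v) 0)
      Deg<-R v = Deg<-⊕ (Ev (Aᵥ v)) _ (Deg<-Σₚ B (λ k → mono k ⊛ Aᵥ v k) termA) (Deg<-mono (fᵉ ⊛ Ev (Dᵥ v)) (ℕₚ.≤-reflexive eq)
          (Deg<-⊛ fᵉ (Ev (Dᵥ v)) (e ℕ.* 4) (B′ ℕ.* n ℕ.+ l′) (Deg<-⊛^ f 4 e hf) (Deg<-Σₚ B (λ k → mono k ⊛ Dᵥ v k) termD)))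
        where
        termA : ∀ k → k < B → Deg< (l ℕ.+ (B′ ℕ.+ (m ℕ.+ m)) ℕ.* n) (mono k ⊛ Aᵥ v k)
        termA k (s≤s k≤) = Deg<-mono (mono k ⊛ Aᵥ v k)
          (subst (k ℕ.* n ℕ.+ l ≤_) (ℕₚ.+-comm _ l) (ℕₚ.+-monoˡ-≤ l (ℕₚ.*-monoˡ-≤ n k≤)))
          (Deg<-⊛ (mono k) (Aᵥ v k) (k ℕ.* n) l (Deg<-X^ (k ℕ.* n)) (hA v k))
        termD : ∀ k → k < B → Deg< (B′ ℕ.* n ℕ.+ l′) (mono k ⊛ Dᵥ v k)
        termD k _ with k ℕₚ.≤? B′
        ... | yes k≤ = Deg<-mono (mono k ⊛ Dᵥ v k) (ℕₚ.+-monoˡ-≤ l′ (ℕₚ.*-monoˡ-≤ n k≤))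
          (Deg<-⊛ (mono k) (Dᵥ v k) (k ℕ.* n) l′ (Deg<-X^ (k ℕ.* n)) (hD v k))
        ... | no k≰ = λ i _ → ⊛≈[] (mono k) (blocks-beyond (suc B′) l′ (drop (B ℕ.* l) v) k (ℕₚ.≰⇒> k≰)) .at i
        eq : e ℕ.* 4 ℕ.+ (B′ ℕ.* n ℕ.+ l′) ≡ l ℕ.+ (B′ ℕ.+ (m ℕ.+ m)) ℕ.* n
        eq = trans (cong (ℕ._+ (B′ ℕ.* n ℕ.+ l′)) e≡)
          (solve 4 (λ m n b l → (con 4 :+ (m :+ m) :* n) :+ (b :* n :+ l) := (con 4 :+ l) :+ (b :+ (m :+ m)) :* n) refl m n B′ l′)
          where open +-*-Solver

      sum-const : ∀ (k : ℕ) (xs : List F) → sum (map proj₂ (map (λ x → x , k) xs)) ≡ length xs ℕ.* k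
      sum-const k [] = refl
      sum-const k (x ∷ xs) = cong (k ℕ.+_) (sum-const k xs)

      map-fst : ∀ (k : ℕ) (xs : List F) → map proj₁ (map (λ x → x , k) xs) ≡ xs
      map-fst k [] = refl
      map-fst k (x ∷ xs) = cong (x ∷_) (map-fst k xs)

      zeros-of : List (F × ℕ)
      zeros-of = map (λ x → x , h ℕ.* 2 ℕ.+ 1) Y ++ map (λ x → x , h ℕ.* 2 ℕ.+ 0) Z

      unique′ : Unique (map proj₁ zeros-of)
      unique′ = subst Unique (sym (trans (map-++ proj₁ (map (λ x → x , h ℕ.* 2 ℕ.+ 1) Y) _) (cong₂ _++_ (map-fst _ Y) (map-fst _ Z)))) unique

      total : sum (map proj₂ zeros-of) ≡ length Y ℕ.* (h ℕ.* 2 ℕ.+ 1) ℕ.+ length Z ℕ.* (h ℕ.* 2 ℕ.+ 0)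
      total = trans (cong sum (map-++ proj₂ (map (λ x → x , h ℕ.* 2 ℕ.+ 1) Y) _))
        (trans (sum-++ (map proj₂ (map (λ x → x , h ℕ.* 2 ℕ.+ 1) Y)) _) (cong₂ ℕ._+_ (sum-const _ Y) (sum-const _ Z)))

      module Kernel (v : Vec F N) (zs : All (λ ψ → ψ v ≡ 0#) system) where

        A D : ℕ → Poly
        A = Aᵥ v
        D = Dᵥ v

        vanish : ∀ {x} → x ∈ Y ++ Z → ∀ i → i < h → Δ A D (x ^ n) i ≈ [] × Δ° A D (x ^ n) i ≈ []
        vanish {x} x∈ = conditions-zero (x ^ n) v h (All-concatMap⁻ (λ ζ → conditions ζ h) K (proj₂ (proj₂ (proj₂ (good x∈))))
                          (++⁻ˡ (concatMap (λ ζ → conditions ζ h) K) zs))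

        order : ∀ {x} r → x ∈ Y ++ Z → r ≤ 1 → Div x r (R A D h) → Div x (h ℕ.* 2 ℕ.+ r) (R A D 0)
        order {x} r x∈ r≤1 last =
          vanishing-order A D x (proj₁ (good x∈)) (proj₁ (proj₂ (good x∈))) (proj₁ (proj₂ (proj₂ (good x∈)))) (vanish x∈)
            (λ j 1≤j j≤ → ιj≢0 j 1≤j (ℕₚ.≤-trans j≤ (ℕₚ.+-monoʳ-≤ (h ℕ.* 2) r≤1))) last h 0 refl

        orderY : ∀ {x} → x ∈ Y → Div x (h ℕ.* 2 ℕ.+ 1) (R A D 0)
        orderY {x} x∈ = order 1 (∈-++⁺ˡ x∈) ℕₚ.≤-refl
          (Div-suc x 0 (R A D h) (R A D h) (≈-sym (P.*-identityˡ _)) (All.lookup (map⁻ (++⁻ʳ (concatMap (λ ζ → conditions ζ h) K) zs)) x∈))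

        orderZ : ∀ {x} → x ∈ Z → Div x (h ℕ.* 2 ℕ.+ 0) (R A D 0)
        orderZ {x} x∈ = order 0 (∈-++⁺ʳ Y x∈) z≤n (R A D h , ≈-sym (P.*-identityˡ _))

        orders : ∀ {x k} → (x , k) ∈ zeros-of → Div x k (R A D 0)
        orders {x} {k} xk∈ = [ fromY , fromZ ]′ (∈-++⁻ (map (λ x → x , h ℕ.* 2 ℕ.+ 1) Y) xk∈)
          where
          transport : ∀ {y j} → (x , k) ≡ (y , j) → Div y j (R A D 0) → Div x k (R A D 0)
          transport refl d = d
          fromY : (x , k) ∈ map (λ x → x , h ℕ.* 2 ℕ.+ 1) Y → Div x k (R A D 0)
          fromY ∈Y = let (y , y∈ , eq) = ∈-map⁻ _ ∈Y in transport eq (orderY y∈)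
          fromZ : (x , k) ∈ map (λ x → x , h ℕ.* 2 ℕ.+ 0) Z → Div x k (R A D 0)
          fromZ ∈Z = let (y , y∈ , eq) = ∈-map⁻ _ ∈Z in transport eq (orderZ y∈)

        R≈0 : (4 ℕ.+ l′) ℕ.+ (B′ ℕ.+ (m ℕ.+ m)) ℕ.* n ≤ length Y ℕ.* (h ℕ.* 2 ℕ.+ 1) ℕ.+ length Z ℕ.* (h ℕ.* 2 ℕ.+ 0) → R A D 0 ≈ []
        R≈0 many = many-roots⇒≈[] zeros-of (R A D 0) _ unique′ orders (Deg<-R v) (subst (_ ≤_) (sym total) many)

        trivial : R A D 0 ≈ [] → v ≡ zeros N
        trivial R≈0 = split-zeros (B ℕ.* l) v
          (blocks≈[]⇒zeros B l (take (B ℕ.* l) v) (λ k k<B → proj₁ (all-zero k k<B)))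
          (blocks≈[]⇒zeros (suc B′) l′ (drop (B ℕ.* l) v) (λ k k<B′ → proj₂ (all-zero k (ℕₚ.≤-trans k<B′ (s≤s (ℕₚ.m≤m+n B′ (m ℕ.+ m)))))))
          where
          open Nonvanishing f n e hf nonsquare c₀ c₀≢0 s₀ f²ᵉ≈ l′ small
          all-zero : ∀ k → k < B → A k ≈ [] × D k ≈ []
          all-zero = nonvanishing B A D (hA v) (hD v) R≈0

    bound : length K ℕ.* rows l′ h ℕ.+ length Y < suc (B′ ℕ.+ (m ℕ.+ m)) ℕ.* (4 ℕ.+ l′) ℕ.+ suc B′ ℕ.* l′ →
            (4 ℕ.+ l′) ℕ.+ (B′ ℕ.+ (m ℕ.+ m)) ℕ.* n ≤ length Y ℕ.* (h ℕ.* 2 ℕ.+ 1) ℕ.+ length Z ℕ.* (h ℕ.* 2 ℕ.+ 0) → ⊥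
    bound enough many = refute (common-kernel system system-linear (subst (_< N) (sym length-system) enough))
      where
      refute : ∃[ v ] (v ≢ zeros N × All (λ ψ → ψ v ≡ 0#) system) → ⊥
      refute (v , v≢0 , zs) = v≢0 (Kernel.trivial v zs (Kernel.R≈0 v zs many))

-- Counting in lists, and the product behind Euler's function.

module Lists where

  open import Data.List.Base using (List; []; _∷_; map; length; filter)
  open import Data.List.Membership.Propositional using (_∈_)
  open import Data.List.Membership.Propositional.Properties using (∈-map⁻)
  open import Data.List.Relation.Unary.All as All using (All; []; _∷_)
  open import Data.List.Relation.Unary.AllPairs using ([]; _∷_)
  open import Data.List.Relation.Unary.Any using (here; there)
  open import Data.List.Relation.Unary.Unique.Propositional using (Unique)
  open import Data.Nat.Base using (ℕ; suc; _+_; _*_; _∸_; _≤_)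
  open import Data.Nat.Coprimality using (Coprime)
  open import Data.Nat.Properties using (+-suc)
  open import Relation.Unary using (Decidable)
  open import Relation.Nullary.Decidable using (¬?; _×-dec_)

  Unique-map : ∀ {A B : Set} (g : A → B) xs → (∀ {x y} → x ∈ xs → y ∈ xs → g x ≡ g y → x ≡ y) → Unique xs → Unique (map g xs)
  Unique-map g [] inj [] = []
  Unique-map g (x ∷ xs) inj (x∉ ∷ u) =
    All.tabulate (λ {z} z∈ gx≡z → let (y , y∈ , z≡gy) = ∈-map⁻ g z∈ in All.lookup x∉ y∈ (inj (here refl) (there y∈) (trans gx≡z z≡gy)))
    ∷ Unique-map g xs (λ x∈ y∈ → inj (there x∈) (there y∈)) u

  length-filter-split : ∀ {A : Set} {P Q : A → Set} (P? : Decidable P) (Q? : Decidable Q) xs →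
    length (filter P? xs) ≡ length (filter (λ x → P? x ×-dec Q? x) xs) + length (filter (λ x → P? x ×-dec ¬? (Q? x)) xs)
  length-filter-split P? Q? [] = refl
  length-filter-split P? Q? (x ∷ xs) with P? x | Q? x
  ... | yes _ | yes _ = cong suc (length-filter-split P? Q? xs)
  ... | yes _ | no _  = trans (cong suc (length-filter-split P? Q? xs)) (sym (+-suc _ _))
  ... | no _  | yes _ = length-filter-split P? Q? xs
  ... | no _  | no _  = length-filter-split P? Q? xs

  -- If T lists the distinct primes dividing c ∏ T, then c times this number is Euler's φ at c ∏ T.
  pred-product : List ℕ → ℕ
  pred-product [] = 1
  pred-product (l ∷ T) = (l ∸ 1) * pred-product T

  data PairwiseCoprime : List ℕ → Set where
    []  : PairwiseCoprime []
    _∷_ : ∀ {l T} → 1 ≤ l × All (Coprime l) T → PairwiseCoprime T → PairwiseCoprime (l ∷ T)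

  positive : ∀ {T l} → PairwiseCoprime T → l ∈ T → 1 ≤ l
  positive ((1≤l , _) ∷ _) (here refl) = 1≤l
  positive (_ ∷ pc) (there l∈) = positive pc l∈

-- The prime field: p-th powers, Fermat, Euler's criterion, counting elements of given order.

module PrimeCharacteristic (𝕂 : DecidableField) where

  open Polynomials 𝕂
  open Divisibility 𝕂
  open Stepanov 𝕂
  open Lists
  open import Data.Empty using (⊥)
  open import Data.List.Base as List using (List; []; _∷_; map; length; upTo; filter)
  open import Data.List.Membership.Propositional using (_∈_)
  open import Data.List.Membership.Propositional.Properties using (∈-upTo⁺; ∈-upTo⁻; ∈-map⁺; ∈-map⁻; ∈-filter⁻)
  open import Data.List.Properties using (length-map; length-upTo; filter-≐)
  open import Data.List.Relation.Unary.All as All using (All; []; _∷_)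
  import Data.List.Relation.Unary.All.Properties as Allₚ
  open import Data.List.Relation.Unary.AllPairs using ([]; _∷_)
  open import Data.List.Relation.Unary.Any as Any using (here; there)
  open import Data.List.Relation.Unary.Unique.Propositional using (Unique)
  open import Data.List.Relation.Unary.Unique.Propositional.Properties using (upTo⁺; filter⁺)
  open import Data.Nat.Base as ℕ using (ℕ; zero; suc; _<_; _≤_; _∸_; z≤n; s≤s)
  open import Data.Nat.Coprimality using (Coprime; coprime-Bézout)
  open import Data.Nat.Divisibility using (_∣_; divides)
  open import Data.Nat.DivMod using (_/_; m*n/n≡m)
  open import Data.Nat.GCD using (gcd; gcd-GCD; gcd[m,n]∣m; gcd[m,n]∣n; module Bézout)
  open import Data.Nat.ListAction using (sum; product)
  open import Data.Nat.Primality using (Prime; prime⇒nonZero)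
  open import Data.Nat.Primality.Factorisation using (factorise; PrimeFactorisation)
  import Data.Nat.Properties as ℕₚ
  open import Data.Nat.Solver using (module +-*-Solver)
  open import Data.Sum.Base using (_⊎_; inj₁; inj₂)
  open import Relation.Nullary.Decidable using (¬?; _×-dec_)
  open import Data.List.Membership.DecPropositional _≟_ using (_∈?_)

  ^-+ : ∀ x m n → x ^ (m ℕ.+ n) ≡ x ^ m * x ^ n
  ^-+ x zero n = sym (*-identityˡ _)
  ^-+ x (suc m) n = trans (cong (x *_) (^-+ x m n)) (sym (*-assoc x _ _))

  1^ : ∀ n → 1# ^ n ≡ 1#
  1^ zero = refl
  1^ (suc n) = trans (*-identityˡ _) (1^ n)

  ^-nonzero : ∀ {x} n → x ≢ 0# → x ^ n ≢ 0#
  ^-nonzero zero x≢0 = 1≢0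
  ^-nonzero (suc n) x≢0 = *-nonzero x≢0 (^-nonzero n x≢0)

  *^ : ∀ x y n → (x * y) ^ n ≡ x ^ n * y ^ n
  *^ x y zero = sym (*-identityˡ _)
  *^ x y (suc n) = trans (cong (x * y *_) (*^ x y n))
    (solveᶠ 4 (λ x y u v → (x *ᶠ y) *ᶠ (u *ᶠ v) ≔ᶠ (x *ᶠ u) *ᶠ (y *ᶠ v)) refl x y (x ^ n) (y ^ n))

  ^≡1-* : ∀ x {d} k → x ^ d ≡ 1# → x ^ (k ℕ.* d) ≡ 1#
  ^≡1-* x {d} k x^d≡1 = trans (^-* x k d) (trans (cong (_^ k) x^d≡1) (1^ k))

  ^≡1-bezout : ∀ x {d a b} → Bézout.Identity d a b → x ^ a ≡ 1# → x ^ b ≡ 1# → x ^ d ≡ 1#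
  ^≡1-bezout x {d} {a} {b} (Bézout.+- s t eq) xᵃ xᵇ = begin
    x ^ d                       ≡⟨ *-identityʳ _ ⟨
    x ^ d * 1#                  ≡⟨ cong (x ^ d *_) (^≡1-* x t xᵇ) ⟨
    x ^ d * x ^ (t ℕ.* b)       ≡⟨ ^-+ x d (t ℕ.* b) ⟨
    x ^ (d ℕ.+ t ℕ.* b)         ≡⟨ cong (x ^_) eq ⟩
    x ^ (s ℕ.* a)               ≡⟨ ^≡1-* x s xᵃ ⟩
    1#                          ∎
    where open ≡-Reasoning
  ^≡1-bezout x i@(Bézout.-+ _ _ _) xᵃ xᵇ = ^≡1-bezout x (Bézout.Identity.sym i) xᵇ xᵃ

  ι-+ : ∀ i j → ι (i ℕ.+ j) ≡ ι i + ι j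
  ι-+ zero j = sym (+-identityˡ _)
  ι-+ (suc i) j = trans (cong (1# +_) (ι-+ i j)) (sym (+-assoc _ _ _))

  roots≤degree : ∀ f d xs → ¬ f ≈ [] → Deg< (suc d) f → Unique xs → (∀ {x} → x ∈ xs → eval f x ≡ 0#) → length xs ≤ d
  roots≤degree f d xs f≉0 hf u roots with length xs ℕₚ.≤? d
  ... | yes le = le
  ... | no xs≰d = contradiction (many-roots⇒≈[] (map (λ x → x , 1) xs) f (suc d) (subst Unique (sym (fst xs)) u) divs hf
                    (subst (suc d ≤_) (sym (snd xs)) (ℕₚ.≰⇒> xs≰d))) f≉0
    where
    fst : ∀ xs → map proj₁ (map (λ x → x , 1) xs) ≡ xs
    fst [] = refl
    fst (x ∷ xs) = cong (x ∷_) (fst xs)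
    snd : ∀ (xs : List F) → sum (map proj₂ (map (λ x → x , 1) xs)) ≡ length xs
    snd [] = refl
    snd (x ∷ xs) = cong suc (snd xs)
    divs : ∀ {x k} → (x , k) ∈ map (λ x → x , 1) xs → Div x k f
    divs {x} xk∈ with ∈-map⁻ _ xk∈
    ... | y , y∈ , refl = Div-suc y 0 f f (≈-sym (P.*-identityˡ f)) (roots y∈)

  unity-poly : ℕ → Poly
  unity-poly d = X ⊛^ d ⊕ ⊖ C 1#

  eval-unity-poly : ∀ d x → eval (unity-poly d) x ≡ x ^ d + - 1#
  eval-unity-poly d x = trans (eval-⊕ (X ⊛^ d) _ x) (cong₂ _+_ (eval-X^ x d) (trans (eval-⊖ (C 1#) x) (cong -_ (eval-C 1# x))))

  coeff₀-⊛ : ∀ f g → coeff (f ⊛ g) 0 ≡ coeff f 0 * coeff g 0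
  coeff₀-⊛ [] g = trans (P.zeroˡ g .at 0) (sym (zeroˡ _))
  coeff₀-⊛ (a ∷ as) g = coeff-⊛-zero a as g

  coeff₀-⊛^ : ∀ f n → coeff (f ⊛^ n) 0 ≡ coeff f 0 ^ n
  coeff₀-⊛^ f zero = refl
  coeff₀-⊛^ f (suc n) = trans (coeff₀-⊛ f (f ⊛^ n)) (cong (coeff f 0 *_) (coeff₀-⊛^ f n))

  -1≢0 : - 1# ≢ 0#
  -1≢0 -1≡0 = 1≢0 (trans (sym (+-identityʳ 1#)) (trans (cong (1# +_) (sym -1≡0)) (-‿inverseʳ 1#)))

  unity-poly≉[] : ∀ d → 1 ≤ d → ¬ unity-poly d ≈ []
  unity-poly≉[] (suc d) _ p = -1≢0 (begin
    - 1#                                          ≡⟨ +-identityˡ _ ⟨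
    0# + - 1#                                     ≡⟨ cong₂ _+_ (trans (coeff₀-⊛ X (X ⊛^ d)) (zeroˡ _)) (coeff-⊖ (C 1#) 0) ⟨
    coeff (X ⊛^ suc d) 0 + coeff (⊖ C 1#) 0       ≡⟨ coeff-⊕ (X ⊛^ suc d) (⊖ C 1#) 0 ⟨
    coeff (unity-poly (suc d)) 0                  ≡⟨ p .at 0 ⟩
    0#                                            ∎)
    where open ≡-Reasoning

  Deg<-unity-poly : ∀ d → Deg< (suc d) (unity-poly d)
  Deg<-unity-poly d = Deg<-⊕ (X ⊛^ d) _ (Deg<-X^ d) (Deg<-⊖ (C 1#) (λ { (suc i) (s≤s _) → refl }))

  roots-of-unity≤ : ∀ d xs → 1 ≤ d → Unique xs → (∀ {x} → x ∈ xs → x ^ d ≡ 1#) → length xs ≤ d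
  roots-of-unity≤ d xs 1≤d u h = roots≤degree (unity-poly d) d xs (unity-poly≉[] d 1≤d) (Deg<-unity-poly d) u
    (λ {x} x∈ → trans (eval-unity-poly d x) (trans (cong (_+ - 1#) (h x∈)) (-‿inverseʳ 1#)))

  square≡1 : ∀ {z} → z * z ≡ 1# → z ≡ 1# ⊎ z ≡ - 1#
  square≡1 {z} z²≡1 with z ≟ 1#
  ... | yes z≡1 = inj₁ z≡1
  ... | no z≢1 = inj₂ (⊖≡0 (trans (cong (z +_) -‿involutive) (integral (begin
    (z + - 1#) * (z + 1#)          ≡⟨ solveᶠ 2 (λ z o → (z +ᶠ (-ᶠ o)) *ᶠ (z +ᶠ o) ≔ᶠ z *ᶠ z +ᶠ (-ᶠ (o *ᶠ o))) refl z 1# ⟩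
    z * z + - (1# * 1#)            ≡⟨ cong₂ (λ a b → a + - b) z²≡1 (*-identityˡ 1#) ⟩
    1# + - 1#                      ≡⟨ -‿inverseʳ 1# ⟩
    0#                             ∎) (λ e → z≢1 (⊖≡0 e)))))
    where
    open ≡-Reasoning
    -‿involutive : - (- 1#) ≡ 1#
    -‿involutive = solveᶠ 1 (λ o → -ᶠ (-ᶠ o) ≔ᶠ o) refl 1#

  -- Division with the default value 0 at l = 0, so that no `NonZero` instance has to travel along
  -- the lists of primes.
  quot : ℕ → ℕ → ℕ
  quot L zero    = 0
  quot L (suc l) = L / suc l

  quot-* : ∀ d l → 1 ≤ l → quot (d ℕ.* l) l ≡ d
  quot-* d (suc l) _ = m*n/n≡m d (suc l)

  ∈⇒∣product : ∀ {l T} → l ∈ T → l ∣ product T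
  ∈⇒∣product {l} {_ ∷ T} (here refl) = divides (product T) (ℕₚ.*-comm l (product T))
  ∈⇒∣product {l} {k ∷ T} (there l∈) with ∈⇒∣product l∈
  ... | divides d eq = divides (k ℕ.* d) (trans (cong (k ℕ.*_) eq) (sym (ℕₚ.*-assoc k d l)))

  -- Together the hypotheses say that F is the prime field with q + 1 elements, enumerated by ι.
  module Cyclic (q : ℕ) (1≤q : 1 ≤ q) (ι-char : ι (suc q) ≡ 0#) (ι-small : ∀ j → 1 ≤ j → j ≤ q → ι j ≢ 0#)
           (ι-onto : ∀ x → ∃[ j ] (j ≤ q × x ≡ ι j)) where

    -- By `⊛-θ-⊛^` the product g θ(g^p) carries the factor p = 0, so θ(g^p) = 0; its i-th
    -- coefficient is i times that of g^p, and i is invertible.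
    p-th-power : ∀ g → ¬ g ≈ [] → ∀ i → 1 ≤ i → i ≤ q → coeff (g ⊛^ suc q) i ≡ 0#
    p-th-power g g≉0 i 1≤i i≤q = integral (trans (sym (coeff-θ gᵖ i)) (θ≈0 .at i)) (ι-small i 1≤i i≤q)
      where
      gᵖ = g ⊛^ suc q
      θ≈0 : θ gᵖ ≈ []
      θ≈0 = ⊛-integral (θ gᵖ) g (≈-trans (P.*-comm (θ gᵖ) g) (≈-trans (⊛-θ-⊛^ g (suc q))
              (≈[]⊛ _ (≈-trans (C-cong ι-char) C0≈[])))) g≉0

    p-th-power-low : ∀ g n → ¬ g ≈ [] → n ≤ suc q → ∃[ s ] g ⊛^ suc q ≈ C (coeff g 0 ^ suc q) ⊕ X ⊛^ n ⊛ s
    p-th-power-low g n g≉0 n≤p = s , (begin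
      gᵖ                                ≈⟨ solveₚ 2 (λ a b → a ≔ b ⊞ (a ⊞ (⊟ b))) ≈-refl gᵖ (C c) ⟩
      C c ⊕ (gᵖ ⊕ ⊖ C c)                ≈⟨ ⊕-cong ≈-refl (proj₂ low) ⟩
      C c ⊕ X ⊛^ n ⊛ s                  ∎)
      where
      open P.Reasoning
      gᵖ = g ⊛^ suc q
      c = coeff g 0 ^ suc q
      coeffs : ∀ t → t < n → coeff (gᵖ ⊕ ⊖ C c) t ≡ 0#
      coeffs zero _ = trans (coeff-⊕ gᵖ (⊖ C c) 0) (trans (cong₂ _+_ (coeff₀-⊛^ g (suc q)) (coeff-⊖ (C c) 0)) (-‿inverseʳ c))
      coeffs (suc t) t<n = trans (coeff-⊕ gᵖ (⊖ C c) (suc t)) (trans (cong₂ _+_ (p-th-power g g≉0 (suc t) (s≤s z≤n) (ℕ.s≤s⁻¹ (ℕₚ.≤-trans t<n n≤p)))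
                             (trans (coeff-⊖ (C c) (suc t)) (trans (sym (+-identityˡ _)) (-‿inverseʳ 0#)))) (+-identityʳ 0#))
      low = low-zero⇒X^∣ n (gᵖ ⊕ ⊖ C c) coeffs
      s = proj₁ low

    private
      1+X : Poly
      1+X = 1# ∷ 1# ∷ []

      top-1+X : ∀ j → coeff (1+X ⊛^ j) j ≡ 1# × Deg< (suc j) (1+X ⊛^ j)
      top-1+X zero = refl , λ { (suc i) _ → refl }
      top-1+X (suc j) with top-1+X j
      ... | top , deg = (begin
        coeff (1+X ⊛ g) (suc j)                        ≡⟨ coeff-⊛-suc 1# (1# ∷ []) g j ⟩
        1# * coeff g (suc j) + coeff (C 1# ⊛ g) j      ≡⟨ cong₂ _+_ (trans (cong (1# *_) (deg (suc j) ℕₚ.≤-refl)) (zeroʳ _)) (trans (P.*-identityˡ g .at j) top) ⟩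
        0# + 1#                                        ≡⟨ +-identityˡ 1# ⟩
        1#                                             ∎)
        , Deg<-⊛ 1+X g 1 (suc j) (λ { (suc (suc i)) _ → refl ; (suc zero) (s≤s ()) }) deg
        where
        open ≡-Reasoning
        g = 1+X ⊛^ j

      coeff-X^ : ∀ n → coeff (X ⊛^ n) n ≡ 1#
      coeff-X^ zero = refl
      coeff-X^ (suc n) = trans (X⊛ (X ⊛^ n) .at (suc n)) (coeff-X^ n)

      coeff-X^-low : ∀ n t → t < n → coeff (X ⊛^ n) t ≡ 0#
      coeff-X^-low n t t<n = trans (sym (P.*-identityʳ (X ⊛^ n) .at t)) (coeff-X^⊛ n (C 1#) t t<n)

      p = suc q

      -- The coefficients strictly between 0 and p vanish by `p-th-power`. Evaluated, this carries
      -- the identity x^p = x from x to 1 + x, which proves Fermat's theorem for every ι j.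
      freshman : 1+X ⊛^ p ≈ C 1# ⊕ X ⊛^ p
      freshman .at zero = begin
        coeff (1+X ⊛^ p) 0                    ≡⟨ coeff₀-⊛^ 1+X p ⟩
        1# ^ p                                ≡⟨ 1^ p ⟩
        1#                                    ≡⟨ +-identityʳ 1# ⟨
        1# + 0#                               ≡⟨ cong (1# +_) (coeff-X^-low p 0 (s≤s z≤n)) ⟨
        1# + coeff (X ⊛^ p) 0                 ≡⟨ coeff-⊕ (C 1#) (X ⊛^ p) 0 ⟨
        coeff (C 1# ⊕ X ⊛^ p) 0               ∎
        where open ≡-Reasoning
      freshman .at (suc i) = trans (lhs (ℕₚ.<-cmp (suc i) p)) (sym (trans (coeff-⊕ (C 1#) (X ⊛^ p) (suc i)) (+-identityˡ _)))
        where
        open import Relation.Binary.Definitions using (Tri; tri<; tri≈; tri>)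
        lhs : Tri (suc i < p) (suc i ≡ p) (p < suc i) → coeff (1+X ⊛^ p) (suc i) ≡ coeff (X ⊛^ p) (suc i)
        lhs (tri< i<p _ _) = trans (p-th-power 1+X (λ e → 1≢0 (e .at 0)) (suc i) (s≤s z≤n) (ℕ.s≤s⁻¹ i<p)) (sym (coeff-X^-low p (suc i) i<p))
        lhs (tri≈ _ refl _) = trans (proj₁ (top-1+X p)) (sym (coeff-X^ p))
        lhs (tri> _ _ p<i) = trans (proj₂ (top-1+X p) (suc i) p<i) (sym (Deg<-X^ p (suc i) p<i))

      frobenius-suc : ∀ x → (1# + x) ^ p ≡ 1# + x ^ p
      frobenius-suc x = begin
        (1# + x) ^ p                     ≡⟨ cong (_^ p) (cong (1# +_) (trans (cong (x *_) (eval-C 1# x)) (*-identityʳ x))) ⟨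
        eval 1+X x ^ p                   ≡⟨ eval-⊛^ 1+X p x ⟨
        eval (1+X ⊛^ p) x                ≡⟨ eval-cong x freshman ⟩
        eval (C 1# ⊕ X ⊛^ p) x           ≡⟨ eval-⊕ (C 1#) (X ⊛^ p) x ⟩
        eval (C 1#) x + eval (X ⊛^ p) x  ≡⟨ cong₂ _+_ (eval-C 1# x) (eval-X^ x p) ⟩
        1# + x ^ p                       ∎
        where open ≡-Reasoning

      fermat-ι : ∀ j → ι j ^ p ≡ ι j
      fermat-ι zero = zeroˡ _
      fermat-ι (suc j) = trans (frobenius-suc (ι j)) (cong (1# +_) (fermat-ι j))

    fermat : ∀ x → x ≢ 0# → x ^ q ≡ 1#
    fermat x x≢0 = ⊖≡0 (integral (begin
      x * (x ^ q + - 1#)       ≡⟨ solveᶠ 3 (λ x y o → x *ᶠ (y +ᶠ (-ᶠ o)) ≔ᶠ x *ᶠ y +ᶠ (-ᶠ (x *ᶠ o))) refl x (x ^ q) 1# ⟩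
      x ^ p + - (x * 1#)       ≡⟨ cong₂ (λ a b → a + - b) xᵖ≡x (*-identityʳ x) ⟩
      x + - x                  ≡⟨ -‿inverseʳ x ⟩
      0#                       ∎) x≢0)
      where
      open ≡-Reasoning
      xᵖ≡x : x ^ p ≡ x
      xᵖ≡x with ι-onto x
      ... | j , _ , refl = fermat-ι j

    private
      ι-injective-ordered : ∀ i j → i ≤ j → j ≤ q → ι i ≡ ι j → i ≡ j
      ι-injective-ordered i j i≤j j≤q eq with j ∸ i in d≡
      ... | zero = ℕₚ.≤-antisym i≤j (ℕₚ.m∸n≡0⇒m≤n d≡)
      ... | suc d = contradiction (begin
        ι (suc d)                         ≡⟨ solveᶠ 2 (λ a b → b ≔ᶠ (a +ᶠ b) +ᶠ (-ᶠ a)) refl (ι i) (ι (suc d)) ⟩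
        (ι i + ι (suc d)) + - ι i         ≡⟨ cong (_+ - ι i) (ι-+ i (suc d)) ⟨
        ι (i ℕ.+ suc d) + - ι i           ≡⟨ cong (λ k → ι k + - ι i) (trans (cong (i ℕ.+_) (sym d≡)) (ℕₚ.m+[n∸m]≡n i≤j)) ⟩
        ι j + - ι i                       ≡⟨ cong (λ z → ι j + - z) eq ⟩
        ι j + - ι j                       ≡⟨ -‿inverseʳ _ ⟩
        0#                                ∎) (ι-small (suc d) (s≤s z≤n) (ℕₚ.≤-trans (ℕₚ.≤-reflexive (sym d≡)) (ℕₚ.≤-trans (ℕₚ.m∸n≤m j i) j≤q)))
        where open ≡-Reasoning

    ι-injective : ∀ i j → i ≤ q → j ≤ q → ι i ≡ ι j → i ≡ j
    ι-injective i j i≤q j≤q eq with ℕₚ.≤-total i j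
    ... | inj₁ i≤j = ι-injective-ordered i j i≤j j≤q eq
    ... | inj₂ j≤i = sym (ι-injective-ordered j i j≤i i≤q (sym eq))

    units : List F
    units = map (λ j → ι (suc j)) (upTo q)

    unique-units : Unique units
    unique-units = Unique-map _ (upTo q)
      (λ x∈ y∈ eq → ℕₚ.suc-injective (ι-injective _ _ (∈-upTo⁻ x∈) (∈-upTo⁻ y∈) eq)) (upTo⁺ q)

    ∈-units : ∀ x → x ≢ 0# → x ∈ units
    ∈-units x x≢0 with ι-onto x
    ... | zero , _ , refl = contradiction refl x≢0
    ... | suc j , j<q , refl = ∈-map⁺ _ (∈-upTo⁺ j<q)

    units-nonzero : ∀ {x} → x ∈ units → x ≢ 0#
    units-nonzero x∈ with ∈-map⁻ _ x∈
    ... | j , j∈ , refl = ι-small (suc j) (s≤s z≤n) (∈-upTo⁻ j∈)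

    length-units : length units ≡ q
    length-units = trans (length-map _ (upTo q)) (length-upTo q)

    -- The squares of 1, ..., h are h distinct roots of Y^h - 1; a further y would be one root too
    -- many.
    euler : ∀ h → h ℕ.+ h ≡ q → 1 ≤ h → ∀ y → y ^ h ≡ 1# → ∃[ z ] z * z ≡ y
    euler h h+h≡q 1≤h y yʰ≡1 with y ∈? squares
      where squares = map (λ j → ι (suc j) * ι (suc j)) (upTo h)
    ... | yes y∈ = let (j , _ , y≡) = ∈-map⁻ _ y∈ in ι (suc j) , sym y≡
    ... | no y∉ = contradiction (roots-of-unity≤ h (y ∷ squares) 1≤h (Allₚ.¬Any⇒All¬ squares y∉ ∷ unique) roots)
                    (ℕₚ.<⇒≱ (s≤s (ℕₚ.≤-reflexive (sym (trans (length-map _ (upTo h)) (length-upTo h))))))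
      where
      squares = map (λ j → ι (suc j) * ι (suc j)) (upTo h)
      h≤q : h ≤ q
      h≤q = subst (h ≤_) h+h≡q (ℕₚ.m≤m+n h h)
      inj : ∀ {i j} → i < h → j < h → ι (suc i) * ι (suc i) ≡ ι (suc j) * ι (suc j) → i ≡ j
      inj {i} {j} i<h j<h eq = ℕₚ.suc-injective (ι-injective (suc i) (suc j) (ℕₚ.≤-trans i<h h≤q) (ℕₚ.≤-trans j<h h≤q)
        (⊖≡0 (integral (trans (solveᶠ 2 (λ a b → (a +ᶠ b) *ᶠ (a +ᶠ (-ᶠ b)) ≔ᶠ a *ᶠ a +ᶠ (-ᶠ (b *ᶠ b))) refl (ι (suc i)) (ι (suc j)))
          (trans (cong (_+ - (ι (suc j) * ι (suc j))) eq) (-‿inverseʳ _)))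
          (λ e → ι-small (suc i ℕ.+ suc j) (s≤s z≤n) (subst (suc i ℕ.+ suc j ≤_) h+h≡q (ℕₚ.+-mono-≤ i<h j<h)) (trans (ι-+ (suc i) (suc j)) e)))))
      unique : Unique squares
      unique = Unique-map _ (upTo h) (λ i∈ j∈ → inj (∈-upTo⁻ i∈) (∈-upTo⁻ j∈)) (upTo⁺ h)
      roots : ∀ {x} → x ∈ y ∷ squares → x ^ h ≡ 1#
      roots (here refl) = yʰ≡1
      roots (there x∈) with ∈-map⁻ _ x∈
      ... | j , j∈ , refl = trans (*^ _ _ h) (trans (sym (^-+ (ι (suc j)) h h)) (trans (cong (ι (suc j) ^_) h+h≡q)
              (fermat _ (ι-small (suc j) (s≤s z≤n) (ℕₚ.≤-trans (∈-upTo⁻ j∈) h≤q)))))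

    torsion : ℕ → List F
    torsion L = filter (λ x → (x ^ L) ≟ 1#) units

    private
      geometric : ℕ → ℕ → Poly
      geometric L k = Σₚ k (λ j → X ⊛^ (j ℕ.* L))

      eval-geometric : ∀ L k x → (x ^ L + - 1#) * eval (geometric L k) x ≡ x ^ (k ℕ.* L) + - 1#
      eval-geometric L zero x = trans (zeroʳ _) (sym (-‿inverseʳ 1#))
      eval-geometric L (suc k) x = begin
        (x ^ L + - 1#) * eval (geometric L (suc k)) x
          ≡⟨ cong ((x ^ L + - 1#) *_) (trans (eval-⊕ (C 1#) _ x) (cong₂ _+_ (eval-C 1# x) shifted)) ⟩
        (x ^ L + - 1#) * (1# + x ^ L * eval (geometric L k) x)
          ≡⟨ solveᶠ 3 (λ y o g → (y +ᶠ (-ᶠ o)) *ᶠ (o +ᶠ y *ᶠ g) ≔ᶠ (y +ᶠ (-ᶠ o)) *ᶠ o +ᶠ y *ᶠ ((y +ᶠ (-ᶠ o)) *ᶠ g)) refl (x ^ L) 1# (eval (geometric L k) x) ⟩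
        (x ^ L + - 1#) * 1# + x ^ L * ((x ^ L + - 1#) * eval (geometric L k) x)
          ≡⟨ cong₂ _+_ (*-identityʳ _) (cong (x ^ L *_) (eval-geometric L k x)) ⟩
        (x ^ L + - 1#) + x ^ L * (x ^ (k ℕ.* L) + - 1#)
          ≡⟨ solveᶠ 3 (λ y o z → (y +ᶠ (-ᶠ o)) +ᶠ y *ᶠ (z +ᶠ (-ᶠ o)) ≔ᶠ (y *ᶠ z +ᶠ (-ᶠ o)) +ᶠ (y +ᶠ (-ᶠ (y *ᶠ o)))) refl (x ^ L) 1# (x ^ (k ℕ.* L)) ⟩
        (x ^ L * x ^ (k ℕ.* L) + - 1#) + (x ^ L + - (x ^ L * 1#))
          ≡⟨ cong₂ _+_ (cong (_+ - 1#) (sym (^-+ x L (k ℕ.* L)))) (trans (cong (λ z → x ^ L + - z) (*-identityʳ _)) (-‿inverseʳ _)) ⟩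
        (x ^ (suc k ℕ.* L) + - 1#) + 0#
          ≡⟨ +-identityʳ _ ⟩
        x ^ (suc k ℕ.* L) + - 1# ∎
        where
        open ≡-Reasoning
        shifted : eval (Σₚ k (λ j → X ⊛^ (suc j ℕ.* L))) x ≡ x ^ L * eval (geometric L k) x
        shifted = trans (eval-cong x (≈-trans (Σₚ-cong k (λ j → ⊛^-+ X L (j ℕ.* L))) (Σₚ-⊛ k (X ⊛^ L) (λ j → X ⊛^ (j ℕ.* L)))))
                    (trans (eval-⊛ (X ⊛^ L) (geometric L k) x) (cong (_* eval (geometric L k) x) (eval-X^ x L)))

      Deg<-geometric : ∀ L k → Deg< (suc (k ℕ.* L)) (geometric L (suc k))
      Deg<-geometric L k = Deg<-Σₚ (suc k) (λ j → X ⊛^ (j ℕ.* L))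
        (λ j j<k → Deg<-mono (X ⊛^ (j ℕ.* L)) (s≤s (ℕₚ.*-monoˡ-≤ L (ℕ.s≤s⁻¹ j<k))) (Deg<-X^ (j ℕ.* L)))

      geometric≉[] : ∀ L k → 1 ≤ L → ¬ geometric L (suc k) ≈ []
      geometric≉[] L k 1≤L e = 1≢0 (trans (sym (+-identityʳ 1#)) (trans (cong (1# +_) (sym (tail k (λ j → j ℕ.* L)))) (trans (sym (coeff-⊕ (C 1#) _ 0)) (e .at 0))))
        where
        low : ∀ m → 1 ≤ m → coeff (X ⊛^ m) 0 ≡ 0#
        low m 1≤m = coeff-X^-low m 0 1≤m
        tail : ∀ k (g : ℕ → ℕ) → coeff (Σₚ k (λ j → X ⊛^ (L ℕ.+ g j))) 0 ≡ 0#
        tail zero g = refl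
        tail (suc k) g = trans (coeff-⊕ (X ⊛^ (L ℕ.+ g 0)) _ 0) (trans (cong₂ _+_ (low (L ℕ.+ g 0) (ℕₚ.≤-trans 1≤L (ℕₚ.m≤m+n L _))) (tail k (λ j → g (suc j)))) (+-identityʳ 0#))

    -- X^q - 1 is (X^L - 1) times a geometric sum of degree q - L. All q units are roots of the
    -- product and at most q - L of them are roots of the sum, so at least L satisfy x^L = 1.
    length-torsion : ∀ L → 1 ≤ L → L ∣ q → length (torsion L) ≡ L
    length-torsion L 1≤L (divides zero q≡0) = contradiction (subst (1 ≤_) q≡0 1≤q) λ ()
    length-torsion L 1≤L (divides (suc k) q≡) = ℕₚ.≤-antisym upper lower
      where
      U = units
      torsion? : ∀ x → Dec (x ^ L ≡ 1#)
      torsion? x = (x ^ L) ≟ 1#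
      upper : length (torsion L) ≤ L
      upper = roots-of-unity≤ L (torsion L) 1≤L (filter⁺ torsion? unique-units) (λ x∈ → proj₂ (∈-filter⁻ torsion? {xs = U} x∈))
      rest : List F
      rest = filter (λ x → ¬? (torsion? x)) U
      rest≤ : length rest ≤ k ℕ.* L
      rest≤ = roots≤degree (geometric L (suc k)) (k ℕ.* L) rest (geometric≉[] L k 1≤L) (Deg<-geometric L k)
        (filter⁺ (λ x → ¬? (torsion? x)) unique-units)
        (λ {x} x∈ → let (x∈U , xᴸ≢1) = ∈-filter⁻ (λ x → ¬? (torsion? x)) {xs = U} x∈ in
          integral (trans (eval-geometric L (suc k) x) (trans (cong (λ z → x ^ z + - 1#) (sym q≡))
            (trans (cong (_+ - 1#) (fermat x (units-nonzero x∈U))) (-‿inverseʳ 1#)))) (λ e → xᴸ≢1 (⊖≡0 e)))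
      split : ∀ xs → length (filter torsion? xs) ℕ.+ length (filter (λ x → ¬? (torsion? x)) xs) ≡ length xs
      split [] = refl
      split (x ∷ xs) with torsion? x
      ... | yes _ = cong suc (split xs)
      ... | no _ = trans (ℕₚ.+-suc _ _) (cong suc (split xs))
      lower : L ≤ length (torsion L)
      lower = ℕₚ.+-cancelʳ-≤ (k ℕ.* L) L (length (torsion L))
        (ℕₚ.≤-trans (ℕₚ.≤-reflexive (trans (sym q≡) (trans (sym length-units) (sym (split U))))) (ℕₚ.+-monoʳ-≤ (length (torsion L)) rest≤))

    -- If T contains every prime divisor of L, this says that x has order L.
    Prim : List ℕ → ℕ → F → Set
    Prim T L x = x ^ L ≡ 1# × All (λ l → x ^ quot L l ≢ 1#) T

    prim? : ∀ T L x → Dec (Prim T L x)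
    prim? T L x = ((x ^ L) ≟ 1#) ×-dec All.all? (λ l → ¬? ((x ^ quot L l) ≟ 1#)) T

    prims : List ℕ → ℕ → List F
    prims T L = filter (prim? T L) units

    private
      -- For k in T put t = M/k, so that L/k = l t. Then x^(l t) = 1 and x^(k t) = x^M = 1 force x^t
      -- = 1, since k and l are coprime; the converse directions only take powers.
      prim-restrict : ∀ c l T → 1 ≤ l → PairwiseCoprime T → All (Coprime l) T → ∀ x →
        let L = c ℕ.* (l ℕ.* product T) in let M = c ℕ.* product T in
        (Prim T L x × x ^ quot L l ≡ 1# → Prim T M x) × (Prim T M x → Prim T L x × x ^ quot L l ≡ 1#)
      prim-restrict c l T 1≤l pc cop x = to , from
        where
        L = c ℕ.* (l ℕ.* product T)
        M = c ℕ.* product T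
        L≡M*l : L ≡ M ℕ.* l
        L≡M*l = +-*-Solver.solve 3 (λ c l t → c :* (l :* t) := c :* t :* l) refl c l (product T)
          where open +-*-Solver
        quotL : quot L l ≡ M
        quotL = trans (cong (λ z → quot z l) L≡M*l) (quot-* M l 1≤l)
        cofactor : ∀ {k} → k ∈ T → ∃[ t ] (quot L k ≡ l ℕ.* t × quot M k ≡ t × M ≡ k ℕ.* t)
        cofactor {k} k∈ with ∈⇒∣product k∈
        ... | divides d ΠT≡ = c ℕ.* d ,
          trans (cong (λ z → quot z k) (trans (cong (λ z → c ℕ.* (l ℕ.* z)) ΠT≡) (solve 4 (λ c l d k → c :* (l :* (d :* k)) := l :* (c :* d) :* k) refl c l d k))) (quot-* (l ℕ.* (c ℕ.* d)) k (positive pc k∈)) ,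
          trans (cong (λ z → quot z k) (trans (cong (c ℕ.*_) ΠT≡) (sym (ℕₚ.*-assoc c d k)))) (quot-* (c ℕ.* d) k (positive pc k∈)) ,
          trans (cong (c ℕ.*_) ΠT≡) (solve 3 (λ c d k → c :* (d :* k) := k :* (c :* d)) refl c d k)
          where open +-*-Solver
        to : Prim T L x × x ^ quot L l ≡ 1# → Prim T M x
        to ((_ , ns) , xᴹ) = trans (cong (x ^_) (sym quotL)) xᴹ , All.tabulate (λ {k} k∈ e →
          let (t , Lk , Mk , _) = cofactor k∈ in All.lookup ns k∈ (trans (cong (x ^_) Lk) (^≡1-* x l (trans (cong (x ^_) (sym Mk)) e))))
        from : Prim T M x → Prim T L x × x ^ quot L l ≡ 1#
        from (xᴹ , ns) = (trans (cong (x ^_) (trans L≡M*l (ℕₚ.*-comm M l))) (^≡1-* x l xᴹ) , All.tabulate (λ {k} k∈ e →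
          let (t , Lk , Mk , M≡) = cofactor k∈ in
          All.lookup ns k∈ (trans (cong (x ^_) Mk) (coprime-power k t (All.lookup cop k∈) (trans (cong (x ^_) (sym Lk)) e) (trans (cong (x ^_) (sym M≡)) xᴹ)))))
          , trans (cong (x ^_) quotL) xᴹ
          where
          coprime-power : ∀ k t → Coprime l k → x ^ (l ℕ.* t) ≡ 1# → x ^ (k ℕ.* t) ≡ 1# → x ^ t ≡ 1#
          coprime-power k t cp a b = trans (sym (*-identityʳ (x ^ t)))
            (^≡1-bezout (x ^ t) (coprime-Bézout cp) (trans (sym (^-* x l t)) a) (trans (sym (^-* x k t)) b))

    -- Move l into the cofactor: with T alone, level L has c l ∏ (k - 1) elements. Those among them
    -- with x^(L/l) = 1 are the elements of level L/l, which number c ∏ (k - 1), and the difference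
    -- is the count for `l ∷ T`.
    length-prims : ∀ T c → PairwiseCoprime T → 1 ≤ c → c ℕ.* product T ∣ q → length (prims T (c ℕ.* product T)) ≡ c ℕ.* pred-product T
    length-prims [] c [] 1≤c c∣q = trans (cong length (filter-≐ (prim? [] L) (λ x → (x ^ L) ≟ 1#) (proj₁ , λ e → e , []) units))
        (length-torsion L (subst (1 ≤_) (sym (ℕₚ.*-identityʳ c)) 1≤c) c∣q)
      where L = c ℕ.* 1
    length-prims (l ∷ T) c ((1≤l , cop) ∷ pc) 1≤c L∣q = ℕₚ.+-cancelˡ-≡ (c ℕ.* pred-product T) _ _ (begin
      c ℕ.* pred-product T ℕ.+ length (prims (l ∷ T) L)
        ≡⟨ cong₂ ℕ._+_ (trans (cong length (filter-≐ (λ x → prim? T L x ×-dec ((x ^ quot L l) ≟ 1#)) (prim? T M) ((λ {x} → proj₁ (prim-restrict c l T 1≤l pc cop x)) , λ {x} → proj₂ (prim-restrict c l T 1≤l pc cop x)) units))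
                              (length-prims T c pc 1≤c M∣q))
                       (cong length (filter-≐ (λ x → prim? T L x ×-dec ¬? ((x ^ quot L l) ≟ 1#)) (prim? (l ∷ T) L) ((λ { ((a , b) , e) → a , e ∷ b }) , λ { (a , e ∷ b) → (a , b) , e }) units)) ⟨
      length (filter (λ x → prim? T L x ×-dec ((x ^ quot L l) ≟ 1#)) units) ℕ.+ length (filter (λ x → prim? T L x ×-dec ¬? ((x ^ quot L l) ≟ 1#)) units)
        ≡⟨ length-filter-split (prim? T L) (λ x → (x ^ quot L l) ≟ 1#) units ⟨
      length (prims T L)
        ≡⟨ cong (λ z → length (prims T z)) L≡ ⟩
      length (prims T (c ℕ.* l ℕ.* product T))
        ≡⟨ length-prims T (c ℕ.* l) pc (ℕₚ.*-mono-≤ 1≤c 1≤l) (subst (_∣ q) L≡ L∣q) ⟩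
      c ℕ.* l ℕ.* pred-product T
        ≡⟨ cong (λ z → c ℕ.* z ℕ.* pred-product T) (sym (ℕₚ.m+[n∸m]≡n 1≤l)) ⟩
      c ℕ.* suc (l ∸ 1) ℕ.* pred-product T
        ≡⟨ solve 3 (λ c k t → c :* (con 1 :+ k) :* t := c :* t :+ c :* (k :* t)) refl c (l ∸ 1) (pred-product T) ⟩
      c ℕ.* pred-product T ℕ.+ c ℕ.* pred-product (l ∷ T) ∎)
      where
      open ≡-Reasoning
      open +-*-Solver
      L = c ℕ.* product (l ∷ T)
      M = c ℕ.* product T
      L≡ : L ≡ c ℕ.* l ℕ.* product T
      L≡ = sym (ℕₚ.*-assoc c l (product T))
      M∣q : M ∣ q
      M∣q = ∣-trans (divides l (solve 3 (λ c l t → c :* (l :* t) := l :* (c :* t)) refl c l (product T))) L∣q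
        where open import Data.Nat.Divisibility using (∣-trans)

    prime-divisor : ∀ n → 2 ≤ n → ∃[ l ] (Prime l × l ∣ n)
    prime-divisor n 2≤n = pick (factorise n ⦃ ℕ.>-nonZero (ℕₚ.≤-trans (s≤s z≤n) 2≤n) ⦄)
      where
      pick : PrimeFactorisation n → ∃[ l ] (Prime l × l ∣ n)
      pick record { factors = [] ; isFactorisation = n≡1 } = contradiction (subst (2 ≤_) n≡1 2≤n) λ { (s≤s ()) }
      pick record { factors = l ∷ ls ; isFactorisation = n≡ ; factorsPrime = pl ∷ _ } =
        l , pl , divides (product ls) (trans n≡ (ℕₚ.*-comm l (product ls)))

    module _ {T} (complete : ∀ {l} → Prime l → l ∣ q → l ∈ T) {x} (x≢0 : x ≢ 0#) (isPrim : Prim T q x) where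

      -- With g = gcd(d, q) Bézout gives x^g = 1. Since g < q, some prime l divides q/g, and then
      -- x^(q/l) = 1, which `Prim` forbids.
      no-small-order : ∀ d → 1 ≤ d → d < q → x ^ d ≢ 1#
      no-small-order d 1≤d d<q xᵈ≡1 with gcd[m,n]∣n d q
      ... | divides k q≡ = large k q≡
        where
        g = gcd d q
        xᵍ≡1 : x ^ g ≡ 1#
        xᵍ≡1 = ^≡1-bezout x (Bézout.identity (gcd-GCD d q)) xᵈ≡1 (proj₁ isPrim)
        g≤d : g ≤ d
        g≤d = ∣⇒≤ ⦃ ℕ.>-nonZero 1≤d ⦄ (gcd[m,n]∣m d q)
          where open import Data.Nat.Divisibility using (∣⇒≤)
        large : ∀ k → q ≡ k ℕ.* g → ⊥
        large zero q≡0 = contradiction (subst (1 ≤_) q≡0 1≤q) λ ()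
        large (suc zero) q≡ = ℕₚ.<-irrefl (sym (trans q≡ (ℕₚ.*-identityˡ g))) (ℕₚ.≤-<-trans g≤d d<q)
        large k@(suc (suc _)) q≡ with prime-divisor k (s≤s (s≤s z≤n))
        ... | l , pl , divides j k≡ = All.lookup (proj₂ isPrim) (complete pl (divides (j ℕ.* g) q≡′))
                (trans (cong (x ^_) (trans (cong (λ z → quot z l) q≡′) (quot-* (j ℕ.* g) l (ℕ.>-nonZero⁻¹ l ⦃ prime⇒nonZero pl ⦄)))) (^≡1-* x j xᵍ≡1))
          where
          q≡′ : q ≡ j ℕ.* g ℕ.* l
          q≡′ = trans q≡ (trans (cong (ℕ._* g) k≡) (solve 3 (λ j l g → j :* l :* g := j :* g :* l) refl j l g))
            where open +-*-Solver

      private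
        powers : List F
        powers = map (x ^_) (upTo q)

        ordered : ∀ i d → i ℕ.+ d < q → x ^ i ≡ x ^ (i ℕ.+ d) → d ≡ 0
        ordered i zero _ _ = refl
        ordered i (suc d) lt eq = contradiction (⊖≡0 (integral (begin
          x ^ i * (x ^ suc d + - 1#)            ≡⟨ solveᶠ 3 (λ a b o → a *ᶠ (b +ᶠ (-ᶠ o)) ≔ᶠ a *ᶠ b +ᶠ (-ᶠ (a *ᶠ o))) refl (x ^ i) (x ^ suc d) 1# ⟩
          x ^ i * x ^ suc d + - (x ^ i * 1#)    ≡⟨ cong₂ (λ a b → a + - b) (sym (^-+ x i (suc d))) (*-identityʳ _) ⟩
          x ^ (i ℕ.+ suc d) + - x ^ i           ≡⟨ cong (λ z → z + - x ^ i) (sym eq) ⟩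
          x ^ i + - x ^ i                       ≡⟨ -‿inverseʳ _ ⟩
          0#                                    ∎) (^-nonzero i x≢0)))
          (no-small-order (suc d) (s≤s z≤n) (ℕₚ.≤-<-trans (ℕₚ.m≤n+m (suc d) i) lt))
          where open ≡-Reasoning

        injective : ∀ i j → i < q → j < q → x ^ i ≡ x ^ j → i ≡ j
        injective i j i<q j<q eq with ℕₚ.≤-total i j
        ... | inj₁ i≤j = ℕₚ.≤-antisym i≤j (ℕₚ.m∸n≡0⇒m≤n (ordered i (j ∸ i) (subst (_< q) (sym j≡) j<q) (trans eq (cong (x ^_) (sym j≡)))))
          where j≡ = ℕₚ.m+[n∸m]≡n i≤j
        ... | inj₂ j≤i = ℕₚ.≤-antisym (ℕₚ.m∸n≡0⇒m≤n (ordered j (i ∸ j) (subst (_< q) (sym i≡) i<q) (trans (sym eq) (cong (x ^_) (sym i≡))))) j≤i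
          where i≡ = ℕₚ.m+[n∸m]≡n j≤i

      -- The powers x^0, ..., x^(q-1) are q distinct roots of Z^q - 1 and leave no room for another
      -- unit.
      generates : ∀ y → y ≢ 0# → ∃[ k ] x ^ k ≡ y
      generates y y≢0 with y ∈? powers
      ... | yes y∈ = let (k , _ , y≡) = ∈-map⁻ _ y∈ in k , sym y≡
      ... | no y∉ = contradiction (roots-of-unity≤ q (y ∷ powers) 1≤q
              (Allₚ.¬Any⇒All¬ powers y∉ ∷ Unique-map _ (upTo q) (λ i∈ j∈ → injective _ _ (∈-upTo⁻ i∈) (∈-upTo⁻ j∈)) (upTo⁺ q)) roots)
              (ℕₚ.<⇒≱ (s≤s (ℕₚ.≤-reflexive (sym (trans (length-map _ (upTo q)) (length-upTo q))))))
        where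
        roots : ∀ {z} → z ∈ y ∷ powers → z ^ q ≡ 1#
        roots (here refl) = fermat y y≢0
        roots (there z∈) with ∈-map⁻ _ z∈
        ... | k , _ , refl = fermat (x ^ k) (^-nonzero k x≢0)

-- A square value at a primitive root, given suitable numerical parameters.

module SquareValues (𝕂 : DecidableField) where

  open Polynomials 𝕂
  open Divisibility 𝕂
  open StepanovBound 𝕂
  open Conditions
  open Lists
  open PrimeCharacteristic 𝕂
  open Stepanov 𝕂 using (^-*)
  open import Data.List.Base as List using (List; []; _∷_; _++_; length; take; drop)
  open import Data.List.Membership.Propositional using (_∈_; find)
  open import Data.List.Membership.Propositional.Properties using (∈-filter⁺; ∈-filter⁻; ∈-++⁺ʳ)
  open import Data.List.Properties using (take++drop≡id; length-take; length-drop)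
  open import Data.List.Relation.Unary.All as All using (All; []; _∷_)
  import Data.List.Relation.Unary.All.Properties as Allₚ
  open import Data.List.Relation.Unary.Any as Any using (Any)
  open import Data.List.Relation.Unary.Unique.Propositional using (Unique)
  open import Data.List.Relation.Unary.Unique.Propositional.Properties using (filter⁺)
  open import Data.Nat.Base as ℕ using (ℕ; suc; _<_; _≤_; _∸_; z≤n; s≤s)
  open import Data.Nat.Divisibility using (divides)
  open import Data.Nat.ListAction using (product)
  open import Data.Nat.ListAction.Properties using (product-++)
  import Data.Nat.Properties as ℕₚ
  open import Data.Nat.Solver using (module +-*-Solver)
  open import Data.Sum.Base using (inj₁; inj₂)
  open import Relation.Nullary.Decidable using (¬?; decidable-stable)

  module _ (q : ℕ) (1≤q : 1 ≤ q) (ι-char : ι (suc q) ≡ 0#) (ι-small : ∀ j → 1 ≤ j → j ≤ q → ι j ≢ 0#)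
           (ι-onto : ∀ x → ∃[ j ] (j ≤ q × x ≡ ι j)) where

    open Cyclic q 1≤q ι-char ι-small ι-onto

    PairwiseCoprime-++ʳ : ∀ O {S} → PairwiseCoprime (O ++ S) → PairwiseCoprime S
    PairwiseCoprime-++ʳ [] pc = pc
    PairwiseCoprime-++ʳ (o ∷ O) (_ ∷ pc) = PairwiseCoprime-++ʳ O pc

    -- For l in S the exponent q/l equals (m/l) n, so x^(q/l) ≠ 1 is a statement about x^n.
    prims-power : ∀ O S m n → PairwiseCoprime (O ++ S) → m ≡ product S → m ℕ.* n ≡ q → 1 ≤ m →
                  ∀ {x} → x ∈ prims (O ++ S) q → x ^ n ∈ prims S m
    prims-power O S m n pc m≡ mn≡q 1≤m {x} x∈ = ∈-filter⁺ (prim? S m) (∈-units (x ^ n) (^-nonzero n x≢0)) (isUnity , notSmaller)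
      where
      x∈units×prim = ∈-filter⁻ (prim? (O ++ S) q) {xs = units} x∈
      x≢0 = units-nonzero (proj₁ x∈units×prim)
      isPrim = proj₂ x∈units×prim
      isUnity : (x ^ n) ^ m ≡ 1#
      isUnity = trans (sym (^-* x m n)) (trans (cong (x ^_) mn≡q) (proj₁ isPrim))
      notSmaller : All (λ l → (x ^ n) ^ quot m l ≢ 1#) S
      notSmaller = All.tabulate λ {l} l∈ e → All.lookup (proj₂ isPrim) (∈-++⁺ʳ O l∈)
          (trans (cong (x ^_) (quot≡ l∈)) (trans (^-* x (quot m l) n) e))
        where
        quot≡ : ∀ {l} → l ∈ S → quot q l ≡ quot m l ℕ.* n
        quot≡ {l} l∈ with ∈⇒∣product l∈
        ... | divides d ΠS≡ = trans (cong (λ z → quot z l) q≡) (trans (quot-* (d ℕ.* n) l 1≤l)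
                (cong (ℕ._* n) (sym (trans (cong (λ z → quot z l) (trans m≡ ΠS≡)) (quot-* d l 1≤l)))))
          where
          open +-*-Solver
          1≤l = positive (PairwiseCoprime-++ʳ O pc) l∈
          q≡ : q ≡ d ℕ.* n ℕ.* l
          q≡ = trans (sym mn≡q) (trans (cong (ℕ._* n) (trans m≡ ΠS≡)) (solve 3 (λ d l n → d :* l :* n := d :* n :* l) refl d l n))

    -- If f(x)^half = -1 at every primitive root, all of them are points for `Bound`, whose
    -- inequalities contradict each other. At any other primitive root f(x) is zero, or its
    -- half-power is 1 and Euler's criterion yields a root.
    square-value : ∀ O S c half (f : Poly) →
      PairwiseCoprime (O ++ S) → c ℕ.* product (O ++ S) ≡ q → half ℕ.+ half ≡ q → 1 ≤ half →
      Deg< 5 f → coeff f 0 ≢ 0# → (∀ a g → a ≢ 0# → ¬ C a ⊛ f ≈ g ⊛ g) →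
      ∀ l′ B′ H r → let m = product S; n = c ℕ.* product O; N = c ℕ.* pred-product (O ++ S) in
      (4 ℕ.+ l′) ℕ.+ (4 ℕ.+ l′) ≤ suc n → H ℕ.* 2 ℕ.+ 1 ≤ q → r ≤ N →
      pred-product S ℕ.* rows l′ H ℕ.+ r < suc (B′ ℕ.+ (m ℕ.+ m)) ℕ.* (4 ℕ.+ l′) ℕ.+ suc B′ ℕ.* l′ →
      (4 ℕ.+ l′) ℕ.+ (B′ ℕ.+ (m ℕ.+ m)) ℕ.* n ≤ N ℕ.* (H ℕ.* 2) ℕ.+ r →
      ∃[ x ] (x ≢ 0# × Prim (O ++ S) q x × ∃[ z ] z * z ≡ eval f x)
    square-value O S c half f pc c*ΠT≡q half+half≡q 1≤half hf f₀≢0 nonsquare l′ B′ H r small H≤ r≤N enough many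
      with Any.any? (λ x → ¬? ((eval f x ^ half) ≟ (- 1#))) (prims (O ++ S) q)
    ... | yes some = found (find some)
      where
      found : ∃[ x ] (x ∈ prims (O ++ S) q × eval f x ^ half ≢ - 1#) → ∃[ x ] (x ≢ 0# × Prim (O ++ S) q x × ∃[ z ] z * z ≡ eval f x)
      found (x , x∈ , fxʰ≢-1) = x , units-nonzero (proj₁ x∈′) , proj₂ x∈′ , root
        where
        x∈′ = ∈-filter⁻ (prim? (O ++ S) q) {xs = units} x∈
        root : ∃[ z ] z * z ≡ eval f x
        root with eval f x ≟ 0#
        ... | yes fx≡0 = 0# , trans (zeroˡ 0#) (sym fx≡0)
        ... | no fx≢0 with square≡1 (trans (sym (^-+ (eval f x) half half)) (trans (cong (eval f x ^_) half+half≡q) (fermat (eval f x) fx≢0)))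
        ...   | inj₁ ≡1 = euler half half+half≡q 1≤half (eval f x) ≡1
        ...   | inj₂ ≡-1 = contradiction ≡-1 fxʰ≢-1
    ... | no none = contradiction (bound enough′ many′) λ ()
      where
      left-factor : ∀ a b → 1 ≤ a ℕ.* b → 1 ≤ a
      left-factor (suc a) b _ = s≤s z≤n
      T = O ++ S
      m = product S
      n = c ℕ.* product O
      N = c ℕ.* pred-product T
      e = suc half
      all-nonsquare : ∀ {x} → x ∈ prims T q → eval f x ^ half ≡ - 1#
      all-nonsquare x∈ = decidable-stable (_ ≟ _) (All.lookup (Allₚ.¬Any⇒All¬ _ none) x∈)
      mn≡q : m ℕ.* n ≡ q
      mn≡q = trans (solve 3 (λ m c o → m :* (c :* o) := c :* (o :* m)) refl m c (product O)) (trans (cong (c ℕ.*_) (sym (product-++ O S))) c*ΠT≡q)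
        where open +-*-Solver
      1≤m : 1 ≤ m
      1≤m = left-factor m n (subst (1 ≤_) (sym mn≡q) 1≤q)
      1≤c : 1 ≤ c
      1≤c = left-factor c (product T) (subst (1 ≤_) (sym c*ΠT≡q) 1≤q)
      n≤q : n ≤ q
      n≤q = subst (n ≤_) mn≡q (subst (ℕ._≤ m ℕ.* n) (ℕₚ.*-identityˡ n) (ℕₚ.*-monoˡ-≤ n 1≤m))
      Xs = prims T q
      K = prims S m
      Y = take r Xs
      Z = drop r Xs
      Y++Z≡ : Y ++ Z ≡ Xs
      Y++Z≡ = take++drop≡id r Xs
      |Xs| : length Xs ≡ N
      |Xs| = trans (cong (λ z → length (prims T z)) (sym c*ΠT≡q)) (length-prims T c pc 1≤c (divides 1 (trans (sym c*ΠT≡q) (sym (ℕₚ.*-identityˡ _)))))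
      |K| : length K ≡ pred-product S
      |K| = trans (cong (λ z → length (prims S z)) (sym (ℕₚ.*-identityˡ m)))
              (trans (length-prims S 1 (PairwiseCoprime-++ʳ O pc) ℕₚ.≤-refl (divides n (trans (sym mn≡q) (trans (ℕₚ.*-comm m n) (cong (n ℕ.*_) (sym (ℕₚ.*-identityˡ m)))))))
                     (ℕₚ.*-identityˡ _))
      |Y| : length Y ≡ r
      |Y| = trans (length-take r Xs) (ℕₚ.m≤n⇒m⊓n≡m (subst (r ≤_) (sym |Xs|) r≤N))
      |Z| : length Z ≡ N ∸ r
      |Z| = trans (length-drop r Xs) (cong (_∸ r) |Xs|)
      f≉0 : ¬ f ≈ []
      f≉0 p = f₀≢0 (p .at 0)
      -- Since 2 e = p + 1, f^(2e) = f f^p, and below degree p only the constant term f(0)^p of f^p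
      -- survives. It is nonzero because f(0) is.
      low = p-th-power-low f n f≉0 (ℕₚ.m≤n⇒m≤1+n n≤q)
      f²ᵉ≈ : f ⊛^ e ⊛ f ⊛^ e ≈ f ⊛ (C (coeff f 0 ^ suc q) ⊕ X ⊛^ n ⊛ proj₁ low)
      f²ᵉ≈ = ≈-trans (≈-sym (⊛^-+ f e e)) (≈-trans (P.reflexive (cong (f ⊛^_) (cong suc (trans (ℕₚ.+-suc half half) (cong suc half+half≡q)))))
               (⊛-cong ≈-refl (proj₂ low)))
      e≡ : e ℕ.* 4 ≡ 4 ℕ.+ (m ℕ.+ m) ℕ.* n
      e≡ = cong (4 ℕ.+_) (trans (solve 1 (λ h → h :* con 4 := (h :+ h) :+ (h :+ h)) refl half)
             (trans (cong₂ ℕ._+_ (trans half+half≡q (sym mn≡q)) (trans half+half≡q (sym mn≡q))) (sym (ℕₚ.*-distribʳ-+ n m m))))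
        where open +-*-Solver
      good : ∀ {x} → x ∈ Y ++ Z → x ≢ 0# × eval f x ≢ 0# × eval f x ^ e ≡ - eval f x × x ^ n ∈ K
      good {x} x∈YZ = units-nonzero (proj₁ (∈-filter⁻ (prim? T q) {xs = units} x∈)) , fx≢0 ,
          trans (cong (eval f x *_) (all-nonsquare x∈)) (trans (solveᶠ 2 (λ a o → a *ᶠ (-ᶠ o) ≔ᶠ -ᶠ (a *ᶠ o)) refl (eval f x) 1#) (cong -_ (*-identityʳ _))) ,
          prims-power O S m n pc refl mn≡q 1≤m x∈
        where
        x∈ : x ∈ Xs
        x∈ = subst (x ∈_) Y++Z≡ x∈YZ
        fx≢0 : eval f x ≢ 0#
        fx≢0 fx≡0 = -1≢0 (trans (sym (all-nonsquare x∈)) (trans (cong (_^ half) fx≡0) (0^ half 1≤half)))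
          where
          0^ : ∀ k → 1 ≤ k → 0# ^ k ≡ 0#
          0^ (suc k) _ = zeroˡ _
      open Bound f n e hf nonsquare (coeff f 0 ^ suc q) (^-nonzero (suc q) f₀≢0) (proj₁ low) f²ᵉ≈ l′ m B′ H small e≡
        (λ j 1≤j j≤ → ι-small j 1≤j (ℕₚ.≤-trans j≤ H≤)) K Y Z
        (subst Unique (sym Y++Z≡) (filter⁺ (prim? T q) unique-units)) good
      enough′ : length K ℕ.* rows l′ H ℕ.+ length Y < suc (B′ ℕ.+ (m ℕ.+ m)) ℕ.* (4 ℕ.+ l′) ℕ.+ suc B′ ℕ.* l′
      enough′ = subst₂ (λ k y → k ℕ.* rows l′ H ℕ.+ y < suc (B′ ℕ.+ (m ℕ.+ m)) ℕ.* (4 ℕ.+ l′) ℕ.+ suc B′ ℕ.* l′) (sym |K|) (sym |Y|) enough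
      many′ : (4 ℕ.+ l′) ℕ.+ (B′ ℕ.+ (m ℕ.+ m)) ℕ.* n ≤ length Y ℕ.* (H ℕ.* 2 ℕ.+ 1) ℕ.+ length Z ℕ.* (H ℕ.* 2 ℕ.+ 0)
      many′ = subst ((4 ℕ.+ l′) ℕ.+ (B′ ℕ.+ (m ℕ.+ m)) ℕ.* n ≤_) (begin
        N ℕ.* (H ℕ.* 2) ℕ.+ r                                     ≡⟨ cong (λ z → z ℕ.* (H ℕ.* 2) ℕ.+ r) (sym (ℕₚ.m+[n∸m]≡n r≤N)) ⟩
        (r ℕ.+ (N ∸ r)) ℕ.* (H ℕ.* 2) ℕ.+ r                       ≡⟨ solve 3 (λ r s h → (r :+ s) :* h :+ r := r :* (h :+ con 1) :+ s :* (h :+ con 0)) refl r (N ∸ r) (H ℕ.* 2) ⟩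
        r ℕ.* (H ℕ.* 2 ℕ.+ 1) ℕ.+ (N ∸ r) ℕ.* (H ℕ.* 2 ℕ.+ 0)     ≡⟨ cong₂ (λ a b → a ℕ.* (H ℕ.* 2 ℕ.+ 1) ℕ.+ b ℕ.* (H ℕ.* 2 ℕ.+ 0)) (sym |Y|) (sym |Z|) ⟩
        length Y ℕ.* (H ℕ.* 2 ℕ.+ 1) ℕ.+ length Z ℕ.* (H ℕ.* 2 ℕ.+ 0) ∎) many
        where
        open ≡-Reasoning
        open +-*-Solver

-- Inequalities for the parameters, and the case of two large primes.

module Parameters where

  open Conditions
  open Lists
  open import Data.List.Base using (List; []; _∷_; _++_; map)
  open import Data.List.Relation.Unary.All as All using (All; []; _∷_)
  open import Data.List.Relation.Unary.AllPairs using (AllPairs; []; _∷_)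
  open import Data.Nat.Base
  open import Data.Nat.DivMod using (_/_; _%_; m≡m%n+[m/n]*n; m%n<n; m/n*n≤m)
  open import Data.Nat.ListAction using (product)
  open import Data.Nat.Properties
  open import Data.Nat.Solver using (module +-*-Solver)

  -- Numerical parameters for the auxiliary polynomial attached to the factorisation m n of c ∏ (O ++ S)
  -- with m = ∏ S and n = c ∏ O.
  record Admissible (O S : List ℕ) (c : ℕ) : Set where
    field
      l′ B′ H r : ℕ
      small  : (4 + l′) + (4 + l′) ≤ suc (c * product O)
      levels : H * 2 + 1 ≤ c * product (O ++ S)
      r≤N    : r ≤ c * pred-product (O ++ S)
      enough : pred-product S * rows l′ H + r < suc (B′ + (product S + product S)) * (4 + l′) + suc B′ * l′
      many   : (4 + l′) + (B′ + (product S + product S)) * (c * product O) ≤ c * pred-product (O ++ S) * (H * 2) + r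

  -- Level i contributes 2 (4 i + l), with sum 2 h l + 4 h (h - 1); the term 4 h stands on the left
  -- to avoid subtraction.
  rows-closed : ∀ l′ h → rows l′ h + 4 * h ≡ 2 * h * (4 + l′) + 4 * (h * h)
  rows-closed l′ zero = refl
  rows-closed l′ (suc h) = begin
    (w + (w + rows l′ h)) + 4 * suc h              ≡⟨ solve 3 (λ w r h → (w :+ (w :+ r)) :+ con 4 :* (con 1 :+ h) := (r :+ con 4 :* h) :+ (con 2 :* w :+ con 4)) refl w (rows l′ h) h ⟩
    (rows l′ h + 4 * h) + (2 * w + 4)              ≡⟨ cong (_+ (2 * w + 4)) (rows-closed l′ h) ⟩
    (2 * h * (4 + l′) + 4 * (h * h)) + (2 * w + 4) ≡⟨ solve 2 (λ h l → (con 2 :* h :* (con 4 :+ l) :+ con 4 :* (h :* h)) :+ (con 2 :* (h :* con 4 :+ (con 4 :+ l)) :+ con 4)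
                                                        := con 2 :* (con 1 :+ h) :* (con 4 :+ l) :+ con 4 :* ((con 1 :+ h) :* (con 1 :+ h))) refl h l′ ⟩
    2 * suc h * (4 + l′) + 4 * (suc h * suc h)     ∎
    where
    open ≡-Reasoning
    open +-*-Solver
    w = h * 4 + (4 + l′)

  -- With B = κ h + 2 m blocks the dimension count becomes 2 κ h² < m l.
  enough-rows : ∀ κ m h l′ B′ → κ * h ≡ suc B′ → 2 * (κ * (h * h)) < m * (4 + l′) →
                κ * rows l′ h + 0 < suc (B′ + (m + m)) * (4 + l′) + suc B′ * l′
  enough-rows κ m h l′ B′ κh≡ lt = +-cancelʳ-< (4 * (κ * h)) _ _ (begin-strict
    (κ * rows l′ h + 0) + 4 * (κ * h)                    ≡⟨ solve 3 (λ k r h → (k :* r :+ con 0) :+ con 4 :* (k :* h) := k :* (r :+ con 4 :* h)) refl κ (rows l′ h) h ⟩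
    κ * (rows l′ h + 4 * h)                              ≡⟨ cong (κ *_) (rows-closed l′ h) ⟩
    κ * (2 * h * (4 + l′) + 4 * (h * h))                 ≡⟨ solve 3 (λ k h l → k :* (con 2 :* h :* l :+ con 4 :* (h :* h)) := con 2 :* (k :* h) :* l :+ con 2 :* (con 2 :* (k :* (h :* h)))) refl κ h (4 + l′) ⟩
    2 * (κ * h) * (4 + l′) + 2 * (2 * (κ * (h * h)))     <⟨ +-monoʳ-< (2 * (κ * h) * (4 + l′)) (*-monoʳ-< 2 lt) ⟩
    2 * (κ * h) * (4 + l′) + 2 * (m * (4 + l′))          ≡⟨ cong (λ z → 2 * z * (4 + l′) + 2 * (m * (4 + l′))) κh≡ ⟩
    2 * suc B′ * (4 + l′) + 2 * (m * (4 + l′))           ≡⟨ solve 3 (λ b m l → con 2 :* (con 1 :+ b) :* (con 4 :+ l) :+ con 2 :* (m :* (con 4 :+ l))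
                                                              := ((con 1 :+ (b :+ (m :+ m))) :* (con 4 :+ l) :+ (con 1 :+ b) :* l) :+ con 4 :* (con 1 :+ b)) refl B′ m l′ ⟩
    (suc (B′ + (m + m)) * (4 + l′) + suc B′ * l′) + 4 * suc B′  ≡⟨ cong (λ z → (suc (B′ + (m + m)) * (4 + l′) + suc B′ * l′) + 4 * z) κh≡ ⟨
    (suc (B′ + (m + m)) * (4 + l′) + suc B′ * l′) + 4 * (κ * h)  ∎)
    where
    open ≤-Reasoning
    open +-*-Solver

  -- The block length l = 4 + l′ is n/2 rounded up, the largest that `small` allows; n ≥ 8 makes it
  -- at least 4.
  split-half : ∀ n → 8 ≤ n → ∃[ l′ ] ((4 + l′) + (4 + l′) ≤ suc n × n ≤ (4 + l′) + (4 + l′))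
  split-half n 8≤n with half n
    where
    half : ∀ n → ∃[ l ] (l + l ≤ suc n × n ≤ l + l)
    half zero = 0 , z≤n , z≤n
    half (suc zero) = 1 , ≤-refl , s≤s z≤n
    half (suc (suc n)) with half n
    ... | l , a , b = suc l , s≤s (subst (_≤ suc (suc n)) (sym (+-suc l l)) (s≤s a)) , s≤s (subst (suc n ≤_) (sym (+-suc l l)) (s≤s b))
  ... | l , a , b with l ∸ 4 | m+[n∸m]≡n {4} {l} 4≤l
    where
    4≤l : 4 ≤ l
    4≤l with 4 ≤? l
    ... | yes p = p
    ... | no l<4 = contradiction (≤-trans 8≤n (≤-trans b (+-mono-≤ (s≤s⁻¹ (≰⇒> l<4)) (s≤s⁻¹ (≰⇒> l<4))))) λ { (s≤s (s≤s (s≤s (s≤s (s≤s (s≤s ())))))) }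
  ... | l′ | refl = l′ , a , b

  -- The standard choice is r = 0 and B′ + 1 = κ H. As 2 l ≥ n, the count 2 κ H² < m l follows from
  -- 4 κ H² < m n; as l ≤ n, the degree l + (B′ + 2 m) n is at most (κ H + 2 m) n.
  admissible : ∀ O S c H → let m = product S; κ = pred-product S; n = c * product O; N = c * pred-product (O ++ S) in
    c * product (O ++ S) ≡ m * n → 1 ≤ κ * H → 8 ≤ n → 4 * (κ * (H * H)) < m * n → H * 2 + 1 ≤ m * n →
    (κ * H + (m + m)) * n ≤ N * (H * 2) → Admissible O S c
  admissible O S c H mn≡ 1≤κH 8≤n area levels zeros with split-half (c * product O) 8≤n | κH≡
    where
    κH≡ : ∃[ B′ ] pred-product S * H ≡ suc B′
    κH≡ = pred (pred-product S * H) , sym (suc-pred (pred-product S * H) ⦃ >-nonZero 1≤κH ⦄)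
  ... | l′ , small , n≤2l | B′ , κH≡ = record
    { l′ = l′ ; B′ = B′ ; H = H ; r = 0 ; small = small ; levels = subst (H * 2 + 1 ≤_) (sym mn≡) levels ; r≤N = z≤n
    ; enough = enough-rows (pred-product S) (product S) H l′ B′ κH≡ (*-cancelˡ-< 2 _ _ (begin-strict
        2 * (2 * (pred-product S * (H * H)))       ≡⟨ *-assoc 2 2 (pred-product S * (H * H)) ⟨
        4 * (pred-product S * (H * H))             <⟨ area ⟩
        product S * (c * product O)                ≤⟨ *-monoʳ-≤ (product S) n≤2l ⟩
        product S * ((4 + l′) + (4 + l′))          ≡⟨ solve 2 (λ m l → m :* (l :+ l) := con 2 :* (m :* l)) refl (product S) (4 + l′) ⟩
        2 * (product S * (4 + l′))                 ∎))
    ; many = begin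
        (4 + l′) + (B′ + (product S + product S)) * (c * product O)               ≤⟨ +-monoˡ-≤ _ (l≤n l′ (c * product O) small) ⟩
        c * product O + (B′ + (product S + product S)) * (c * product O)          ≡⟨⟩
        suc (B′ + (product S + product S)) * (c * product O)                      ≡⟨ cong (λ z → (z + (product S + product S)) * (c * product O)) κH≡ ⟨
        (pred-product S * H + (product S + product S)) * (c * product O)          ≤⟨ zeros ⟩
        c * pred-product (O ++ S) * (H * 2)                                       ≡⟨ +-identityʳ _ ⟨
        c * pred-product (O ++ S) * (H * 2) + 0                                   ∎ }
    where
    open ≤-Reasoning
    open +-*-Solver
    l≤n : ∀ l′ n → (4 + l′) + (4 + l′) ≤ suc n → 4 + l′ ≤ n
    l≤n l′ n small = ≤-trans (m≤m+n (4 + l′) (3 + l′)) (s≤s⁻¹ (≤-trans (≤-reflexive (sym (+-suc (4 + l′) (3 + l′)))) small))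

  ceil-div : ∀ a d → 1 ≤ d → ∃[ H ] (a ≤ d * H × d * H < a + d)
  ceil-div a d@(suc d′) _ = (a + d′) / d , lower , upper
    where
    open ≤-Reasoning
    H = (a + d′) / d
    lower : a ≤ d * H
    lower = +-cancelʳ-≤ d′ a (d * H) (begin
      a + d′                       ≡⟨ m≡m%n+[m/n]*n (a + d′) d ⟩
      (a + d′) % d + H * d         ≤⟨ +-monoˡ-≤ (H * d) (s≤s⁻¹ (m%n<n (a + d′) d)) ⟩
      d′ + H * d                   ≡⟨ trans (+-comm d′ _) (cong (_+ d′) (*-comm H d)) ⟩
      d * H + d′                   ∎)
    upper : d * H < a + d
    upper = begin-strict
      d * H                        ≡⟨ *-comm d H ⟩
      H * d                        ≤⟨ m/n*n≤m (a + d′) d ⟩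
      a + d′                       <⟨ +-monoʳ-< a (n<1+n d′) ⟩
      a + d                        ∎

  Descending : List ℕ → Set
  Descending = AllPairs _>_

  1≤pred-product : ∀ {S} → All (2 ≤_) S → 1 ≤ pred-product S
  1≤pred-product [] = ≤-refl
  1≤pred-product (2≤l ∷ ps) = *-mono-≤ (∸-monoˡ-≤ 1 2≤l) (1≤pred-product ps)

  pred-product≤product : ∀ S → pred-product S ≤ product S
  pred-product≤product [] = ≤-refl
  pred-product≤product (l ∷ S) = *-mono-≤ (m∸n≤m l 1) (pred-product≤product S)

  -- ∏ l / (l − 1) over distinct l ≤ b telescopes.
  product≤ : ∀ {S} b → 1 ≤ b → All (2 ≤_) S → All (_≤ b) S → Descending S → product S ≤ pred-product S * b
  product≤ b 1≤b [] [] [] = subst (1 ≤_) (sym (*-identityˡ b)) 1≤b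
  product≤ {l ∷ S} b 1≤b (2≤l ∷ 2≤S) (l≤b ∷ _) (S<l ∷ desc) = begin
    l * product S                           ≤⟨ *-monoʳ-≤ l (product≤ (l ∸ 1) (∸-monoˡ-≤ 1 2≤l) 2≤S (All.map <⇒≤pred′ S<l) desc) ⟩
    l * (pred-product S * (l ∸ 1))          ≡⟨ solve 3 (λ l p k → l :* (p :* k) := (k :* p) :* l) refl l (pred-product S) (l ∸ 1) ⟩
    ((l ∸ 1) * pred-product S) * l          ≤⟨ *-monoʳ-≤ ((l ∸ 1) * pred-product S) l≤b ⟩
    ((l ∸ 1) * pred-product S) * b          ∎
    where
    open ≤-Reasoning
    open +-*-Solver
    <⇒≤pred′ : ∀ {x} → x < l → x ≤ l ∸ 1
    <⇒≤pred′ x<l = ∸-monoˡ-≤ 1 x<l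

  -- H is 5 m / (2 κ) rounded up, which bounds 2 m by (4/5) κ H. With m ≤ κ b the dimension count
  -- reduces to 25 b + 24 ≤ n. Because n is at least (b + 1)(b + 3), this holds from b = 22 on,
  -- where it reads 574 ≤ 575; hence the bound 23 for the second prime.
  two-large-primes : ∀ a b S c → 22 ≤ b → 2 + b ≤ a → 1 ≤ c → All (2 ≤_) S → All (_≤ b) S → Descending S →
                     Admissible (suc a ∷ suc b ∷ []) S c
  two-large-primes a b S c 22≤b b+2≤a 1≤c 2≤S S≤b desc with ceil-div (5 * product S) (2 * pred-product S) (*-mono-≤ {1} {2} (s≤s z≤n) (1≤pred-product 2≤S))
  ... | H , lower , upper = admissible (suc a ∷ suc b ∷ []) S c H mn≡ 1≤κH (≤-trans (m≤m+n 8 566) 574≤n) area levels zeros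
    where
    open ≤-Reasoning
    open +-*-Solver
    m = product S
    κ = pred-product S
    Q = suc a * (suc b * 1)
    n = c * Q
    1≤κ : 1 ≤ κ
    1≤κ = 1≤pred-product 2≤S
    κ≤m : κ ≤ m
    κ≤m = pred-product≤product S
    1≤m : 1 ≤ m
    1≤m = ≤-trans 1≤κ κ≤m
    m≤κb : m ≤ κ * b
    m≤κb = product≤ b (≤-trans (s≤s z≤n) 22≤b) 2≤S S≤b desc
    mn≡ : c * product (suc a ∷ suc b ∷ S) ≡ m * n
    mn≡ = solve 4 (λ c a b m → c :* ((con 1 :+ a) :* ((con 1 :+ b) :* m)) := m :* (c :* ((con 1 :+ a) :* ((con 1 :+ b) :* con 1)))) refl c a b m
    d = a ∸ (2 + b)
    a≡ : 2 + b + d ≡ a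
    a≡ = m+[n∸m]≡n b+2≤a
    e = b ∸ 22
    b≡ : 22 + e ≡ b
    b≡ = m+[n∸m]≡n 22≤b
    Q≥ : 25 * b + 24 ≤ Q
    Q≥ = subst₂ (λ a b → 25 * b + 24 ≤ suc a * (suc b * 1)) (trans (cong (λ z → 2 + z + d) b≡) a≡) b≡ (begin
      25 * (22 + e) + 24                                ≤⟨ m≤m+n _ (1 + 23 * e + e * e + d * (23 + e)) ⟩
      25 * (22 + e) + 24 + (1 + 23 * e + e * e + d * (23 + e))  ≡⟨ solve 2 (λ e d → con 25 :* (con 22 :+ e) :+ con 24 :+ (con 1 :+ con 23 :* e :+ e :* e :+ d :* (con 23 :+ e))
                                                             := (con 1 :+ (con 2 :+ (con 22 :+ e) :+ d)) :* ((con 1 :+ (con 22 :+ e)) :* con 1)) refl e d ⟩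
      suc (2 + (22 + e) + d) * (suc (22 + e) * 1)       ∎)
    Q≤n : Q ≤ n
    Q≤n = subst (_≤ n) (*-identityˡ Q) (*-monoˡ-≤ Q 1≤c)
    574≤n : 574 ≤ n
    574≤n = ≤-trans (+-monoˡ-≤ 24 (*-monoʳ-≤ 25 22≤b)) (≤-trans Q≥ Q≤n)
    1≤κH : 1 ≤ κ * H
    1≤κH = *-cancelˡ-≤ 2 (≤-trans (≤-trans (*-mono-≤ {2} {5} (s≤s (s≤s z≤n)) 1≤m) lower) (≤-reflexive (*-assoc 2 κ H)))
    area : 4 * (κ * (H * H)) < m * n
    area = *-cancelˡ-< κ _ _ (begin-strict
      κ * (4 * (κ * (H * H)))                ≡⟨ solve 2 (λ k h → k :* (con 4 :* (k :* (h :* h))) := (con 2 :* k :* h) :* (con 2 :* k :* h)) refl κ H ⟩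
      (2 * κ * H) * (2 * κ * H)              <⟨ *-mono-< upper upper ⟩
      (5 * m + 2 * κ) * (5 * m + 2 * κ)      ≡⟨ solve 2 (λ m k → (con 5 :* m :+ con 2 :* k) :* (con 5 :* m :+ con 2 :* k) := (con 25 :* m) :* m :+ ((con 20 :* m) :* k :+ (con 4 :* k) :* k)) refl m κ ⟩
      (25 * m) * m + ((20 * m) * κ + (4 * κ) * κ)  ≤⟨ +-mono-≤ (*-monoʳ-≤ (25 * m) m≤κb) (+-monoʳ-≤ ((20 * m) * κ) (*-monoʳ-≤ (4 * κ) κ≤m)) ⟩
      (25 * m) * (κ * b) + ((20 * m) * κ + (4 * κ) * m)  ≡⟨ solve 3 (λ m k b → (con 25 :* m) :* (k :* b) :+ ((con 20 :* m) :* k :+ (con 4 :* k) :* m) := (k :* m) :* (con 25 :* b :+ con 24)) refl m κ b ⟩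
      (κ * m) * (25 * b + 24)                ≤⟨ *-monoʳ-≤ (κ * m) (≤-trans Q≥ Q≤n) ⟩
      (κ * m) * n                            ≡⟨ *-assoc κ m n ⟩
      κ * (m * n)                            ∎)
    levels : H * 2 + 1 ≤ m * n
    levels = begin
      H * 2 + 1                              ≤⟨ +-monoˡ-≤ 1 (subst₂ _≤_ (*-identityˡ _) (solve 2 (λ k h → k :* (h :* con 2) := con 2 :* k :* h) refl κ H) (*-monoˡ-≤ (H * 2) 1≤κ)) ⟩
      2 * κ * H + 1                          ≤⟨ +-monoˡ-≤ 1 (<⇒≤ upper) ⟩
      5 * m + 2 * κ + 1                      ≤⟨ +-mono-≤ (+-monoʳ-≤ (5 * m) (*-monoʳ-≤ 2 κ≤m)) 1≤m ⟩
      5 * m + 2 * m + m                      ≡⟨ solve 1 (λ m → con 5 :* m :+ con 2 :* m :+ m := m :* con 8) refl m ⟩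
      m * 8                                  ≤⟨ *-monoʳ-≤ m (≤-trans (m≤m+n 8 566) 574≤n) ⟩
      m * n                                  ∎
    -- 5 (κH + 2m) ≤ 9 κH and 9 (a + 1)(b + 1) ≤ 10 a b.
    zeros : (κ * H + (m + m)) * n ≤ c * (a * (b * κ)) * (H * 2)
    zeros = *-cancelˡ-≤ 5 (begin
      5 * ((κ * H + (m + m)) * n)            ≡⟨ solve 4 (λ k h m n → con 5 :* ((k :* h :+ (m :+ m)) :* n) := (con 5 :* (k :* h) :+ con 2 :* (con 5 :* m)) :* n) refl κ H m n ⟩
      (5 * (κ * H) + 2 * (5 * m)) * n        ≤⟨ *-monoˡ-≤ n (+-monoʳ-≤ (5 * (κ * H)) (*-monoʳ-≤ 2 lower)) ⟩
      (5 * (κ * H) + 2 * (2 * κ * H)) * n    ≡⟨ solve 4 (λ k h c q → (con 5 :* (k :* h) :+ con 2 :* (con 2 :* k :* h)) :* (c :* q) := (c :* (k :* h)) :* (con 9 :* q)) refl κ H c Q ⟩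
      (c * (κ * H)) * (9 * Q)                ≤⟨ *-monoʳ-≤ (c * (κ * H)) 9Q≤ ⟩
      (c * (κ * H)) * (10 * (a * b))         ≡⟨ solve 5 (λ c k h a b → (c :* (k :* h)) :* (con 10 :* (a :* b)) := con 5 :* (c :* (a :* (b :* k)) :* (h :* con 2))) refl c κ H a b ⟩
      5 * (c * (a * (b * κ)) * (H * 2))      ∎)
      where
      9Q≤ : 9 * Q ≤ 10 * (a * b)
      9Q≤ = subst₂ (λ a b → 9 * (suc a * (suc b * 1)) ≤ 10 * (a * b)) (trans (cong (λ z → 2 + z + d) b≡) a≡) b≡ (begin
        9 * (suc (2 + (22 + e) + d) * (suc (22 + e) * 1))  ≤⟨ m≤m+n _ (105 + 28 * e + e * e + d * (13 + e)) ⟩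
        9 * (suc (2 + (22 + e) + d) * (suc (22 + e) * 1)) + (105 + 28 * e + e * e + d * (13 + e))
          ≡⟨ solve 2 (λ e d → con 9 :* ((con 1 :+ (con 2 :+ (con 22 :+ e) :+ d)) :* ((con 1 :+ (con 22 :+ e)) :* con 1)) :+ (con 105 :+ con 28 :* e :+ e :* e :+ d :* (con 13 :+ e))
               := con 10 :* ((con 2 :+ (con 22 :+ e) :+ d) :* (con 22 :+ e))) refl e d ⟩
        10 * ((2 + (22 + e) + d) * (22 + e))               ∎)

-- One large prime, and decision procedures for the remaining finite families.

module ParameterSearch where

  open Conditions
  open Lists
  open Parameters
  open import Defs using (E)
  open import Data.Bool.Base using (Bool; true; false; _∧_; _∨_; not; T)
  open import Data.Bool.Properties using (T-∧; T-∨)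
  open import Data.Empty using (⊥-elim)
  open import Data.Bool.ListAction using (all; any)
  open import Data.List.Base using (List; []; _∷_; _++_; take; drop; upTo)
  open import Data.List.Membership.Propositional using (_∈_; find)
  open import Data.List.Membership.Propositional.Properties using (∈-upTo⁺)
  open import Data.List.Membership.DecPropositional using (_∈?_)
  open import Data.List.Properties using (take++drop≡id)
  open import Data.List.Relation.Binary.Sublist.Propositional using (_⊆_; []; _∷_; _∷ʳ_; minimum)
  open import Data.List.Relation.Unary.All as All using (All; []; _∷_)
  open import Data.List.Relation.Unary.All.Properties as Allₚ using (all⁺)
  open import Data.List.Relation.Unary.Any as Any using (Any; here; there)
  open import Data.List.Relation.Unary.Any.Properties using (any⁻)
  open import Data.List.Relation.Unary.AllPairs using (AllPairs; []; _∷_)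
  open import Data.Nat.Base
  open import Data.Nat.Divisibility using (m%n≡0⇒n∣m)
  open import Data.Nat.DivMod using (_/_; _%_)
  open import Data.Nat.ListAction using (product)
  open import Data.Nat.ListAction.Properties using (product-++)
  open import Data.Nat.Primality using (Prime; prime?; prime⇒irreducible)
  open import Data.Nat.Properties
  open import Data.Nat.Solver using (module +-*-Solver)
  open import Data.Sum.Base using (_⊎_; inj₁; inj₂)
  open import Data.Unit.Base using (tt)
  open import Function.Bundles using (Equivalence)
  open import Relation.Nullary.Decidable using (from-yes; _→-dec_)

  -- The bound 10 m ≤ 3 κ H makes κ H + 2 m at most (8/5) κ H, and 8 (a + 1) ≤ 10 a once a ≥ 4. With
  -- n replaced by 289 the other inequalities involve S and H alone.
  one-large-prime : ∀ a S c H → 4 ≤ a → 289 ≤ c * suc a → let m = product S; κ = pred-product S in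
    1 ≤ κ * H → 10 * m ≤ 3 * κ * H → 4 * (κ * (H * H)) < m * 289 → H * 2 + 1 ≤ m * 289 → Admissible (suc a ∷ []) S c
  one-large-prime a S c H 4≤a w≥ 1≤κH lower area levels =
    admissible (suc a ∷ []) S c H mn≡ 1≤κH (≤-trans (m≤m+n 8 281) n≥) (<-≤-trans area (*-monoʳ-≤ m n≥)) (≤-trans levels (*-monoʳ-≤ m n≥)) zeros
    where
    open ≤-Reasoning
    open +-*-Solver
    m = product S
    κ = pred-product S
    n = c * (suc a * 1)
    mn≡ : c * product (suc a ∷ S) ≡ m * n
    mn≡ = solve 3 (λ c a m → c :* ((con 1 :+ a) :* m) := m :* (c :* ((con 1 :+ a) :* con 1))) refl c a m
    n≥ : 289 ≤ n
    n≥ = subst (λ z → 289 ≤ c * z) (sym (*-identityʳ (suc a))) w≥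
    zeros : (κ * H + (m + m)) * n ≤ c * (a * κ) * (H * 2)
    zeros = *-cancelˡ-≤ 5 (begin
      5 * ((κ * H + (m + m)) * n)                    ≡⟨ solve 4 (λ k h m n → con 5 :* ((k :* h :+ (m :+ m)) :* n) := (con 5 :* (k :* h) :+ con 10 :* m) :* n) refl κ H m n ⟩
      (5 * (κ * H) + 10 * m) * n                     ≤⟨ *-monoˡ-≤ n (+-monoʳ-≤ (5 * (κ * H)) lower) ⟩
      (5 * (κ * H) + 3 * κ * H) * n                  ≡⟨ solve 4 (λ k h c a → (con 5 :* (k :* h) :+ con 3 :* k :* h) :* (c :* ((con 1 :+ a) :* con 1)) := (c :* (k :* h)) :* (con 2 :* (con 4 :+ con 4 :* a))) refl κ H c a ⟩
      (c * (κ * H)) * (2 * (4 + 4 * a))              ≤⟨ *-monoʳ-≤ (c * (κ * H)) (*-monoʳ-≤ 2 (+-monoˡ-≤ (4 * a) 4≤a)) ⟩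
      (c * (κ * H)) * (2 * (a + 4 * a))              ≡⟨ solve 4 (λ c k h a → (c :* (k :* h)) :* (con 2 :* (a :+ con 4 :* a)) := con 5 :* (c :* (a :* k) :* (h :* con 2))) refl c κ H a ⟩
      5 * (c * (a * κ) * (H * 2))                    ∎)

  -- The zeros suffice when 3 (H + 4) ≤ 4 H, so H = 12 is least, and 4 · 12² < 2 n then means n ≥
  -- 289. This case fixes the threshold 289.
  three-smooth : ∀ c → 289 ≤ c * 3 → Admissible (3 ∷ []) (2 ∷ []) c
  three-smooth c w≥ = admissible (3 ∷ []) (2 ∷ []) c 12 (solve 1 (λ c → c :* con 6 := con 2 :* (c :* con 3)) refl c) (s≤s z≤n)
      (≤-trans (m≤m+n 8 281) w≥) (<-≤-trans (m≤m+n 577 1) (*-monoʳ-≤ 2 w≥)) (≤-trans (m≤m+n 25 553) (*-monoʳ-≤ 2 w≥))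
      (≤-reflexive (solve 1 (λ c → con 16 :* (c :* con 3) := c :* con 2 :* con 24) refl c))
    where open +-*-Solver

  -- Here H + 4 ≤ 2 H gives H = 4, and 4 · 4² < 2 n means n ≥ 33.
  power-of-two : ∀ c → 33 ≤ c → Admissible [] (2 ∷ []) c
  power-of-two c c≥ = admissible [] (2 ∷ []) c 4 (solve 1 (λ c → c :* con 2 := con 2 :* (c :* con 1)) refl c) (s≤s z≤n)
      (≤-trans (m≤m+n 8 25) n≥) (<-≤-trans (m≤m+n 65 1) (*-monoʳ-≤ 2 n≥)) (≤-trans (m≤m+n 9 57) (*-monoʳ-≤ 2 n≥))
      (≤-reflexive (solve 1 (λ c → con 8 :* (c :* con 1) := c :* con 1 :* con 8) refl c))
    where
    open +-*-Solver
    n≥ : 33 ≤ c * 1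
    n≥ = subst (33 ≤_) (sym (*-identityʳ c)) c≥

  private
    ∧⁻ : ∀ {a b} → T (a ∧ b) → T a × T b
    ∧⁻ = Equivalence.to T-∧

    ∨⁻ : ∀ {a b} → T (a ∨ b) → T a ⊎ T b
    ∨⁻ = Equivalence.to T-∨

  ∨-resolve : ∀ a b → T (a ∨ b) → ¬ T a → T b
  ∨-resolve true  b ok ¬a = contradiction tt ¬a
  ∨-resolve false b ok ¬a = ok

  -- The inequalities for r = 0 and B′ + 1 = κ H, with the degree kept exact instead of l being
  -- rounded up to n.
  fits : (m κ n N l H : ℕ) → Bool
  fits m κ n N l H =
    (4 ≤ᵇ l) ∧ (l + l ≤ᵇ suc n) ∧ (1 ≤ᵇ κ * H) ∧ (2 * (κ * (H * H)) <ᵇ m * l) ∧ (H * 2 + 1 ≤ᵇ m * n) ∧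
    (l + ((κ * H + (m + m)) ∸ 1) * n ≤ᵇ N * (H * 2))

  -- The least H for which the auxiliary polynomial has too many zeros.
  fits-least : (m κ n N l excess : ℕ) → Bool
  fits-least m κ n N l zero    = false
  fits-least m κ n N l (suc d) = fits m κ n N l ((l + ((m + m) ∸ 1) * n + d) / suc d)

  -- Each level gains 2 N zeros and costs κ n in degree, so the excess 2 N - κ n has to be positive;
  -- l is the greatest block length with 2 l ≤ n + 1.
  fits? : (m κ n N : ℕ) → Bool
  fits? m κ n N = fits-least m κ n N (suc n / 2) (2 * N ∸ κ * n)

  suits? : List ℕ → List ℕ → ℕ → Bool
  suits? O S c = fits? (product S) (pred-product S) (c * product O) (c * pred-product (O ++ S))

  private
    product-split : ∀ O S c → c * product (O ++ S) ≡ product S * (c * product O)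
    product-split O S c = trans (cong (c *_) (product-++ O S))
      (solve 3 (λ c o s → c :* (o :* s) := s :* (c :* o)) refl c (product O) (product S))
      where open +-*-Solver

    fits-sound : ∀ O S c l H → T (fits (product S) (pred-product S) (c * product O) (c * pred-product (O ++ S)) l H) → Admissible O S c
    fits-sound O S c l H ok =
      let (4≤l , ok₁) = ∧⁻ ok
          (small , ok₂) = ∧⁻ ok₁
          (1≤κH , ok₃) = ∧⁻ ok₂
          (area , ok₄) = ∧⁻ ok₃
          (levels , many) = ∧⁻ ok₄
      in build (≤ᵇ⇒≤ 4 l 4≤l) (≤ᵇ⇒≤ _ _ small) (≤ᵇ⇒≤ _ _ 1≤κH) (<ᵇ⇒< _ _ area) (≤ᵇ⇒≤ _ _ levels) (≤ᵇ⇒≤ _ _ many)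
      where
      m = product S
      κ = pred-product S
      n = c * product O
      N = c * pred-product (O ++ S)
      build : 4 ≤ l → l + l ≤ suc n → 1 ≤ κ * H → 2 * (κ * (H * H)) < m * l → H * 2 + 1 ≤ m * n →
              l + ((κ * H + (m + m)) ∸ 1) * n ≤ N * (H * 2) → Admissible O S c
      build 4≤l small 1≤κH area levels many = record
        { l′ = l ∸ 4 ; B′ = pred (κ * H) ; H = H ; r = 0
        ; small = subst (λ z → z + z ≤ suc n) (sym l≡) small
        ; levels = subst (H * 2 + 1 ≤_) (sym (product-split O S c)) levels
        ; r≤N = z≤n
        ; enough = enough-rows κ m H (l ∸ 4) (pred (κ * H)) (sym κH≡) (subst (λ z → 2 * (κ * (H * H)) < m * z) (sym l≡) area)
        ; many = subst₂ _≤_ (cong₂ (λ z b → z + ((b + (m + m)) ∸ 1) * n) (sym l≡) (sym κH≡)) (sym (+-identityʳ (N * (H * 2)))) many }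
        where
        l≡ : 4 + (l ∸ 4) ≡ l
        l≡ = m+[n∸m]≡n 4≤l
        κH≡ : suc (pred (κ * H)) ≡ κ * H
        κH≡ = suc-pred (κ * H) ⦃ >-nonZero 1≤κH ⦄

  suits-sound : ∀ O S c → T (suits? O S c) → Admissible O S c
  suits-sound O S c ok = least (suc (c * product O) / 2) (2 * (c * pred-product (O ++ S)) ∸ pred-product S * (c * product O)) ok
    where
    least : ∀ l d → T (fits-least (product S) (pred-product S) (c * product O) (c * pred-product (O ++ S)) l d) → Admissible O S c
    least l (suc d) ok = fits-sound O S c l _ ok

  admissible? : List ℕ → List ℕ → ℕ → (l′ B′ H r : ℕ) → Bool
  admissible? O S c l′ B′ H r =
    ((4 + l′) + (4 + l′) ≤ᵇ suc (c * product O)) ∧ (H * 2 + 1 ≤ᵇ c * product (O ++ S)) ∧ (r ≤ᵇ c * pred-product (O ++ S)) ∧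
    (pred-product S * rows l′ H + r <ᵇ suc (B′ + (product S + product S)) * (4 + l′) + suc B′ * l′) ∧
    ((4 + l′) + (B′ + (product S + product S)) * (c * product O) ≤ᵇ c * pred-product (O ++ S) * (H * 2) + r)

  admissible-sound : ∀ O S c l′ B′ H r → T (admissible? O S c l′ B′ H r) → Admissible O S c
  admissible-sound O S c l′ B′ H r ok =
    let (small , ok₁) = ∧⁻ ok
        (levels , ok₂) = ∧⁻ ok₁
        (r≤N , ok₃) = ∧⁻ ok₂
        (enough , many) = ∧⁻ ok₃
    in record { l′ = l′ ; B′ = B′ ; H = H ; r = r ; small = ≤ᵇ⇒≤ _ _ small ; levels = ≤ᵇ⇒≤ _ _ levels ; r≤N = ≤ᵇ⇒≤ _ _ r≤N
              ; enough = <ᵇ⇒< _ _ enough ; many = ≤ᵇ⇒≤ _ _ many }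

  divisor-below : ℕ → ℕ → Bool
  divisor-below k p = any (λ d → (2 + d <ᵇ p) ∧ (p % (2 + d) ≡ᵇ 0)) (upTo k)

  divisor-below-sound : ∀ k p → T (divisor-below k p) → ¬ Prime p
  divisor-below-sound k p ok pr with find (any⁻ (λ d → (2 + d <ᵇ p) ∧ (p % (2 + d) ≡ᵇ 0)) (upTo k) ok)
  ... | d , _ , ok′ with ∧⁻ ok′
  ...   | d<p , p%d≡0 with prime⇒irreducible pr (m%n≡0⇒n∣m p (2 + d) (≡ᵇ⇒≡ _ 0 p%d≡0))
  ...     | inj₂ d≡p = <⇒≢ (<ᵇ⇒< (2 + d) p d<p) d≡p

  -- Trial division stops at 41; a composite candidate that survives it must pass the numerical
  -- tests like a prime.
  excluded? : ℕ → Bool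
  excluded? p = any (p ≡ᵇ_) E ∨ divisor-below 40 p

  excluded-sound : ∀ p → Prime p → ¬ (p ∈ E) → ¬ T (excluded? p)
  excluded-sound p pr p∉E ok with ∨⁻ {any (p ≡ᵇ_) E} ok
  ... | inj₁ inE = let (e , e∈ , p≡e) = find (any⁻ (p ≡ᵇ_) E inE) in p∉E (subst (_∈ E) (sym (≡ᵇ⇒≡ p e p≡e)) e∈)
  ... | inj₂ composite = divisor-below-sound 40 p composite pr

  Choice : List ℕ → ℕ → Set
  Choice T c = ∃[ O ] ∃[ S ] (O ++ S ≡ T × Admissible O S c)

  -- The last two alternatives serve p = 89 and p = 191.
  choice? : List ℕ → ℕ → Bool
  choice? T c = suits? (take 1 T) (drop 1 T) c ∨ suits? (take 2 T) (drop 2 T) c ∨ suits? (take 0 T) (drop 0 T) c ∨ suits? (take 3 T) (drop 3 T) c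
    ∨ excluded? (1 + c * product T)
    ∨ admissible? (take 1 T) (drop 1 T) c 18 1 3 2 ∨ admissible? (take 2 T) (drop 2 T) c 44 5 6 39

  choice-sound : ∀ T′ c → Prime (1 + c * product T′) → ¬ (1 + c * product T′ ∈ E) → T (choice? T′ c) → Choice T′ c
  choice-sound T′ c pr p∉E ok with ∨⁻ {suits? (take 1 T′) (drop 1 T′) c} ok
  ... | inj₁ ok = take 1 T′ , drop 1 T′ , take++drop≡id 1 T′ , suits-sound _ _ c ok
  ... | inj₂ ok with ∨⁻ {suits? (take 2 T′) (drop 2 T′) c} ok
  ... | inj₁ ok = take 2 T′ , drop 2 T′ , take++drop≡id 2 T′ , suits-sound _ _ c ok
  ... | inj₂ ok with ∨⁻ {suits? (take 0 T′) (drop 0 T′) c} ok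
  ... | inj₁ ok = take 0 T′ , drop 0 T′ , refl , suits-sound _ _ c ok
  ... | inj₂ ok with ∨⁻ {suits? (take 3 T′) (drop 3 T′) c} ok
  ... | inj₁ ok = take 3 T′ , drop 3 T′ , take++drop≡id 3 T′ , suits-sound _ _ c ok
  ... | inj₂ ok with ∨⁻ {excluded? (1 + c * product T′)} ok
  ... | inj₁ ok = ⊥-elim (excluded-sound (1 + c * product T′) pr p∉E ok)
  ... | inj₂ ok with ∨⁻ {admissible? (take 1 T′) (drop 1 T′) c 18 1 3 2} ok
  ... | inj₁ ok = take 1 T′ , drop 1 T′ , take++drop≡id 1 T′ , admissible-sound (take 1 T′) (drop 1 T′) c 18 1 3 2 ok
  ... | inj₂ ok = take 2 T′ , drop 2 T′ , take++drop≡id 2 T′ , admissible-sound (take 2 T′) (drop 2 T′) c 44 5 6 39 ok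

  -- The test is specialised prime by prime along the recursion, so no list of sublists is ever
  -- built.
  all-sublists : (List ℕ → Bool) → List ℕ → Bool
  all-sublists f [] = f []
  all-sublists f (b ∷ bs) = all-sublists (λ S → f (b ∷ S)) bs ∧ all-sublists f bs

  all-sublists-sound : ∀ f {S bs} → S ⊆ bs → T (all-sublists f bs) → T (f S)
  all-sublists-sound f [] ok = ok
  all-sublists-sound f {bs = _ ∷ bs} (b ∷ʳ S⊆) ok = all-sublists-sound f S⊆ (proj₂ (∧⁻ {all-sublists (λ S → f (b ∷ S)) bs} ok))
  all-sublists-sound f {bs = b ∷ bs} (refl ∷ S⊆) ok = all-sublists-sound (λ S → f (b ∷ S)) S⊆ (proj₁ (∧⁻ {all-sublists (λ S → f (b ∷ S)) bs} ok))

  all-sublists-true : ∀ f {S bs} → S ⊆ bs → all-sublists f bs ≡ true → T (f S)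
  all-sublists-true f S⊆ eq = all-sublists-sound f S⊆ (subst T (sym eq) tt)

  descending-⊆ : ∀ {S} bs → Descending S → All (_∈ bs) S → Descending bs → S ⊆ bs
  descending-⊆ {[]} bs _ _ _ = minimum bs
  descending-⊆ {s ∷ S} (b ∷ bs) (S<s ∷ descS) (here refl ∷ S∈) (bs<b ∷ descB) =
    refl ∷ descending-⊆ bs descS (All.zipWith (λ { (x<s , here refl) → contradiction x<s (<-irrefl refl) ; (_ , there x∈) → x∈ }) (S<s , S∈)) descB
  descending-⊆ {s ∷ S} (b ∷ bs) (S<s ∷ descS) (there s∈ ∷ S∈) (bs<b ∷ descB) =
    b ∷ʳ descending-⊆ bs (S<s ∷ descS) (s∈ ∷ All.zipWith (λ { (x<s , here refl) → contradiction (<-trans x<s (All.lookup bs<b s∈)) (<-irrefl refl) ; (_ , there x∈) → x∈ }) (S<s , S∈)) descB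

  small-primes : List ℕ
  small-primes = 19 ∷ 17 ∷ 13 ∷ 11 ∷ 7 ∷ 5 ∷ 3 ∷ 2 ∷ []

  small-primes-descending : Descending small-primes
  small-primes-descending = from-yes (allPairs? (λ x y → y <? x) small-primes)
    where open import Data.List.Relation.Unary.AllPairs using (allPairs?)

  ∈-small-primes : ∀ l → Prime l → l < 23 → l ∈ small-primes
  ∈-small-primes l pr l<23 = All.lookup (from-yes (All.all? (λ n → prime? n →-dec (_∈?_ _≟_ n small-primes)) (upTo 23))) (∈-upTo⁺ l<23) pr

  -- Tests the least H with 10 m ≤ 3 κ H, namely 10 m / (3 κ) rounded up.
  large-cofactor? : List ℕ → Bool
  large-cofactor? S = go (product S) (pred-product S)
    where
    check : ℕ → ℕ → ℕ → Bool
    check m κ H = (1 ≤ᵇ κ * H) ∧ (10 * m ≤ᵇ 3 * κ * H) ∧ (4 * (κ * (H * H)) <ᵇ m * 289) ∧ (H * 2 + 1 ≤ᵇ m * 289)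
    go : ℕ → ℕ → Bool
    go m zero = false
    go m κ@(suc k) = check m κ ((10 * m + (3 * κ ∸ 1)) / (3 * κ))

  -- Only lists containing 2 occur, because p - 1 is even and 2 stays in m.
  large-check : List ℕ → Bool
  large-check S = not (any (_≡ᵇ 2) S) ∨ large-cofactor? S

  all-large-cofactors : all-sublists large-check small-primes ≡ true
  all-large-cofactors = refl

  -- The candidate q + 1 for the largest prime has to exceed the next prime s. As q + 1 ≤ 288 < 17²,
  -- the trial divisors 2, ..., 16 decide whether it is prime.
  skip? : List ℕ → ℕ → Bool
  skip? [] q = true
  skip? (s ∷ _) q = (q <ᵇ s) ∨ divisor-below 15 (suc q)

  choice-at? : List ℕ → ℕ → ℕ → Bool
  choice-at? S q c = choice? (suc q ∷ S) (suc c)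

  -- The cofactors are those with c (q + 1) ≤ 288, complementary to the range of `one-large-prime`.
  choices? : List ℕ → ℕ → Bool
  choices? S q = all (choice-at? S q) (upTo (288 / suc q))

  prime-choices? : List ℕ → ℕ → Bool
  prime-choices? S q = skip? S q ∨ choices? S q

  small-cofactor? : List ℕ → Bool
  small-cofactor? S = all (prime-choices? S) (upTo 288)

  small-check : List ℕ → Bool
  small-check S = not (any (_≡ᵇ 2) S) ∨ small-cofactor? S

  excluded-at? : ℕ → Bool
  excluded-at? c = excluded? (1 + suc c * 2)

  -- Covers the range below the threshold of `power-of-two`: every odd number from 3 to 65 lies in E
  -- or is composite.
  few-powers-of-two : T (all excluded-at? (upTo 32))
  few-powers-of-two = tt

  choices-sound : ∀ S q → q < 288 → T (small-cofactor? S) → ¬ T (skip? S q) → T (choices? S q)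
  choices-sound S q q<288 ok = ∨-resolve (skip? S q) (choices? S q)
    (All.lookup (all⁺ (prime-choices? S) (upTo 288) ok) (∈-upTo⁺ q<288))

  choice-at-sound : ∀ S q c → c < 288 / suc q → T (choices? S q) → T (choice-at? S q c)
  choice-at-sound S q c c< oks = All.lookup (all⁺ (choice-at? S q) (upTo (288 / suc q)) oks) (∈-upTo⁺ c<)

  excluded-at-sound : ∀ c → c < 32 → T (excluded-at? c)
  excluded-at-sound c c<32 = All.lookup (all⁺ excluded-at? (upTo 32) few-powers-of-two) (∈-upTo⁺ c<32)

-- The finite check for small cofactors, by evaluation.

module SmallCofactors where

  open ParameterSearch
  open import Data.Bool.Base using (true)
  open import Relation.Binary.PropositionalEquality using (_≡_; refl)

  all-small-cofactors : all-sublists small-check small-primes ≡ true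
  all-small-cofactors = refl

-- The prime divisors of p - 1 and the choice of parameters in every case.

module ParameterChoice where

  open Lists
  open Parameters
  open ParameterSearch
  open SmallCofactors
  open import Defs using (E)
  open import Data.Bool.Base using (Bool; _∧_; _∨_; not; T)
  open import Data.Bool.ListAction using (any)
  open import Data.Bool.Properties using (T-∧; T-∨)
  open import Data.Empty using (⊥; ⊥-elim)
  open import Data.List.Base using (List; []; _∷_)
  open import Data.List.Membership.Propositional using (_∈_; lose)
  open import Data.List.Relation.Binary.Sublist.Propositional using (_⊆_)
  open import Data.List.Relation.Unary.All as All using (All; []; _∷_)
  open import Data.List.Relation.Unary.Any using (here; there)
  open import Data.List.Relation.Unary.Any.Properties using (any⁺)
  open import Data.List.Relation.Unary.AllPairs using ([]; _∷_)
  open import Data.Nat.Base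
  open import Data.Nat.Coprimality as Coprimality using (Coprime; coprime-divisor; prime⇒coprime)
  open import Data.Nat.Divisibility using (_∣_; divides; ∣⇒≤; _∣?_)
  open import Data.Nat.DivMod using (_/_; m*n/n≡m; /-monoˡ-≤)
  open import Data.Nat.ListAction using (product)
  open import Data.Nat.Primality using (Prime; prime?; prime⇒irreducible; prime⇒nonZero; prime⇒nonTrivial; ¬prime[0])
  open import Data.Nat.Properties
  open import Data.Nat.Solver using (module +-*-Solver)
  open import Data.Sum.Base using (_⊎_; inj₁; inj₂)
  open import Function.Bundles using (Equivalence)
  open import Relation.Nullary.Decidable using (_×-dec_)

  private
    ∨⁻ : ∀ {a b} → T (a ∨ b) → T a ⊎ T b
    ∨⁻ = Equivalence.to T-∨

    ∧⁻ : ∀ {a b} → T (a ∧ b) → T a × T b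
    ∧⁻ = Equivalence.to T-∧

    T-not : ∀ {b} → T (not b) → T b → ⊥
    T-not {Bool.false} _ ()
    T-not {Bool.true} ()

  prime≥2 : ∀ {l} → Prime l → 2 ≤ l
  prime≥2 pr = nonTrivial⇒n>1 _ ⦃ prime⇒nonTrivial pr ⦄

  record PrimeList (q : ℕ) : Set where
    field
      T-list     : List ℕ
      primes     : All Prime T-list
      descending : Descending T-list
      dividing   : All (_∣ q) T-list
      complete   : ∀ {l} → Prime l → l ∣ q → l ∈ T-list

  private
    module _ (q : ℕ) where

      Good : ℕ → Set
      Good l = Prime l × l ∣ q

      good? : ∀ l → Dec (Good l)
      good? l = prime? l ×-dec (l ∣? q)

      -- The decision is passed to `extend` as an argument, so that properties of the list are
      -- proved by cases on that argument.
      below : ℕ → List ℕ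
      extend : ∀ k → Dec (Good k) → List ℕ
      below zero = []
      below (suc k) = extend k (good? k)
      extend k (yes _) = k ∷ below k
      extend k (no _) = below k

      below-< : ∀ k → All (_< k) (below k)
      below-< zero = []
      below-< (suc k) = go (good? k)
        where
        go : ∀ d → All (_< suc k) (extend k d)
        go (yes _) = ≤-refl ∷ All.map m≤n⇒m≤1+n (below-< k)
        go (no _) = All.map m≤n⇒m≤1+n (below-< k)

      below-good : ∀ k → All Good (below k)
      below-good zero = []
      below-good (suc k) = go (good? k)
        where
        go : ∀ d → All Good (extend k d)
        go (yes g) = g ∷ below-good k
        go (no _) = below-good k

      below-descending : ∀ k → Descending (below k)
      below-descending zero = []
      below-descending (suc k) = go (good? k)
        where
        go : ∀ d → Descending (extend k d)
        go (yes _) = below-< k ∷ below-descending k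
        go (no _) = below-descending k

      below-complete : ∀ k {l} → l < k → Good l → l ∈ below k
      below-complete (suc k) {l} (s≤s l≤k) g = go (good? k) (m≤n⇒m<n∨m≡n l≤k)
        where
        go : ∀ d → l < k ⊎ l ≡ k → l ∈ extend k d
        go (yes _) (inj₁ l<k) = there (below-complete k l<k g)
        go (yes _) (inj₂ refl) = here refl
        go (no _) (inj₁ l<k) = below-complete k l<k g
        go (no ¬g) (inj₂ refl) = contradiction g ¬g

  prime-list : ∀ q → 1 ≤ q → PrimeList q
  prime-list q 1≤q = record
    { T-list = below q (suc q) ; primes = All.map proj₁ (below-good q (suc q)) ; descending = below-descending q (suc q)
    ; dividing = All.map proj₂ (below-good q (suc q))
    ; complete = λ pr l∣q → below-complete q (suc q) (s≤s (∣⇒≤ ⦃ >-nonZero 1≤q ⦄ l∣q)) (pr , l∣q) }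

  pairwise-coprime : ∀ {T} → All Prime T → Descending T → PairwiseCoprime T
  pairwise-coprime [] [] = []
  pairwise-coprime {l ∷ _} (pr ∷ prs) (T<l ∷ desc) =
    (≤-trans (s≤s z≤n) (prime≥2 pr) , coprime-to-l prs T<l) ∷ pairwise-coprime prs desc
    where
    coprime-to-l : ∀ {S} → All Prime S → All (_< l) S → All (Coprime l) S
    coprime-to-l [] [] = []
    coprime-to-l (prk ∷ prs) (k<l ∷ S<l) = prime⇒coprime pr ⦃ prime⇒nonZero prk ⦄ k<l ∷ coprime-to-l prs S<l

  -- After division by l the other members still divide the cofactor, being coprime to l.
  product-divides : ∀ {T} q → PairwiseCoprime T → All (_∣ q) T → ∃[ c ] c * product T ≡ q
  product-divides q [] [] = q , *-identityʳ q
  product-divides {l ∷ T} q ((_ , cop) ∷ pc) (divides k q≡ ∷ ds) with product-divides k pc (divide-cofactor cop ds)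
    where
    divide-cofactor : ∀ {S} → All (Coprime l) S → All (_∣ q) S → All (_∣ k) S
    divide-cofactor [] [] = []
    divide-cofactor (cp ∷ cps) (d ∷ ds) = coprime-divisor (Coprimality.sym cp) (subst (_ ∣_) (trans q≡ (*-comm k l)) d) ∷ divide-cofactor cps ds
  ... | c , k≡ = c , trans (solve 3 (λ c l t → c :* (l :* t) := (c :* t) :* l) refl c l (product T)) (trans (cong (_* l) k≡) (sym q≡))
    where open +-*-Solver

  private
    all-≥2 : ∀ {T} → All Prime T → All (2 ≤_) T
    all-≥2 = All.map prime≥2

    any-2 : ∀ {S} → 2 ∈ S → T (any (_≡ᵇ 2) S)
    any-2 2∈ = any⁺ (_≡ᵇ 2) (lose 2∈ (≡⇒≡ᵇ 2 2 refl))

    ¬no-2 : ∀ {S} → 2 ∈ S → ¬ T (not (any (_≡ᵇ 2) S))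
    ¬no-2 2∈ no2 = T-not no2 (any-2 2∈)

    large-at : ∀ {S} → S ⊆ small-primes → 2 ∈ S → T (large-cofactor? S)
    large-at {S} S⊆ 2∈ = ∨-resolve (not (any (_≡ᵇ 2) S)) (large-cofactor? S) (all-sublists-true large-check S⊆ all-large-cofactors) (¬no-2 2∈)

    small-at : ∀ {S} → S ⊆ small-primes → 2 ∈ S → T (small-cofactor? S)
    small-at {S} S⊆ 2∈ = ∨-resolve (not (any (_≡ᵇ 2) S)) (small-cofactor? S) (all-sublists-true small-check S⊆ all-small-cofactors) (¬no-2 2∈)

    large-cofactor : ∀ a S c → T (large-cofactor? S) → 4 ≤ a → 289 ≤ c * suc a → Choice (suc a ∷ S) c
    large-cofactor a S c ok 4≤a w≥ = suc a ∷ [] , S , refl , go (pred-product S) refl ok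
      where
      go : ∀ κ → pred-product S ≡ κ → T (large-cofactor? S) → Admissible (suc a ∷ []) S c
      go zero κ≡ ok rewrite κ≡ = ⊥-elim ok
      go (suc k) κ≡ ok with pred-product S in eq
      go (suc k) κ≡ ok | suc k′ =
        let H = (10 * product S + (3 * suc k′ ∸ 1)) / (3 * suc k′)
            (p₁ , ok₁) = ∧⁻ {1 ≤ᵇ suc k′ * H} ok
            (p₂ , ok₂) = ∧⁻ {10 * product S ≤ᵇ 3 * suc k′ * H} ok₁
            (p₃ , p₄) = ∧⁻ {4 * (suc k′ * (H * H)) <ᵇ product S * 289} ok₂
        in one-large-prime a S c H 4≤a w≥
             (subst (λ κ → 1 ≤ κ * H) (sym eq) (≤ᵇ⇒≤ 1 _ p₁)) (subst (λ κ → 10 * product S ≤ 3 * κ * H) (sym eq) (≤ᵇ⇒≤ _ _ p₂))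
             (subst (λ κ → 4 * (κ * (H * H)) < product S * 289) (sym eq) (<ᵇ⇒< _ _ p₃)) (≤ᵇ⇒≤ _ _ p₄)

    small-cofactor : ∀ a s S c → T (small-cofactor? (s ∷ S)) → s < suc a → Prime (suc a) → 1 ≤ c → c * suc a < 289 → T (choice? (suc a ∷ s ∷ S) c)
    small-cofactor a s S (suc c) ok s<q pr _ w< = choice-at-sound (s ∷ S) a c c< (choices-sound (s ∷ S) a a<288 ok ¬skip)
      where
      a<288 : a < 288
      a<288 = s≤s⁻¹ (≤-<-trans (m≤m+n (suc a) (c * suc a)) w<)
      c< : c < 288 / suc a
      c< = ≤-trans (≤-reflexive (sym (m*n/n≡m (suc c) (suc a)))) (/-monoˡ-≤ (suc a) (s≤s⁻¹ w<))
      ¬skip : ¬ T (skip? (s ∷ S) a)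
      ¬skip skip = divisor-below-sound 15 (suc a) (∨-resolve (a <ᵇ s) (divisor-below 15 (suc a)) skip (λ a<s → ≤⇒≯ (s≤s⁻¹ s<q) (<ᵇ⇒< a s a<s))) pr

  private
    -- One of k and k + 1 is even, so two primes above 2 are not consecutive. This supplies a ≥ b +
    -- 2, on which the constants of `two-large-primes` depend.
    odd-gap : ∀ {k l} → Prime k → Prime l → 2 < k → k < l → 2 + k ≤ l
    odd-gap {k} {l} prk prl 2<k k<l with m≤n⇒m<n∨m≡n k<l
    ... | inj₁ lt = lt
    ... | inj₂ refl with 2∣or2∣suc k
      where
      2∣or2∣suc : ∀ k → 2 ∣ k ⊎ 2 ∣ suc k
      2∣or2∣suc zero = inj₁ (divides 0 refl)
      2∣or2∣suc (suc k) with 2∣or2∣suc k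
      ... | inj₁ (divides d k≡) = inj₂ (divides (suc d) (cong (2 +_) k≡))
      ... | inj₂ d = inj₁ d
    ...   | inj₁ 2∣k with prime⇒irreducible prk 2∣k
    ...     | inj₂ refl = contradiction 2<k (<-irrefl refl)
    odd-gap {k} prk prl 2<k k<l | inj₂ refl | inj₂ 2∣l with prime⇒irreducible prl 2∣l
    ...     | inj₂ refl = contradiction 2<k λ { (s≤s ()) }

  choose : ∀ T′ c → All Prime T′ → Descending T′ → 2 ∈ T′ → 1 ≤ c → Prime (1 + c * product T′) → ¬ (1 + c * product T′ ∈ E) → Choice T′ c
  choose (l ∷ []) c _ _ (here refl) 1≤c pr p∉E with 33 ≤? c
  ... | yes 33≤c = [] , 2 ∷ [] , refl , power-of-two c 33≤c
  choose (l ∷ []) (suc c) _ _ (here refl) _ pr p∉E | no 33≰c =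
    ⊥-elim (excluded-sound (1 + suc c * 2) pr p∉E (excluded-at-sound c (s≤s⁻¹ (≰⇒> 33≰c))))
  choose (zero ∷ _ ∷ _) c (pr ∷ _) _ _ _ _ _ = contradiction pr ¬prime[0]
  choose (suc a ∷ zero ∷ _) c (_ ∷ pr ∷ _) _ _ _ _ _ = contradiction pr ¬prime[0]
  choose (suc a ∷ suc b ∷ S) c (pra ∷ prb ∷ prs) ((b<a ∷ S<a) ∷ (S<b ∷ desc)) 2∈ 1≤c pr p∉E with 22 ≤? b
  ... | yes 22≤b = suc a ∷ suc b ∷ [] , S , refl ,
        two-large-primes a b S c 22≤b (s≤s⁻¹ (odd-gap prb pra (≤-trans (m≤m+n 3 20) (s≤s 22≤b)) b<a)) 1≤c (all-≥2 prs) (All.map s≤s⁻¹ S<b) desc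
  ... | no b<22 = smooth (289 ≤? c * suc a)
    where
    S′ = suc b ∷ S
    b<23 : suc b < 23
    b<23 = s≤s (≰⇒> b<22)
    S′⊆ : S′ ⊆ small-primes
    S′⊆ = descending-⊆ small-primes (S<b ∷ desc)
      (All.zipWith (λ { (prl , l<) → ∈-small-primes _ prl l< }) ((prb ∷ prs) , (b<23 ∷ All.map (λ l<b → <-trans l<b b<23) S<b))) small-primes-descending
    2≤b : 2 ≤ suc b
    2≤b = prime≥2 prb
    2∈S′ : 2 ∈ S′
    2∈S′ = strip 2∈
      where
      strip : 2 ∈ suc a ∷ S′ → 2 ∈ S′
      strip (here refl) = contradiction (≤-trans b<a 2≤b) (<-irrefl refl)
      strip (there 2∈) = 2∈
    smooth : Dec (289 ≤ c * suc a) → Choice (suc a ∷ S′) c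
    -- All primes but the largest are below 23 and c (a + 1) ≤ 288: this is a finite family, covered
    -- by the evaluated check.
    smooth (no w≱) = choice-sound (suc a ∷ S′) c pr p∉E
      (small-cofactor a (suc b) S c (small-at S′⊆ 2∈S′) b<a pra 1≤c (≰⇒> w≱))
    smooth (yes w≥) with 4 ≤? a
    ... | yes 4≤a = large-cofactor a S′ c (large-at S′⊆ 2∈S′) 4≤a w≥
    -- The largest prime is now at most 4, hence it is 3, and 2 is the only other one.
    ... | no a<4 = three a b S (≰⇒> a<4) b<a 2≤b pra prs S<b w≥
      where
      three : ∀ a b S → a < 4 → suc b < suc a → 2 ≤ suc b → Prime (suc a) → All Prime S → All (_< suc b) S → 289 ≤ c * suc a → Choice (suc a ∷ suc b ∷ S) c
      three 2 1 [] _ _ _ _ _ _ w≥ = 3 ∷ [] , 2 ∷ [] , refl , three-smooth c w≥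
      three 2 1 (s ∷ S) _ _ _ _ (prs ∷ _) (s<2 ∷ _) _ = contradiction s<2 (≤⇒≯ (prime≥2 prs))
      three 3 b S _ _ _ pr4 _ _ _ = ⊥-elim (divisor-below-sound 1 4 _ pr4)
      three (suc (suc (suc (suc _)))) b S (s≤s (s≤s (s≤s (s≤s ())))) _ _ _ _ _ _
      three 0 b S _ (s≤s ()) _ _ _ _ _
      three 1 zero S _ _ (s≤s ()) _ _ _ _
      three 1 (suc b) S _ (s≤s (s≤s ())) _ _ _ _ _
      three 2 zero S _ _ (s≤s ()) _ _ _ _
      three 2 (suc (suc b)) S _ (s≤s (s≤s (s≤s ()))) _ _ _ _ _

open import Defs
open import Data.Nat using (ℕ; _<_; NonZero)
open import Data.Nat.DivMod using (_%_)
open import Data.Nat.Primality using (Prime)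
open import Data.List.Membership.Propositional using (_∈_)

-- The field of residues modulo p.

module PrimeField (p : ℕ) .{{_ : NonZero p}} (isPrime : Prime p) where

  open import Algebra.Structures using (IsCommutativeRing)
  open import Data.Nat.Base as ℕ using (zero; suc; _∸_; s≤s; z≤n; _≤_)
  open import Data.Nat.Coprimality as Coprimality using (prime⇒coprime; coprime-Bézout)
  open import Data.Nat.DivMod
  open import Data.Nat.GCD using (module Bézout)
  open import Data.Nat.Primality using (prime⇒nonTrivial)
  import Data.Nat.Properties as ℕₚ
  open import Data.Empty using (⊥-elim-irr)

  -- The bound is irrelevant, so residues with equal values are equal; `relevant` recovers the bound
  -- by deciding it.
  record 𝔽 : Set where
    constructor residue
    field
      val    : ℕ
      .bound : val < p
  open 𝔽 public

  residue-≡ : ∀ {a b : ℕ} .{a< : a < p} .{b< : b < p} → a ≡ b → residue a a< ≡ residue b b<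
  residue-≡ refl = refl

  0%p≡0 : 0 % p ≡ 0
  0%p≡0 = m*n%n≡0 0 p

  private
    relevant : ∀ {a} → .(a < p) → a < p
    relevant {a} a<p with a ℕₚ.<? p
    ... | yes lt = lt
    ... | no ¬lt = ⊥-elim-irr (¬lt a<p)

  infixl 7 _*ᵖ_
  infixl 6 _+ᵖ_

  opaque
    [_] : ℕ → 𝔽
    [ a ] = residue (a % p) (m%n<n a p)

    _+ᵖ_ _*ᵖ_ : 𝔽 → 𝔽 → 𝔽
    x +ᵖ y = [ val x ℕ.+ val y ]
    x *ᵖ y = [ val x ℕ.* val y ]

    neg : 𝔽 → 𝔽
    neg x = [ p ∸ val x ]

    val-[] : ∀ a → val [ a ] ≡ a % p
    val-[] a = refl

    []-cong : ∀ {a b} → a % p ≡ b % p → [ a ] ≡ [ b ]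
    []-cong = residue-≡

    [val] : ∀ x → [ val x ] ≡ x
    [val] (residue a a<p) = residue-≡ (m<n⇒m%n≡m (relevant a<p))

    +-def : ∀ x y → x +ᵖ y ≡ [ val x ℕ.+ val y ]
    +-def x y = refl

    *-def : ∀ x y → x *ᵖ y ≡ [ val x ℕ.* val y ]
    *-def x y = refl

    neg-def : ∀ x → neg x ≡ [ p ∸ val x ]
    neg-def x = refl

    []-+ : ∀ a b → [ a ] +ᵖ [ b ] ≡ [ a ℕ.+ b ]
    []-+ a b = []-cong (sym (%-distribˡ-+ a b p))

    []-* : ∀ a b → [ a ] *ᵖ [ b ] ≡ [ a ℕ.* b ]
    []-* a b = []-cong (sym (%-distribˡ-* a b p))

  []-injective : ∀ {a b} → [ a ] ≡ [ b ] → a % p ≡ b % p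
  []-injective {a} {b} eq = trans (sym (val-[] a)) (trans (cong val eq) (val-[] b))

  private
    +[] : ∀ x b → x +ᵖ [ b ] ≡ [ val x ℕ.+ b ]
    +[] x b = trans (cong (_+ᵖ [ b ]) (sym ([val] x))) ([]-+ (val x) b)

    *[] : ∀ x b → x *ᵖ [ b ] ≡ [ val x ℕ.* b ]
    *[] x b = trans (cong (_*ᵖ [ b ]) (sym ([val] x))) ([]-* (val x) b)

    assoc+ : ∀ x y z → (x +ᵖ y) +ᵖ z ≡ x +ᵖ (y +ᵖ z)
    assoc+ x y z = begin
      (x +ᵖ y) +ᵖ z                         ≡⟨ cong₂ _+ᵖ_ (+-def x y) (sym ([val] z)) ⟩
      [ val x ℕ.+ val y ] +ᵖ [ val z ]       ≡⟨ []-+ _ _ ⟩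
      [ val x ℕ.+ val y ℕ.+ val z ]           ≡⟨ cong [_] (ℕₚ.+-assoc (val x) (val y) (val z)) ⟩
      [ val x ℕ.+ (val y ℕ.+ val z) ]         ≡⟨ +[] x _ ⟨
      x +ᵖ [ val y ℕ.+ val z ]               ≡⟨ cong (x +ᵖ_) (+-def y z) ⟨
      x +ᵖ (y +ᵖ z)                         ∎
      where open ≡-Reasoning

    assoc* : ∀ x y z → (x *ᵖ y) *ᵖ z ≡ x *ᵖ (y *ᵖ z)
    assoc* x y z = begin
      (x *ᵖ y) *ᵖ z                           ≡⟨ cong₂ _*ᵖ_ (*-def x y) (sym ([val] z)) ⟩
      [ val x ℕ.* val y ] *ᵖ [ val z ]        ≡⟨ []-* _ _ ⟩
      [ val x ℕ.* val y ℕ.* val z ]           ≡⟨ cong [_] (ℕₚ.*-assoc (val x) (val y) (val z)) ⟩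
      [ val x ℕ.* (val y ℕ.* val z) ]         ≡⟨ *[] x _ ⟨
      x *ᵖ [ val y ℕ.* val z ]                ≡⟨ cong (x *ᵖ_) (*-def y z) ⟨
      x *ᵖ (y *ᵖ z)                           ∎
      where open ≡-Reasoning

    comm+ : ∀ x y → x +ᵖ y ≡ y +ᵖ x
    comm+ x y = trans (+-def x y) (trans (cong [_] (ℕₚ.+-comm (val x) (val y))) (sym (+-def y x)))

    comm* : ∀ x y → x *ᵖ y ≡ y *ᵖ x
    comm* x y = trans (*-def x y) (trans (cong [_] (ℕₚ.*-comm (val x) (val y))) (sym (*-def y x)))

    identity+ : ∀ x → [ 0 ] +ᵖ x ≡ x
    identity+ x = trans (cong ([ 0 ] +ᵖ_) (sym ([val] x))) (trans ([]-+ 0 (val x)) ([val] x))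

    identity* : ∀ x → [ 1 ] *ᵖ x ≡ x
    identity* x = trans (cong ([ 1 ] *ᵖ_) (sym ([val] x))) (trans ([]-* 1 (val x)) (trans (cong [_] (ℕₚ.*-identityˡ (val x))) ([val] x)))

    inverse+ : ∀ x → x +ᵖ neg x ≡ [ 0 ]
    inverse+ x@(residue a a<p) = trans (cong (x +ᵖ_) (neg-def x)) (trans (+[] x (p ∸ a))
      (trans (cong [_] (ℕₚ.m+[n∸m]≡n (ℕₚ.<⇒≤ (relevant a<p)))) ([]-cong (trans (n%n≡0 p) (sym 0%p≡0)))))

    distrib : ∀ x y z → x *ᵖ (y +ᵖ z) ≡ x *ᵖ y +ᵖ x *ᵖ z
    distrib x y z = begin
      x *ᵖ (y +ᵖ z)                                      ≡⟨ cong (x *ᵖ_) (+-def y z) ⟩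
      x *ᵖ [ val y ℕ.+ val z ]                            ≡⟨ *[] x _ ⟩
      [ val x ℕ.* (val y ℕ.+ val z) ]                     ≡⟨ cong [_] (ℕₚ.*-distribˡ-+ (val x) (val y) (val z)) ⟩
      [ val x ℕ.* val y ℕ.+ val x ℕ.* val z ]             ≡⟨ []-+ _ _ ⟨
      [ val x ℕ.* val y ] +ᵖ [ val x ℕ.* val z ]         ≡⟨ cong₂ _+ᵖ_ (*-def x y) (*-def x z) ⟨
      x *ᵖ y +ᵖ x *ᵖ z                                   ∎
      where open ≡-Reasoning

  isCommutativeRing : IsCommutativeRing _≡_ _+ᵖ_ _*ᵖ_ neg [ 0 ] [ 1 ]
  isCommutativeRing = record
    { isRing = record
      { +-isAbelianGroup = record
        { isGroup = record
          { isMonoid = record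
            { isSemigroup = record
              { isMagma = record { isEquivalence = Relation.Binary.PropositionalEquality.isEquivalence ; ∙-cong = cong₂ _+ᵖ_ }
              ; assoc = assoc+ }
            ; identity = identity+ , λ x → trans (comm+ x _) (identity+ x) }
          ; inverse = (λ x → trans (comm+ (neg x) x) (inverse+ x)) , inverse+
          ; ⁻¹-cong = cong neg }
        ; comm = comm+ }
      ; *-cong = cong₂ _*ᵖ_
      ; *-assoc = assoc*
      ; *-identity = identity* , λ x → trans (comm* x _) (identity* x)
      ; distrib = distrib , λ x y z → trans (comm* (y +ᵖ z) x) (trans (distrib x y z) (cong₂ _+ᵖ_ (comm* x y) (comm* x z))) }
    ; *-comm = comm* }
    where import Relation.Binary.PropositionalEquality

  2≤p : 2 ≤ p
  2≤p = ℕ.nonTrivial⇒n>1 p ⦃ prime⇒nonTrivial isPrime ⦄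

  nonzero : ∀ j → 1 ≤ j → j < p → [ j ] ≢ [ 0 ]
  nonzero j 1≤j j<p eq = ℕₚ.<⇒≢ 1≤j (sym (trans (sym (m<n⇒m%n≡m j<p)) (trans ([]-injective eq) 0%p≡0)))

  private
    inverse : ∀ x → x ≢ [ 0 ] → ∃ λ y → x *ᵖ y ≡ [ 1 ]
    inverse x@(residue zero 0<p) x≢0 = contradiction (sym ([val] x)) x≢0
    inverse x@(residue a@(suc _) a<p) x≢0 with coprime-Bézout (prime⇒coprime isPrime (relevant a<p))
    ... | Bézout.-+ s t eq = [ t ] , (begin
      x *ᵖ [ t ]             ≡⟨ cong (_*ᵖ [ t ]) ([val] x) ⟨
      [ a ] *ᵖ [ t ]         ≡⟨ []-* a t ⟩
      [ a ℕ.* t ]            ≡⟨ cong [_] (trans (ℕₚ.*-comm a t) (sym eq)) ⟩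
      [ 1 ℕ.+ s ℕ.* p ]      ≡⟨ []-cong ([m+kn]%n≡m%n 1 s p) ⟩
      [ 1 ]                  ∎)
      where open ≡-Reasoning
    -- Here 1 + t a = s p, so the inverse of `a` is - t.
    ... | Bézout.+- s t eq = neg [ t ] , (begin
      x *ᵖ neg [ t ]                              ≡⟨ identity+′ _ ⟨
      x *ᵖ neg [ t ] +ᵖ [ 0 ]                     ≡⟨ cong (x *ᵖ neg [ t ] +ᵖ_) one+ ⟨
      x *ᵖ neg [ t ] +ᵖ ([ 1 ] +ᵖ x *ᵖ [ t ])     ≡⟨ cong (x *ᵖ neg [ t ] +ᵖ_) (comm+ _ _) ⟩
      x *ᵖ neg [ t ] +ᵖ (x *ᵖ [ t ] +ᵖ [ 1 ])     ≡⟨ assoc+ _ _ _ ⟨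
      (x *ᵖ neg [ t ] +ᵖ x *ᵖ [ t ]) +ᵖ [ 1 ]     ≡⟨ cong (_+ᵖ [ 1 ]) (distrib x _ _) ⟨
      x *ᵖ (neg [ t ] +ᵖ [ t ]) +ᵖ [ 1 ]         ≡⟨ cong (λ z → x *ᵖ z +ᵖ [ 1 ]) (trans (comm+ _ _) (inverse+ [ t ])) ⟩
      x *ᵖ [ 0 ] +ᵖ [ 1 ]                        ≡⟨ cong (_+ᵖ [ 1 ]) (trans (*[] x 0) (cong [_] (ℕₚ.*-zeroʳ a))) ⟩
      [ 0 ] +ᵖ [ 1 ]                             ≡⟨ identity+ [ 1 ] ⟩
      [ 1 ]                                      ∎)
      where
      open ≡-Reasoning
      identity+′ : ∀ y → y +ᵖ [ 0 ] ≡ y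
      identity+′ y = trans (comm+ y _) (identity+ y)
      one+ : [ 1 ] +ᵖ x *ᵖ [ t ] ≡ [ 0 ]
      one+ = begin
        [ 1 ] +ᵖ x *ᵖ [ t ]       ≡⟨ cong (λ z → [ 1 ] +ᵖ z *ᵖ [ t ]) ([val] x) ⟨
        [ 1 ] +ᵖ [ a ] *ᵖ [ t ]   ≡⟨ cong ([ 1 ] +ᵖ_) ([]-* a t) ⟩
        [ 1 ] +ᵖ [ a ℕ.* t ]      ≡⟨ []-+ 1 (a ℕ.* t) ⟩
        [ 1 ℕ.+ a ℕ.* t ]         ≡⟨ cong [_] (trans (cong suc (ℕₚ.*-comm a t)) eq) ⟩
        [ s ℕ.* p ]               ≡⟨ []-cong (trans (m*n%n≡0 s p) (sym 0%p≡0)) ⟩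
        [ 0 ]                     ∎

  field-p : DecidableField
  field-p = record
    { F = 𝔽 ; _+_ = _+ᵖ_ ; _*_ = _*ᵖ_ ; -_ = neg ; 0# = [ 0 ] ; 1# = [ 1 ]
    ; isCommutativeRing = isCommutativeRing
    ; _≟_ = λ { (residue a _) (residue b _) → decide a b }
    ; 1≢0 = nonzero 1 (s≤s z≤n) 2≤p
    ; invertible = inverse }
    where
    decide : ∀ a b .{a< : a < p} .{b< : b < p} → Dec (residue a a< ≡ residue b b<)
    decide a b with a ℕₚ.≟ b
    ... | yes a≡b = yes (residue-≡ a≡b)
    ... | no a≢b = no λ eq → a≢b (cong val eq)

-- Transfer between natural numbers modulo p and the field.

module Translation (p : ℕ) .{{_ : NonZero p}} (isPrime : Prime p) where

  open PrimeField p isPrime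
  module K = Polynomials field-p
  open K using (ι; _≈_; at; _⊛_; C; _^_; coeff-⊛-zero; coeff-⊛-suc; coeff-C⊛)
  open import Data.List.Base using (List; []; _∷_; map)
  open import Data.Nat.Base as ℕ using (zero; suc)
  import Data.Nat.Properties as ℕₚ

  ι≡ : ∀ j → ι j ≡ [ j ]
  ι≡ zero = refl
  ι≡ (suc j) = trans (cong ([ 1 ] +ᵖ_) (ι≡ j)) ([]-+ 1 j)

  []-^ : ∀ a k → [ a ℕ.^ k ] ≡ [ a ] ^ k
  []-^ a zero = refl
  []-^ a (suc k) = trans (sym ([]-* a (a ℕ.^ k))) (cong ([ a ] *ᵖ_) ([]-^ a k))

  coeff-map : ∀ f i → K.coeff (map [_] f) i ≡ [ coeff f i ]
  coeff-map [] i = refl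
  coeff-map (a ∷ f) zero = refl
  coeff-map (a ∷ f) (suc i) = coeff-map f i

  eval-map : ∀ f a → K.eval (map [_] f) [ a ] ≡ [ eval f a ]
  eval-map [] a = refl
  eval-map (b ∷ f) a = trans (cong (λ z → [ b ] +ᵖ [ a ] *ᵖ z) (eval-map f a))
    (trans (cong ([ b ] +ᵖ_) ([]-* a (eval f a))) ([]-+ b (a ℕ.* eval f a)))

  map-val : ∀ (f : List 𝔽) → map [_] (map val f) ≡ f
  map-val [] = refl
  map-val (x ∷ f) = cong₂ _∷_ ([val] x) (map-val f)

  coeff-+ₚ : ∀ f g i → coeff (f +ₚ g) i ≡ coeff f i ℕ.+ coeff g i
  coeff-+ₚ [] g i = refl
  coeff-+ₚ (a ∷ f) [] i = sym (ℕₚ.+-identityʳ _)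
  coeff-+ₚ (a ∷ f) (b ∷ g) zero = refl
  coeff-+ₚ (a ∷ f) (b ∷ g) (suc i) = coeff-+ₚ f g i

  coeff-scale : ∀ c f i → coeff (scale c f) i ≡ c ℕ.* coeff f i
  coeff-scale c [] i = sym (ℕₚ.*-zeroʳ c)
  coeff-scale c (a ∷ f) zero = refl
  coeff-scale c (a ∷ f) (suc i) = coeff-scale c f i

  coeff-*ₚ : ∀ f g i → K.coeff (map [_] f ⊛ map [_] g) i ≡ [ coeff (f *ₚ g) i ]
  coeff-*ₚ [] g i = K.P.zeroˡ (map [_] g) .at i
  coeff-*ₚ (a ∷ f) g zero = begin
    K.coeff (map [_] (a ∷ f) ⊛ map [_] g) 0       ≡⟨ coeff-⊛-zero [ a ] (map [_] f) (map [_] g) ⟩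
    [ a ] *ᵖ K.coeff (map [_] g) 0                ≡⟨ cong ([ a ] *ᵖ_) (coeff-map g 0) ⟩
    [ a ] *ᵖ [ coeff g 0 ]                        ≡⟨ []-* a (coeff g 0) ⟩
    [ a ℕ.* coeff g 0 ]                           ≡⟨ cong [_] (trans (coeff-+ₚ (scale a g) (0 ∷ (f *ₚ g)) 0) (trans (ℕₚ.+-identityʳ _) (coeff-scale a g 0))) ⟨
    [ coeff ((a ∷ f) *ₚ g) 0 ]                    ∎
    where open ≡-Reasoning
  coeff-*ₚ (a ∷ f) g (suc i) = begin
    K.coeff (map [_] (a ∷ f) ⊛ map [_] g) (suc i)             ≡⟨ coeff-⊛-suc [ a ] (map [_] f) (map [_] g) i ⟩
    [ a ] *ᵖ K.coeff (map [_] g) (suc i) +ᵖ K.coeff (map [_] f ⊛ map [_] g) i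
                                                              ≡⟨ cong₂ _+ᵖ_ (trans (cong ([ a ] *ᵖ_) (coeff-map g (suc i))) ([]-* a (coeff g (suc i)))) (coeff-*ₚ f g i) ⟩
    [ a ℕ.* coeff g (suc i) ] +ᵖ [ coeff (f *ₚ g) i ]         ≡⟨ []-+ _ _ ⟩
    [ a ℕ.* coeff g (suc i) ℕ.+ coeff (f *ₚ g) i ]            ≡⟨ cong [_] (trans (coeff-+ₚ (scale a g) (0 ∷ (f *ₚ g)) (suc i)) (cong (ℕ._+ coeff (f *ₚ g) i) (coeff-scale a g (suc i)))) ⟨
    [ coeff ((a ∷ f) *ₚ g) (suc i) ]                          ∎
    where open ≡-Reasoning

  -- From a f = g² follows f = a⁻¹ g²; the representatives of a⁻¹ and of the coefficients of g form
  -- the required witness.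
  nonsquare : ∀ f → ¬ IsConstTimesSquare p f → ∀ a g → a ≢ [ 0 ] → ¬ C a ⊛ map [_] f ≈ g ⊛ g
  nonsquare f ¬square a g a≢0 af≈g² = ¬square (val b , map val g , λ i → []-injective (equal i))
    where
    open ≡-Reasoning
    b = proj₁ (DecidableField.invertible field-p a a≢0)
    ab≡1 : a *ᵖ b ≡ [ 1 ]
    ab≡1 = proj₂ (DecidableField.invertible field-p a a≢0)
    g′ = map val g
    equal : ∀ i → [ coeff f i ] ≡ [ coeff (scale (val b) (g′ *ₚ g′)) i ]
    equal i = begin
      [ coeff f i ]                                  ≡⟨ coeff-map f i ⟨
      K.coeff (map [_] f) i                          ≡⟨ K.*-identityˡ _ ⟨
      [ 1 ] *ᵖ K.coeff (map [_] f) i                 ≡⟨ cong (_*ᵖ K.coeff (map [_] f) i) ab≡1 ⟨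
      (a *ᵖ b) *ᵖ K.coeff (map [_] f) i              ≡⟨ trans (cong (_*ᵖ K.coeff (map [_] f) i) (K.*-comm a b)) (K.*-assoc b a _) ⟩
      b *ᵖ (a *ᵖ K.coeff (map [_] f) i)              ≡⟨ cong (b *ᵖ_) (coeff-C⊛ a (map [_] f) i) ⟨
      b *ᵖ K.coeff (C a ⊛ map [_] f) i               ≡⟨ cong (b *ᵖ_) (af≈g² .at i) ⟩
      b *ᵖ K.coeff (g ⊛ g) i                         ≡⟨ cong (λ h → b *ᵖ K.coeff (h ⊛ h) i) (map-val g) ⟨
      b *ᵖ K.coeff (map [_] g′ ⊛ map [_] g′) i       ≡⟨ cong₂ _*ᵖ_ (sym ([val] b)) (coeff-*ₚ g′ g′ i) ⟩
      [ val b ] *ᵖ [ coeff (g′ *ₚ g′) i ]            ≡⟨ []-* (val b) _ ⟩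
      [ val b ℕ.* coeff (g′ *ₚ g′) i ]               ≡⟨ cong [_] (coeff-scale (val b) (g′ *ₚ g′) i) ⟨
      [ coeff (scale (val b) (g′ *ₚ g′)) i ]         ∎

-- Assembly of the theorem over the residue field.

module Main (q : ℕ) (isPrime : Prime (ℕ.suc q)) where

  open PrimeField (ℕ.suc q) isPrime
  open Translation (ℕ.suc q) isPrime
  open Polynomials field-p using (ι; _^_)
  open Divisibility field-p using (Deg<)
  open SquareValues field-p
  open PrimeCharacteristic field-p using (module Cyclic)
  open Lists
  open Parameters
  open ParameterSearch using (Choice)
  open ParameterChoice
  open import Data.List.Base using (map; _++_)
  open import Data.Nat.Base as ℕ using (zero; suc; s≤s; z≤n; _≤_)
  open import Data.Nat.Divisibility using (divides)
  open import Data.Nat.DivMod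
  open import Data.Nat.ListAction using (product)
  open import Data.Nat.Primality using (prime[2]; prime⇒irreducible)
  import Data.Nat.Properties as ℕₚ
  open import Data.Nat.Solver using (module +-*-Solver)
  open import Data.Sum.Base using (_⊎_; inj₁; inj₂)

  p : ℕ
  p = suc q

  1≤q : 1 ≤ q
  1≤q = ℕ.s≤s⁻¹ 2≤p

  ι-char : ι p ≡ [ 0 ]
  ι-char = trans (ι≡ p) ([]-cong (trans (n%n≡0 p) (sym 0%p≡0)))

  ι-small : ∀ j → 1 ≤ j → j ≤ q → ι j ≢ [ 0 ]
  ι-small j 1≤j j≤q eq = nonzero j 1≤j (s≤s j≤q) (trans (sym (ι≡ j)) eq)

  ι-onto : ∀ x → ∃[ j ] (j ≤ q × x ≡ ι j)
  ι-onto x = val x % p , ℕ.s≤s⁻¹ (m%n<n (val x) p) , trans (sym (trans ([]-cong (m%n%n≡m%n (val x) p)) ([val] x))) (sym (ι≡ (val x % p)))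

  open Cyclic q 1≤q ι-char ι-small ι-onto using (generates)

  even : p ≢ 2 → ∃[ h ] (h ℕ.+ h ≡ q)
  even p≢2 with halves q
    where
    halves : ∀ n → ∃[ h ] (h ℕ.+ h ≡ n ⊎ suc (h ℕ.+ h) ≡ n)
    halves zero = 0 , inj₁ refl
    halves (suc n) with halves n
    ... | h , inj₁ e = h , inj₂ (cong suc e)
    ... | h , inj₂ o = suc h , inj₁ (cong suc (trans (ℕₚ.+-suc h h) o))
  ... | h , inj₁ e = h , e
  ... | h , inj₂ o with prime⇒irreducible isPrime (divides (suc h) (trans (cong suc (sym o)) (solve 1 (λ h → con 2 :+ (h :+ h) := (con 1 :+ h) :* con 2) refl h)))
    where open +-*-Solver
  ...   | inj₂ 2≡p = contradiction (sym 2≡p) p≢2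

  theorem : p ≢ 2 → ¬ (p ∈ E) → (a₀ a₁ a₂ a₃ a₄ : ℕ) → a₀ % p ≢ 0 →
    ¬ IsConstTimesSquare p (quartic a₀ a₁ a₂ a₃ a₄) →
    ∃[ β ] (β < p × IsPrimitiveRoot p β × IsSquareMod p (eval (quartic a₀ a₁ a₂ a₃ a₄) β))
  theorem p≢2 p∉E a₀ a₁ a₂ a₃ a₄ a₀≢0 ¬square = conclude
      (square-value q 1≤q ι-char ι-small ι-onto O S c half f (subst PairwiseCoprime (sym O++S≡) coprimes)
        c*ΠOS≡q half+half≡q 1≤half hf f₀≢0 (nonsquare f₀ ¬square)
        l′ B′ H r small (subst (H ℕ.* 2 ℕ.+ 1 ≤_) c*ΠOS≡q levels) r≤N enough many)
    where
    f₀ = quartic a₀ a₁ a₂ a₃ a₄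
    f = map [_] f₀
    half = proj₁ (even p≢2)
    half+half≡q : half ℕ.+ half ≡ q
    half+half≡q = proj₂ (even p≢2)
    1≤half : 1 ≤ half
    1≤half = positive-half half half+half≡q
      where
      positive-half : ∀ h → h ℕ.+ h ≡ q → 1 ≤ h
      positive-half zero e = subst (1 ≤_) (sym e) 1≤q
      positive-half (suc h) _ = s≤s z≤n
    primes-q = prime-list q 1≤q
    open PrimeList primes-q
    coprimes : PairwiseCoprime T-list
    coprimes = pairwise-coprime primes descending
    c = proj₁ (product-divides q coprimes dividing)
    c*Π≡q : c ℕ.* product T-list ≡ q
    c*Π≡q = proj₂ (product-divides q coprimes dividing)
    1≤c : 1 ≤ c
    1≤c = left-factor c (product T-list) (subst (1 ≤_) (sym c*Π≡q) 1≤q)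
      where
      left-factor : ∀ a b → 1 ≤ a ℕ.* b → 1 ≤ a
      left-factor (suc a) b _ = s≤s z≤n
    2∈T : 2 ∈ T-list
    2∈T = complete prime[2] (divides half (trans (sym half+half≡q) (solve 1 (λ h → h :+ h := h :* con 2) refl half)))
      where open +-*-Solver
    choice : Choice T-list c
    choice = choose T-list c primes descending 2∈T 1≤c
      (subst (λ z → Prime (suc z)) (sym c*Π≡q) isPrime) (subst (λ z → ¬ (suc z ∈ E)) (sym c*Π≡q) p∉E)
    O = proj₁ choice
    S = proj₁ (proj₂ choice)
    O++S≡ : O ++ S ≡ T-list
    O++S≡ = proj₁ (proj₂ (proj₂ choice))
    c*ΠOS≡q : c ℕ.* product (O ++ S) ≡ q
    c*ΠOS≡q = trans (cong (λ T → c ℕ.* product T) O++S≡) c*Π≡q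
    open Admissible (proj₂ (proj₂ (proj₂ choice)))
    hf : Deg< 5 f
    hf (suc (suc (suc (suc (suc i))))) _ = refl
    hf (suc (suc (suc (suc zero)))) (s≤s (s≤s (s≤s (s≤s ()))))
    hf (suc (suc (suc zero))) (s≤s (s≤s (s≤s ())))
    hf (suc (suc zero)) (s≤s (s≤s ()))
    hf (suc zero) (s≤s ())
    f₀≢0 : [ a₀ ] ≢ [ 0 ]
    f₀≢0 eq = a₀≢0 (trans ([]-injective eq) 0%p≡0)
    Prim-q = Cyclic.Prim q 1≤q ι-char ι-small ι-onto
    conclude : ∃[ x ] (x ≢ [ 0 ] × Prim-q (O ++ S) q x × ∃[ z ] z *ᵖ z ≡ K.eval f x) →
               ∃[ β ] (β < p × IsPrimitiveRoot p β × IsSquareMod p (eval f₀ β))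
    conclude (x , x≢0 , prim , z , z²≡) = β , m%n<n (val x) p , ((λ β≡0 → x≢0 (trans (sym x≡) ([]-cong (trans β≡0 (sym 0%p≡0))))) , powers) ,
        val z , []-injective (trans (sym (*-def z z)) (trans z²≡ (trans (cong (K.eval f) (sym x≡)) (eval-map f₀ β))))
      where
      -- The bound on `val x` is irrelevant and cannot be returned; reduction modulo p gives the
      -- same residue with a usable proof of β < p.
      β = val x % p
      x≡ : [ β ] ≡ x
      x≡ = trans ([]-cong (m%n%n≡m%n (val x) p)) ([val] x)
      powers : ∀ y → 1 ≤ y → y < p → ∃[ k ] (β ℕ.^ k) % p ≡ y
      powers y 1≤y y<p =
        let (k , xᵏ≡y) = generates {O ++ S} (λ pr d → subst (_ ∈_) (sym O++S≡) (complete pr d)) x≢0 prim [ y ] (nonzero y 1≤y y<p)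
        in k , trans ([]-injective (trans ([]-^ β k) (trans (cong (_^ k) x≡) xᵏ≡y))) (m<n⇒m%n≡m y<p)

theorem3p1 : (p : ℕ) .{{_ : NonZero p}} → Prime p → p ≢ 2 → ¬ (p ∈ E) →
    (a₀ a₁ a₂ a₃ a₄ : ℕ) → a₄ % p ≢ 0 → a₀ % p ≢ 0 →
    ¬ IsConstTimesSquare p (quartic a₀ a₁ a₂ a₃ a₄) →
    ∃[ β ] (β < p × IsPrimitiveRoot p β × IsSquareMod p (eval (quartic a₀ a₁ a₂ a₃ a₄) β))
theorem3p1 (ℕ.suc q) isPrime p≢2 p∉E a₀ a₁ a₂ a₃ a₄ _ a₀≢0 ¬square = Main.theorem q isPrime p≢2 p∉E a₀ a₁ a₂ a₃ a₄ a₀≢0 ¬square
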